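{- Let $p$ be an odd prime. Then $$\sum_{k=0}^{\frac{p-1}2}\frac{\binom{2k}k^2}{32^k}\equiv\begin{cases}0\pmod{p^2}&\text{if }4\mid p-3,\\ 2a-\frac{p}{2a}\pmod{p^2}&\text{if }4\mid p-1\text{ and }p=a^2+b^2\text{ with }a,b\in\mathbb Z,\ 4\mid a-1.\end{cases}$$
   Context: Congruences are between rational numbers whose denominators are prime to $p$. -}

module Defs where

open import Data.Integer.Base as ℤ using (ℤ; +_; -[1+_])
open import Data.Integer.Divisibility using (_∣_)
open import Data.Nat.Base as ℕ using (ℕ; suc; _^_)
open import Data.Nat.Coprimality using (Coprime)
open import Data.Nat.Divisibility using (_∣?_)
open import Data.Rational.Base as ℚ using (ℚ; ↥_; ↧ₙ_)
open import Data.Rational.Literals using (fromℤ)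
open import Relation.Nullary.Decidable.Core using (from-no)
open import Relation.Nullary.Negation.Core using (contradiction)

-- Intended for prime p.  Elements of ℚ are stored in lowest terms, so x and y lie in the localisation
-- ℤ₍ₚ₎ exactly when their denominators are prime to p.  Then x - y also lies in
-- ℤ₍ₚ₎, and it is p ^ r times an element of ℤ₍ₚ₎ exactly when p ^ r divides its
-- reduced numerator.
infix 4 _≡_[mod_^_]

record _≡_[mod_^_] (x y : ℚ) (p r : ℕ) : Set where
  field
    denominatorˡ-coprime : Coprime (↧ₙ x) p
    denominatorʳ-coprime : Coprime (↧ₙ y) p
    numerator-divisible  : + (p ^ r) ∣ ↥ (x ℚ.- y)

4∣a-1⇒2a≢0 : ∀ a → + 4 ∣ a ℤ.- + 1 → ℚ.NonZero (fromℤ (+ 2 ℤ.* a))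
4∣a-1⇒2a≢0 (+ 0)       4∣-1 = contradiction 4∣-1 (from-no (4 ∣? 1))
4∣a-1⇒2a≢0 (+ (suc _)) _    = _
4∣a-1⇒2a≢0 -[1+ _ ]    _    = _

{-# OPTIONS --safe #-}

-- Put n = (p − 1)/2.  Since C(n,k) C(n+k,k) ≡ C(2k,k)² / (−16)^k (mod p²), the sum is congruent to
-- ∑ C(n,k) C(n+k,k) (−1/2)^k, which is 2^(−n) times the coefficient of x^n in (1 + x)^n (1 − x)^n.
-- This vanishes for odd n and equals (−1)^m C(2m,m) / 4^m for n = 2m.
--
-- Let p = 4m + 1 and let χ be the quadratic character.  As χ(v) ≡ v^(pn) (mod p²), Jacobsthal's sum
-- T(z) = ∑ χ(x) χ(x² + z) can be expanded modulo p² in power sums of the p-th powers x^p, and these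
-- are p − 1 or 0.  With ζ = z^(pm) this gives T(z) ≡ (p − 1)(U ζ + V ζ³), where p ∣ V, U V ≡ p and
-- (1 − p) U ≡ (−1)^m C(2m,m) / 4^m.  If g is a non-residue, then T(−1)² + T(g)² ≡ 4p (mod p²), and
-- both terms are so small that equality holds.  By uniqueness of p = a² + b² we get T(−1) = ± 2a, the
-- sign being found modulo 4, so that 2a ≡ (1 − p)(U + V) and p / 2a ≡ V.
module Submission where

-- Gauss's congruence 2a ≡ C(2m,m) holds only modulo p; reaching p² shapes the proof. Modulo p² the
-- power x^p depends only on x modulo p, and x ↦ x^p is multiplicative, so power sums of p-th powers
-- carry no error term. The price is the exponent pn on x² + z. Since p divides W^p - W, expanding
-- (W + (W^p - W))^n to first order replaces W^(pn) by a combination of W^n and W^(n+4m), that is,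
-- of W^(2m) and W^(6m). Their binomial expansions meet the nonzero power sums only at the indices
-- m, 3m and 5m: hence U comes from C(2m,m) and C(6m,m), and V from C(6m,3m). The link to C(2m,m) /
-- 4^m comes from comparing the product of the first m odd numbers with falling factorials at n and
-- n + p. For the sign, a sum of signs is known modulo 4 once their product is, and the product of
-- the terms χ(x) χ(x - 1) χ(x + 1) collapses to χ of a factorial and a few end factors. Inverses
-- modulo p² are avoided: relations are multiplied through by 32^n, 4^m or 2a, and units are
-- cancelled.

module CentralBinomialSum where

  import Algebra.Properties.Monoid.Sum
  import Algebra.Properties.Semiring.Sum
  open import Data.Fin.Base as Fin using (Fin; toℕ; fromℕ<)
  import Data.Fin.Permutation as Fin
  open import Data.Fin.Properties using (toℕ<n; toℕ-fromℕ<; toℕ-injective)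
  open import Data.Integer.Base as ℤ
    using (ℤ; +_; -[1+_]; 0ℤ; 1ℤ; -1ℤ; _+_; _-_; _*_; -_; _^_; ∣_∣)
  import Data.Integer.Divisibility as ℤᵘ
  open import Data.Integer.Divisibility.Signed using (∣ᵤ⇒∣; ∣⇒∣ᵤ; divides)
  open import Data.Integer.DivMod using (_%ℕ_; _/ℕ_; n%ℕd<d; a≡a%ℕn+[a/ℕn]*n)
  open import Data.Integer.Properties as ℤ
    using (+-*-semiring; +-assoc; +-comm; +-identityˡ; +-identityʳ; +-inverseʳ; *-assoc; *-comm;
           *-identityˡ; *-identityʳ; *-zeroˡ; *-zeroʳ; pos-*; ^-distribˡ-+-*; ^-*-assoc; ^-zeroˡ; abs-*)
  open import Data.Integer.Tactic.RingSolver using (solve-∀)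
  open import Data.Nat.Base as ℕ using (ℕ; zero; suc; _<_; _≤_; _∸_; s≤s; z≤n; _!)
  open import Data.Nat.Combinatorics
    using (_C_; nCk≡nC[n∸k]; k>n⇒nCk≡0; nCn≡1; nCk+nC[k+1]≡[n+1]C[k+1])
  open import Data.Nat.Coprimality as ℕ using (Coprime; coprime-divisor)
  import Data.Nat.Divisibility as ℕ
  import Data.Nat.DivMod as ℕ
  import Data.Nat.Induction as ℕ
  open import Data.Nat.Primality
    using (Prime; euclidsLemma; prime⇒nonTrivial; prime⇒irreducible)
  import Data.Nat.Properties as ℕ
  import Data.Nat.Tactic.RingSolver as ℕ
  open import Data.Product.Base using (_×_; _,_; ∃-syntax; proj₁; proj₂)
  open import Data.Rational.Base as ℚ using (ℚ; 0ℚ; ↥_; ↧_; ↧ₙ_)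
  open import Data.Rational.Literals using (fromℤ)
  import Data.Rational.Properties as ℚ
  import Data.Rational.Unnormalised.Base as ℚᵘ
  import Data.Rational.Unnormalised.Properties as ℚᵘ
  open import Data.Sum.Base using (_⊎_; inj₁; inj₂)
  open import Function.Base using (_∘_)
  open import Relation.Binary.Bundles using (Setoid)
  open import Relation.Binary.PropositionalEquality.Core
    using (_≡_; refl; sym; trans; cong; cong₂; subst; _≢_)
  open import Relation.Binary.PropositionalEquality.Properties using (module ≡-Reasoning)
  open import Relation.Nullary.Decidable.Core using (Dec; yes; no; map′; decidable-stable; ¬?)
  open import Relation.Nullary.Negation.Core using (¬_; contradiction)
  open import Defs

  private
    module Sum = Algebra.Properties.Semiring.Sum +-*-semiring
    module ℚ-Sum = Algebra.Properties.Monoid.Sum ℚ.+-0-monoid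

  -- Congruences

  infix 4 _≈_[_]

  -- The quotient is stored, so a congruence can be proved by an identity for the ring solver; being
  -- a record type, it lets unification recover x, y and N.
  record _≈_[_] (x y N : ℤ) : Set where
    constructor congruent
    field
      quotient   : ℤ
      difference : x - y ≡ quotient * N

  reflexive : ∀ {N x y} → x ≡ y → x ≈ y [ N ]
  reflexive {N} {x} refl = congruent 0ℤ (+-inverseʳ x)

  -- A certificate for congruences: once x - y is written as a combination of known differences plus
  -- a multiple of N, only a polynomial identity remains for `solve-∀`.
  lin₁ : ∀ {N x y a b} (s d : ℤ) → a ≈ b [ N ] →
         x - y ≡ s * (a - b) + d * N → x ≈ y [ N ]
  lin₁ {N} s d (congruent q e) eq = congruent (s * q + d)
    (trans eq (trans (cong (λ v → s * v + d * N) e) (lemma s q N d)))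
    where
    lemma : ∀ s q N d → s * (q * N) + d * N ≡ (s * q + d) * N
    lemma = solve-∀

  lin₂ : ∀ {N x y a b a′ b′} (s s′ d : ℤ) → a ≈ b [ N ] → a′ ≈ b′ [ N ] →
         x - y ≡ s * (a - b) + s′ * (a′ - b′) + d * N → x ≈ y [ N ]
  lin₂ {N} s s′ d (congruent q e) (congruent q′ e′) eq = congruent (s * q + s′ * q′ + d)
    (trans eq (trans (cong₂ (λ v v′ → s * v + s′ * v′ + d * N) e e′) (lemma s q N d s′ q′)))
    where
    lemma : ∀ s q N d s′ q′ → s * (q * N) + s′ * (q′ * N) + d * N ≡ (s * q + s′ * q′ + d) * N
    lemma = solve-∀

  lin₃ : ∀ {N x y a b a′ b′ a″ b″} (s s′ s″ d : ℤ) →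
         a ≈ b [ N ] → a′ ≈ b′ [ N ] → a″ ≈ b″ [ N ] →
         x - y ≡ s * (a - b) + s′ * (a′ - b′) + s″ * (a″ - b″) + d * N → x ≈ y [ N ]
  lin₃ {N} {a″ = a″} {b″} s s′ s″ d (congruent q e) (congruent q′ e′) (congruent q″ e″) eq =
    congruent (s * q + s′ * q′ + s″ * q″ + d)
    (trans eq (trans (cong₂ (λ v v′ → s * v + s′ * v′ + s″ * (a″ - b″) + d * N) e e′)
      (trans (cong (λ v → s * (q * N) + s′ * (q′ * N) + s″ * v + d * N) e″)
        (lemma s q N d s′ q′ s″ q″))))
    where
    lemma : ∀ s q N d s′ q′ s″ q″ →
            s * (q * N) + s′ * (q′ * N) + s″ * (q″ * N) + d * N ≡ (s * q + s′ * q′ + s″ * q″ + d) * N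
    lemma = solve-∀

  ≈-sym : ∀ {N x y} → x ≈ y [ N ] → y ≈ x [ N ]
  ≈-sym {N} {x} {y} h = lin₁ (- 1ℤ) 0ℤ h (lemma x y N)
    where
    lemma : ∀ x y N → y - x ≡ - 1ℤ * (x - y) + 0ℤ * N
    lemma = solve-∀

  ≈-trans : ∀ {N x y z} → x ≈ y [ N ] → y ≈ z [ N ] → x ≈ z [ N ]
  ≈-trans {N} {x} {y} {z} h h′ = lin₂ 1ℤ 1ℤ 0ℤ h h′ (lemma x y z N)
    where
    lemma : ∀ x y z N → x - z ≡ 1ℤ * (x - y) + 1ℤ * (y - z) + 0ℤ * N
    lemma = solve-∀

  ≈-refl : ∀ {N x} → x ≈ x [ N ]
  ≈-refl = reflexive refl

  ≈-setoid : ℤ → Setoid _ _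
  ≈-setoid N = record
    { Carrier = ℤ ; _≈_ = λ x y → x ≈ y [ N ]
    ; isEquivalence = record { refl = ≈-refl ; sym = ≈-sym ; trans = ≈-trans } }

  module ≈-Reasoning (N : ℤ) where
    open import Relation.Binary.Reasoning.Setoid (≈-setoid N) public

  +-cong : ∀ {N x y u v} → x ≈ y [ N ] → u ≈ v [ N ] → x + u ≈ y + v [ N ]
  +-cong {N} {x} {y} {u} {v} h h′ = lin₂ 1ℤ 1ℤ 0ℤ h h′ (lemma x y u v N)
    where
    lemma : ∀ x y u v N → x + u - (y + v) ≡ 1ℤ * (x - y) + 1ℤ * (u - v) + 0ℤ * N
    lemma = solve-∀

  *-cong : ∀ {N x y u v} → x ≈ y [ N ] → u ≈ v [ N ] → x * u ≈ y * v [ N ]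
  *-cong {N} {x} {y} {u} {v} h h′ = lin₂ u y 0ℤ h h′ (lemma x y u v N)
    where
    lemma : ∀ x y u v N → x * u - y * v ≡ u * (x - y) + y * (u - v) + 0ℤ * N
    lemma = solve-∀

  *-congˡ : ∀ {N u v} x → u ≈ v [ N ] → x * u ≈ x * v [ N ]
  *-congˡ x h = *-cong (≈-refl {x = x}) h

  *-congʳ : ∀ {N u v} x → u ≈ v [ N ] → u * x ≈ v * x [ N ]
  *-congʳ x h = *-cong h (≈-refl {x = x})

  ^-cong : ∀ {N x y} n → x ≈ y [ N ] → x ^ n ≈ y ^ n [ N ]
  ^-cong zero    h = ≈-refl
  ^-cong (suc n) h = *-cong h (^-cong n h)

  N≈0 : ∀ {N} → N ≈ 0ℤ [ N ]
  N≈0 {N} = congruent 1ℤ (lemma N)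
    where
    lemma : ∀ N → N - 0ℤ ≡ 1ℤ * N
    lemma = solve-∀

  ≈-weaken : ∀ {M N x y} → x ≈ y [ M * N ] → x ≈ y [ N ]
  ≈-weaken {M} {N} (congruent q e) = congruent (q * M) (trans e (sym (*-assoc q M N)))

  -- The device that gains a power of the prime: for M = N = p, a multiple of p turns a congruence
  -- modulo p into one modulo p².
  ≈-scale : ∀ {M N x y u} → u ≈ 0ℤ [ M ] → x ≈ y [ N ] → u * x ≈ u * y [ M * N ]
  ≈-scale {M} {N} {x} {y} {u} (congruent q e) (congruent r f) = congruent (q * r)
    (trans (lemma u x y) (trans (cong₂ _*_ e f) (lemma′ q M r N)))
    where
    lemma : ∀ u x y → u * x - u * y ≡ (u - 0ℤ) * (x - y)
    lemma = solve-∀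
    lemma′ : ∀ q M r N → q * M * (r * N) ≡ q * r * (M * N)
    lemma′ = solve-∀

  ≈-isolate : ∀ {N x y} → x ≈ y [ N ] → ∃[ q ] x ≡ y + q * N
  ≈-isolate {N} {x} {y} (congruent q e) = q , trans (lemma x y) (cong (_+_ y) e)
    where
    lemma : ∀ x y → x ≡ y + (x - y)
    lemma = solve-∀

  -- Finite sums

  ∑ : ℕ → (ℕ → ℤ) → ℤ
  ∑ n f = Sum.sum {n} (f ∘ toℕ)

  ∑-cong : ∀ {N} n {f g : ℕ → ℤ} → (∀ {k} → k < n → f k ≈ g k [ N ]) → ∑ n f ≈ ∑ n g [ N ]
  ∑-cong zero    h = ≈-refl
  ∑-cong (suc n) h = +-cong (h (s≤s z≤n)) (∑-cong n (h ∘ s≤s))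

  ∑-cong-≡ : ∀ n {f g : ℕ → ℤ} → (∀ {k} → k < n → f k ≡ g k) → ∑ n f ≡ ∑ n g
  ∑-cong-≡ zero    h = refl
  ∑-cong-≡ (suc n) h = cong₂ _+_ (h (s≤s z≤n)) (∑-cong-≡ n (h ∘ s≤s))

  ∑-const : ∀ n c → ∑ n (λ _ → c) ≡ + n * c
  ∑-const zero    c = refl
  ∑-const (suc n) c = trans (cong (_+_ c) (∑-const n c)) (lemma c (+ n))
    where
    lemma : ∀ c n → c + n * c ≡ (1ℤ + n) * c
    lemma = solve-∀

  ∑-zero : ∀ {N} n {f : ℕ → ℤ} → (∀ {k} → k < n → f k ≈ 0ℤ [ N ]) → ∑ n f ≈ 0ℤ [ N ]
  ∑-zero n h = ≈-trans (∑-cong n h) (reflexive (trans (∑-const n 0ℤ) (*-zeroʳ (+ n))))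

  ∑-+ : ∀ n f g → ∑ n (λ k → f k + g k) ≡ ∑ n f + ∑ n g
  ∑-+ n f g = Sum.∑-distrib-+ {n} (f ∘ toℕ) (g ∘ toℕ)

  ∑-*ˡ : ∀ n c f → ∑ n (λ k → c * f k) ≡ c * ∑ n f
  ∑-*ˡ n c f = sym (Sum.*-distribˡ-sum {n} c (f ∘ toℕ))

  ∑-comm : ∀ m n (f : ℕ → ℕ → ℤ) → ∑ m (λ i → ∑ n (f i)) ≡ ∑ n (λ j → ∑ m (λ i → f i j))
  ∑-comm m n f = Sum.∑-comm {m} {n} (λ i j → f (toℕ i) (toℕ j))

  ∑-snoc : ∀ n f → ∑ (suc n) f ≡ ∑ n f + f n
  ∑-snoc zero    f = +-comm (f 0) 0ℤ
  ∑-snoc (suc n) f = trans (cong (_+_ (f 0)) (∑-snoc n (f ∘ suc)))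
    (sym (+-assoc (f 0) (∑ n (f ∘ suc)) (f (suc n))))

  ∑-split : ∀ m n f → ∑ (m ℕ.+ n) f ≡ ∑ m f + ∑ n (λ k → f (m ℕ.+ k))
  ∑-split zero    n f = sym (+-identityˡ _)
  ∑-split (suc m) n f = trans (cong (_+_ (f 0)) (∑-split m n (f ∘ suc))) (sym (+-assoc (f 0) _ _))

  ∑-reverse : ∀ n f → ∑ n f ≡ ∑ n (λ k → f (n ∸ suc k))
  ∑-reverse zero    f = refl
  ∑-reverse (suc n) f = trans (∑-snoc n f) (trans (cong (_+ f n) (∑-reverse n f)) (+-comm _ (f n)))

  ∑-telescope : ∀ n (f : ℕ → ℤ) → ∑ n (λ k → f (suc k) - f k) ≡ f n - f 0
  ∑-telescope zero    f = sym (+-inverseʳ (f 0))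
  ∑-telescope (suc n) f = trans (cong (_+_ (f 1 - f 0)) (∑-telescope n (f ∘ suc))) (lemma (f 0) (f 1) (f (suc n)))
    where
    lemma : ∀ a b c → b - a + (c - b) ≡ c - a
    lemma = solve-∀

  -- Zeroing one index keeps the range of summation intact, so several isolated terms can be pulled
  -- out of a sum one after another.
  erase : ℕ → (ℕ → ℤ) → ℕ → ℤ
  erase a f k with k ℕ.≟ a
  ... | yes _ = 0ℤ
  ... | no  _ = f k

  erase-≢ : ∀ a f {k} → k ≢ a → erase a f k ≡ f k
  erase-≢ a f {k} k≢a with k ℕ.≟ a
  ... | yes k≡a = contradiction k≡a k≢a
  ... | no  _   = refl

  erase-≡ : ∀ a f → erase a f a ≡ 0ℤ
  erase-≡ a f with a ℕ.≟ a
  ... | yes _   = refl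
  ... | no  a≢a = contradiction refl a≢a

  ∑-erase : ∀ n f {a} → a < n → ∑ n f ≡ f a + ∑ n (erase a f)
  ∑-erase (suc n) f {a} (s≤s a≤n) with ℕ.m≤n⇒m<n∨m≡n a≤n
  ... | inj₁ a<n = begin
    ∑ (suc n) f                              ≡⟨ ∑-snoc n f ⟩
    ∑ n f + f n                              ≡⟨ cong (_+ f n) (∑-erase n f a<n) ⟩
    f a + ∑ n (erase a f) + f n              ≡⟨ +-assoc (f a) _ _ ⟩
    f a + (∑ n (erase a f) + f n)            ≡⟨ cong (λ v → f a + (∑ n (erase a f) + v)) (erase-≢ a f (ℕ.<⇒≢ a<n ∘ sym)) ⟨
    f a + (∑ n (erase a f) + erase a f n)    ≡⟨ cong (_+_ (f a)) (∑-snoc n (erase a f)) ⟨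
    f a + ∑ (suc n) (erase a f)              ∎
    where open ≡-Reasoning
  ... | inj₂ refl = begin
    ∑ (suc n) f                              ≡⟨ ∑-snoc n f ⟩
    ∑ n f + f n                              ≡⟨ +-comm (∑ n f) (f n) ⟩
    f n + ∑ n f                              ≡⟨ cong (_+_ (f n)) (∑-cong-≡ n (λ k<n → sym (erase-≢ n f (ℕ.<⇒≢ k<n)))) ⟩
    f n + ∑ n (erase n f)                    ≡⟨ cong (_+_ (f n)) (+-identityʳ _) ⟨
    f n + (∑ n (erase n f) + 0ℤ)             ≡⟨ cong (λ v → f n + (∑ n (erase n f) + v)) (erase-≡ n f) ⟨
    f n + (∑ n (erase n f) + erase n f n)    ≡⟨ cong (_+_ (f n)) (∑-snoc n (erase n f)) ⟨
    f n + ∑ (suc n) (erase n f)              ∎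
    where open ≡-Reasoning

  -- Binomial coefficients

  -- Hidden from conversion, so that `_C_` never unfolds inside larger terms; `bin≡C` is the only
  -- way in.
  opaque
    bin : ℕ → ℕ → ℤ
    bin n k = + (n C k)

    bin≡C : ∀ n k → bin n k ≡ + (n C k)
    bin≡C n k = refl

  bin-n-0 : ∀ n → bin n 0 ≡ 1ℤ
  bin-n-0 n = trans (bin≡C n 0) (cong +_ (trans (nCk≡nC[n∸k] {0} {n} z≤n) (nCn≡1 n)))

  bin-n-n : ∀ n → bin n n ≡ 1ℤ
  bin-n-n n = trans (bin≡C n n) (cong +_ (nCn≡1 n))

  bin-> : ∀ {n k} → n < k → bin n k ≡ 0ℤ
  bin-> {n} {k} n<k = trans (bin≡C n k) (cong +_ (k>n⇒nCk≡0 n<k))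

  bin-sym : ∀ a b → bin (a ℕ.+ b) a ≡ bin (a ℕ.+ b) b
  bin-sym a b = begin
    bin (a ℕ.+ b) a              ≡⟨ bin≡C (a ℕ.+ b) a ⟩
    + ((a ℕ.+ b) C a)            ≡⟨ cong +_ (nCk≡nC[n∸k] (ℕ.m≤m+n a b)) ⟩
    + ((a ℕ.+ b) C (a ℕ.+ b ∸ a)) ≡⟨ cong (λ v → + ((a ℕ.+ b) C v)) (ℕ.m+n∸m≡n a b) ⟩
    + ((a ℕ.+ b) C b)            ≡⟨ bin≡C (a ℕ.+ b) b ⟨
    bin (a ℕ.+ b) b              ∎
    where open ≡-Reasoning

  pascal : ∀ n k → bin (suc n) (suc k) ≡ bin n k + bin n (suc k)
  pascal n k = begin
    bin (suc n) (suc k)         ≡⟨ bin≡C (suc n) (suc k) ⟩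
    + (suc n C suc k)           ≡⟨ cong +_ (nCk+nC[k+1]≡[n+1]C[k+1] n k) ⟨
    + (n C k) + + (n C suc k)   ≡⟨ cong₂ _+_ (bin≡C n k) (bin≡C n (suc k)) ⟨
    bin n k + bin n (suc k)     ∎
    where open ≡-Reasoning

  -- The ratio of neighbouring binomials without division; over ℤ it covers k = n, where the factor
  -- n - k vanishes, and k > n, where both binomials do.
  bin-suc-k : ∀ n k → (1ℤ + + k) * bin n (suc k) ≡ (+ n - + k) * bin n k
  bin-suc-k zero    zero    = trans (cong (_*_ 1ℤ) (bin-> (s≤s z≤n))) (sym (*-zeroˡ (bin 0 0)))
  bin-suc-k zero    (suc k) = trans (cong (_*_ (1ℤ + + suc k)) (bin-> {0} {suc (suc k)} (s≤s z≤n)))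
    (trans (*-zeroʳ (1ℤ + + suc k)) (sym (trans (cong (_*_ (0ℤ - + suc k)) (bin-> {0} {suc k} (s≤s z≤n))) (*-zeroʳ (0ℤ - + suc k)))))
  bin-suc-k (suc n) zero    = begin
    1ℤ * bin (suc n) 1              ≡⟨ cong (_*_ 1ℤ) (pascal n 0) ⟩
    1ℤ * (bin n 0 + bin n 1)        ≡⟨ lemma (bin n 0) (bin n 1) ⟩
    bin n 0 + (1ℤ + 0ℤ) * bin n 1   ≡⟨ cong (_+_ (bin n 0)) (bin-suc-k n 0) ⟩
    bin n 0 + (+ n - 0ℤ) * bin n 0  ≡⟨ cong₂ (λ u v → u + (+ n - 0ℤ) * v) (bin-n-0 n) (bin-n-0 n) ⟩
    1ℤ + (+ n - 0ℤ) * 1ℤ            ≡⟨ lemma′ (+ n) ⟩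
    (1ℤ + + n - 0ℤ) * 1ℤ            ≡⟨ cong (_*_ (1ℤ + + n - 0ℤ)) (bin-n-0 (suc n)) ⟨
    (1ℤ + + n - 0ℤ) * bin (suc n) 0 ∎
    where
    open ≡-Reasoning
    lemma : ∀ a b → 1ℤ * (a + b) ≡ a + (1ℤ + 0ℤ) * b
    lemma = solve-∀
    lemma′ : ∀ n → 1ℤ + (n - 0ℤ) * 1ℤ ≡ (1ℤ + n - 0ℤ) * 1ℤ
    lemma′ = solve-∀
  bin-suc-k (suc n) (suc k) = begin
    (1ℤ + (1ℤ + + k)) * bin (suc n) (suc (suc k))  ≡⟨ cong (_*_ (1ℤ + (1ℤ + + k))) (pascal n (suc k)) ⟩
    (1ℤ + (1ℤ + + k)) * (b₁ + b₂)                  ≡⟨ lemma (+ k) b₁ b₂ ⟩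
    (1ℤ + + suc k) * b₂ + ((1ℤ + + k) * b₁ + b₁)   ≡⟨ cong₂ (λ u v → u + (v + b₁)) (bin-suc-k n (suc k)) (bin-suc-k n k) ⟩
    (+ n - + suc k) * b₁ + ((+ n - + k) * b₀ + b₁) ≡⟨ lemma′ (+ n) (+ k) b₀ b₁ ⟩
    (1ℤ + + n - (1ℤ + + k)) * (b₀ + b₁)            ≡⟨ cong (_*_ (+ suc n - + suc k)) (pascal n k) ⟨
    (+ suc n - + suc k) * bin (suc n) (suc k)      ∎
    where
    open ≡-Reasoning
    b₀ = bin n k
    b₁ = bin n (suc k)
    b₂ = bin n (suc (suc k))
    lemma : ∀ k x y → (1ℤ + (1ℤ + k)) * (x + y) ≡ (1ℤ + (1ℤ + k)) * y + ((1ℤ + k) * x + x)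
    lemma = solve-∀
    lemma′ : ∀ n k x y → (n - (1ℤ + k)) * y + ((n - k) * x + y) ≡ (1ℤ + n - (1ℤ + k)) * (x + y)
    lemma′ = solve-∀

  bin-absorb : ∀ n k → (1ℤ + + k) * bin (suc n) (suc k) ≡ (1ℤ + + n) * bin n k
  bin-absorb n k = begin
    (1ℤ + + k) * bin (suc n) (suc k)                  ≡⟨ cong (_*_ (1ℤ + + k)) (pascal n k) ⟩
    (1ℤ + + k) * (bin n k + bin n (suc k))            ≡⟨ lemma (+ k) (bin n k) (bin n (suc k)) ⟩
    (1ℤ + + k) * bin n k + (1ℤ + + k) * bin n (suc k) ≡⟨ cong (_+_ ((1ℤ + + k) * bin n k)) (bin-suc-k n k) ⟩
    (1ℤ + + k) * bin n k + (+ n - + k) * bin n k      ≡⟨ lemma′ (+ n) (+ k) (bin n k) ⟩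
    (1ℤ + + n) * bin n k                              ∎
    where
    open ≡-Reasoning
    lemma : ∀ k x y → (1ℤ + k) * (x + y) ≡ (1ℤ + k) * x + (1ℤ + k) * y
    lemma = solve-∀
    lemma′ : ∀ n k x → (1ℤ + k) * x + (n - k) * x ≡ (1ℤ + n) * x
    lemma′ = solve-∀

  bin-suc-n : ∀ n k → (1ℤ + + n - + k) * bin (suc n) k ≡ (1ℤ + + n) * bin n k
  bin-suc-n n k = trans (sym (bin-suc-k (suc n) k)) (bin-absorb n k)

  -- C(2k+2, k+1) is a sum of two entries of row 2k + 1 that are equal by symmetry, and absorption
  -- leads from there to C(2k, k).
  central-suc : ∀ k → (1ℤ + + k) * bin (2 ℕ.* suc k) (suc k) ≡ + 2 * (1ℤ + + 2 * + k) * bin (2 ℕ.* k) k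
  central-suc k = begin
    (1ℤ + + k) * bin (2 ℕ.* suc k) (suc k)                        ≡⟨ cong (λ v → (1ℤ + + k) * bin v (suc k)) (2*suc k) ⟩
    (1ℤ + + k) * bin (suc (suc (2 ℕ.* k))) (suc k)                ≡⟨ cong (_*_ (1ℤ + + k)) (pascal (suc (2 ℕ.* k)) k) ⟩
    (1ℤ + + k) * (bin (suc (2 ℕ.* k)) k + bin (suc (2 ℕ.* k)) (suc k))
      ≡⟨ cong (λ v → (1ℤ + + k) * (v + bin (suc (2 ℕ.* k)) (suc k))) middle ⟩
    (1ℤ + + k) * (bin (suc (2 ℕ.* k)) (suc k) + bin (suc (2 ℕ.* k)) (suc k))
      ≡⟨ lemma (+ k) (bin (suc (2 ℕ.* k)) (suc k)) ⟩
    + 2 * ((1ℤ + + k) * bin (suc (2 ℕ.* k)) (suc k))              ≡⟨ cong (_*_ (+ 2)) (bin-absorb (2 ℕ.* k) k) ⟩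
    + 2 * ((1ℤ + + (2 ℕ.* k)) * bin (2 ℕ.* k) k)                  ≡⟨ cong (λ v → + 2 * ((1ℤ + v) * bin (2 ℕ.* k) k)) (pos-* 2 k) ⟩
    + 2 * ((1ℤ + + 2 * + k) * bin (2 ℕ.* k) k)                    ≡⟨ *-assoc (+ 2) (1ℤ + + 2 * + k) (bin (2 ℕ.* k) k) ⟨
    + 2 * (1ℤ + + 2 * + k) * bin (2 ℕ.* k) k                      ∎
    where
    open ≡-Reasoning
    2*suc : ∀ k → 2 ℕ.* suc k ≡ suc (suc (2 ℕ.* k))
    2*suc k = ℕ.*-suc 2 k
    middle : bin (suc (2 ℕ.* k)) k ≡ bin (suc (2 ℕ.* k)) (suc k)
    middle = subst (λ v → bin v k ≡ bin v (suc k))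
      (trans (ℕ.+-suc k k) (cong (λ v → suc (k ℕ.+ v)) (sym (ℕ.+-identityʳ k)))) (bin-sym k (suc k))
    lemma : ∀ k x → (1ℤ + k) * (x + x) ≡ + 2 * ((1ℤ + k) * x)
    lemma = solve-∀

  -- The functional h ↦ ∑ C(N, t) h(N − t, t), whose recursion is Pascal's rule

  B : ℕ → (ℕ → ℕ → ℤ) → ℤ
  B zero    h = h 0 0
  B (suc N) h = B N (h ∘ suc) + B N (λ s → h s ∘ suc)

  B-linear : ∀ N c d g h → B N (λ s t → c * g s t + d * h s t) ≡ c * B N g + d * B N h
  B-linear zero    c d g h = refl
  B-linear (suc N) c d g h = trans
    (cong₂ _+_ (B-linear N c d (g ∘ suc) (h ∘ suc)) (B-linear N c d (λ s → g s ∘ suc) (λ s → h s ∘ suc)))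
    (lemma c d (B N (g ∘ suc)) (B N (h ∘ suc)) (B N (λ s → g s ∘ suc)) (B N (λ s → h s ∘ suc)))
    where
    lemma : ∀ c d x y z w → c * x + d * y + (c * z + d * w) ≡ c * (x + z) + d * (y + w)
    lemma = solve-∀

  B-cong-≡ : ∀ N {g h} → (∀ s t → g s t ≡ h s t) → B N g ≡ B N h
  B-cong-≡ zero    e = e 0 0
  B-cong-≡ (suc N) e = cong₂ _+_ (B-cong-≡ N (e ∘ suc)) (B-cong-≡ N (λ s → e s ∘ suc))

  B-∑ : ∀ N n (h : ℕ → ℕ → ℕ → ℤ) → ∑ n (λ x → B N (h x)) ≡ B N (λ s t → ∑ n (λ x → h x s t))
  B-∑ zero    n h = refl
  B-∑ (suc N) n h = trans (∑-+ n (λ x → B N (h x ∘ suc)) (λ x → B N (λ s → h x s ∘ suc)))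
    (cong₂ _+_ (B-∑ N n (λ x → h x ∘ suc)) (B-∑ N n (λ x s → h x s ∘ suc)))

  binomial : ∀ N z y → (z + y) ^ N ≡ B N (λ s t → z ^ s * y ^ t)
  binomial zero    z y = refl
  binomial (suc N) z y = begin
    (z + y) * (z + y) ^ N                                      ≡⟨ cong (_*_ (z + y)) (binomial N z y) ⟩
    (z + y) * B N (λ s t → z ^ s * y ^ t)                      ≡⟨ lemma z y (B N (λ s t → z ^ s * y ^ t)) ⟩
    (z * b + 0ℤ * b) + (y * b + 0ℤ * b)                        ≡⟨ cong₂ _+_ (B-linear N z 0ℤ h h) (B-linear N y 0ℤ h h) ⟨
    B N (λ s t → z * h s t + 0ℤ * h s t) + B N (λ s t → y * h s t + 0ℤ * h s t)
      ≡⟨ cong₂ _+_ (B-cong-≡ N (λ s t → lemma₁ z (z ^ s) (y ^ t))) (B-cong-≡ N (λ s t → lemma₂ y (z ^ s) (y ^ t))) ⟩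
    B N (λ s t → z ^ suc s * y ^ t) + B N (λ s t → z ^ s * y ^ suc t) ∎
    where
    open ≡-Reasoning
    h : ℕ → ℕ → ℤ
    h s t = z ^ s * y ^ t
    b = B N h
    lemma : ∀ z y b → (z + y) * b ≡ (z * b + 0ℤ * b) + (y * b + 0ℤ * b)
    lemma = solve-∀
    lemma₁ : ∀ z u v → z * (u * v) + 0ℤ * (u * v) ≡ z * u * v
    lemma₁ = solve-∀
    lemma₂ : ∀ y u v → y * (u * v) + 0ℤ * (u * v) ≡ u * (y * v)
    lemma₂ = solve-∀

  B≡∑ : ∀ N h → B N h ≡ ∑ (suc N) (λ t → bin N t * h (N ∸ t) t)
  B≡∑ zero    h = sym (trans (+-identityʳ _) (trans (cong (λ v → v * h 0 0) (bin-n-0 0)) (*-identityˡ (h 0 0))))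
  B≡∑ (suc N) h = begin
    B N (h ∘ suc) + B N (λ s → h s ∘ suc)               ≡⟨ cong₂ _+_ (B≡∑ N (h ∘ suc)) (B≡∑ N (λ s → h s ∘ suc)) ⟩
    ∑ (suc N) (λ t → bin N t * h (suc (N ∸ t)) t) + ∑ (suc N) g  ≡⟨ cong (λ v → v + ∑ (suc N) g) low ⟩
    h (suc N) 0 + ∑ (suc N) f + ∑ (suc N) g             ≡⟨ +-assoc (h (suc N) 0) _ _ ⟩
    h (suc N) 0 + (∑ (suc N) f + ∑ (suc N) g)           ≡⟨ cong (_+_ (h (suc N) 0)) (∑-+ (suc N) f g) ⟨
    h (suc N) 0 + ∑ (suc N) (λ t → f t + g t)           ≡⟨ cong₂ _+_ first (∑-cong-≡ (suc N) (λ {t} _ → rest t)) ⟩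
    bin (suc N) 0 * h (suc N) 0 + ∑ (suc N) (λ t → bin (suc N) (suc t) * h (N ∸ t) (suc t)) ∎
    where
    open ≡-Reasoning
    f g : ℕ → ℤ
    f t = bin N (suc t) * h (N ∸ t) (suc t)
    g t = bin N t * h (N ∸ t) (suc t)
    first : h (suc N) 0 ≡ bin (suc N) 0 * h (suc N) 0
    first = sym (trans (cong (λ v → v * h (suc N) 0) (bin-n-0 (suc N))) (*-identityˡ (h (suc N) 0)))
    rest : ∀ t → f t + g t ≡ bin (suc N) (suc t) * h (N ∸ t) (suc t)
    rest t = trans (lemma (bin N (suc t)) (bin N t) (h (N ∸ t) (suc t)))
      (cong (λ v → v * h (N ∸ t) (suc t)) (sym (pascal N t)))
      where
      lemma : ∀ x y z → x * z + y * z ≡ (y + x) * z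
      lemma = solve-∀
    low : ∑ (suc N) (λ t → bin N t * h (suc (N ∸ t)) t) ≡ h (suc N) 0 + ∑ (suc N) f
    low = begin
      bin N 0 * h (suc N) 0 + ∑ N (λ t → bin N (suc t) * h (suc (N ∸ suc t)) (suc t))
        ≡⟨ cong₂ _+_ (trans (cong (λ v → v * h (suc N) 0) (bin-n-0 N)) (*-identityˡ (h (suc N) 0)))
             (∑-cong-≡ N (λ {t} t<N → cong (λ v → bin N (suc t) * h v (suc t)) (sym (ℕ.+-∸-assoc 1 t<N)))) ⟩
      h (suc N) 0 + ∑ N f           ≡⟨ cong (_+_ (h (suc N) 0)) (+-identityʳ (∑ N f)) ⟨
      h (suc N) 0 + (∑ N f + 0ℤ)    ≡⟨ cong (λ v → h (suc N) 0 + (∑ N f + v)) f-top ⟨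
      h (suc N) 0 + (∑ N f + f N)   ≡⟨ cong (_+_ (h (suc N) 0)) (∑-snoc N f) ⟨
      h (suc N) 0 + ∑ (suc N) f     ∎
      where
      f-top : f N ≡ 0ℤ
      f-top = trans (cong (λ v → v * h (N ∸ N) (suc N)) (bin-> {N} ℕ.≤-refl)) (*-zeroˡ (h (N ∸ N) (suc N)))

  ≈⇒∣ : ∀ {N x y} → x ≈ y [ N ] → ∣ N ∣ ℕ.∣ ∣ x - y ∣
  ≈⇒∣ (congruent q e) = ∣⇒∣ᵤ (divides q e)

  ∣⇒≈ : ∀ {N x y} → ∣ N ∣ ℕ.∣ ∣ x - y ∣ → x ≈ y [ N ]
  ∣⇒≈ h with ∣ᵤ⇒∣ h
  ... | divides q e = congruent q e

  infix 4 _≈?_[_]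

  _≈?_[_] : ∀ x y N → Dec (x ≈ y [ N ])
  x ≈? y [ N ] = map′ ∣⇒≈ ≈⇒∣ (∣ N ∣ ℕ.∣? ∣ x - y ∣)

  ≈⇒≡ : ∀ {N x y} → x ≈ y [ N ] → ∣ x - y ∣ < ∣ N ∣ → x ≡ y
  ≈⇒≡ {N} {x} {y} h lt = ℤ.i-j≡0⇒i≡j x y (ℤ.∣i∣≡0⇒i≡0 (zero? ∣ x - y ∣ (≈⇒∣ h) lt))
    where
    zero? : ∀ d → ∣ N ∣ ℕ.∣ d → d < ∣ N ∣ → d ≡ 0
    zero? zero    _ _  = refl
    zero? (suc d) h lt = contradiction (ℕ.∣⇒≤ h) (ℕ.<⇒≱ lt)

  -- The modulus is the square of the increment; for w = kp it weakens to p².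
  ^-+-first-order : ∀ n u w → (u + w) ^ suc n ≈ u ^ suc n + (1ℤ + + n) * (u ^ n * w) [ w * w ]
  ^-+-first-order zero u w = reflexive (lemma u w)
    where
    lemma : ∀ u w → (u + w) * 1ℤ ≡ u * 1ℤ + (1ℤ + 0ℤ) * (1ℤ * w)
    lemma = solve-∀
  ^-+-first-order (suc n) u w =
    lin₁ (u + w) ((1ℤ + + n) * u ^ n) (^-+-first-order n u w) (lemma u w (u ^ n) ((u + w) ^ suc n) (+ n))
    where
    lemma : ∀ u w v x n → (u + w) * x - (u * (u * v) + (1ℤ + (1ℤ + n)) * (u * v * w)) ≡
            (u + w) * (x - (u * v + (1ℤ + n) * (v * w))) + (1ℤ + n) * v * (w * w)
    lemma = solve-∀

  -1^2k : ∀ k → (-1ℤ) ^ (2 ℕ.* k) ≡ 1ℤ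
  -1^2k k = trans (sym (^-*-assoc -1ℤ 2 k)) (^-zeroˡ k)

  *-^ : ∀ x y n → (x * y) ^ n ≡ x ^ n * y ^ n
  *-^ x y zero    = refl
  *-^ x y (suc n) = trans (cong (_*_ (x * y)) (*-^ x y n)) (lemma x y (x ^ n) (y ^ n))
    where
    lemma : ∀ x y u v → x * y * (u * v) ≡ x * u * (y * v)
    lemma = solve-∀

  -- Arithmetic modulo a prime and its square

  module Modular (q : ℕ) (p-prime : Prime (suc q)) where

    p : ℕ
    p = suc q

    P P² : ℤ
    P = + p
    P² = P * P

    1<p : 1 < p
    1<p = ℕ.nonTrivial⇒n>1 p {{prime⇒nonTrivial p-prime}}

    0<q : 0 < q
    0<q = ℕ.s≤s⁻¹ 1<p

    euclid : ∀ {x y} → x * y ≈ 0ℤ [ P ] → x ≈ 0ℤ [ P ] ⊎ y ≈ 0ℤ [ P ]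
    euclid {x} {y} h with euclidsLemma ∣ x ∣ ∣ y ∣ p-prime
      (subst (p ℕ.∣_) (trans (cong ∣_∣ (+-identityʳ (x * y))) (abs-* x y)) (≈⇒∣ h))
    ... | inj₁ d = inj₁ (∣⇒≈ (subst (p ℕ.∣_) (cong ∣_∣ (sym (+-identityʳ x))) d))
    ... | inj₂ d = inj₂ (∣⇒≈ (subst (p ℕ.∣_) (cong ∣_∣ (sym (+-identityʳ y))) d))

    Unit : ℤ → Set
    Unit x = ¬ x ≈ 0ℤ [ P ]

    Unit-* : ∀ {x y} → Unit x → Unit y → Unit (x * y)
    Unit-* ux uy h with euclid h
    ... | inj₁ x≈0 = ux x≈0
    ... | inj₂ y≈0 = uy y≈0

    Unit-resp : ∀ {x y} → x ≈ y [ P ] → Unit x → Unit y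
    Unit-resp h ux y≈0 = ux (≈-trans h y≈0)

    Unit-1 : Unit 1ℤ
    Unit-1 h with ≈⇒≡ h 1<p
    ... | ()

    Unit-^ : ∀ {x} n → Unit x → Unit (x ^ n)
    Unit-^ zero    ux = Unit-1
    Unit-^ (suc n) ux = Unit-* ux (Unit-^ n ux)

    Unit-small : ∀ {k} → 0 < k → k < p → Unit (+ k)
    Unit-small {suc k} _ k<p h with ≈⇒≡ h (subst (ℕ._< p) (cong suc (sym (ℕ.+-identityʳ k))) k<p)
    ... | ()

    ≈0⇒- : ∀ {N x y} → x - y ≈ 0ℤ [ N ] → x ≈ y [ N ]
    ≈0⇒- {N} {x} {y} h = lin₁ 1ℤ 0ℤ h (lemma x y N)
      where
      lemma : ∀ x y N → x - y ≡ 1ℤ * (x - y - 0ℤ) + 0ℤ * N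
      lemma = solve-∀

    cancel : ∀ {c x y} → Unit c → c * x ≈ c * y [ P ] → x ≈ y [ P ]
    cancel {c} {x} {y} uc h with euclid {c} {x - y} (lin₁ 1ℤ 0ℤ h (lemma c x y P))
      where
      lemma : ∀ c x y N → c * (x - y) - 0ℤ ≡ 1ℤ * (c * x - c * y) + 0ℤ * N
      lemma = solve-∀
    ... | inj₁ c≈0 = contradiction c≈0 uc
    ... | inj₂ h′  = ≈0⇒- h′

    -- Cancelling modulo `P` gives x - y = kP; the hypothesis then says that P² divides c k P, so P
    -- divides k.
    cancel² : ∀ {c x y} → Unit c → c * x ≈ c * y [ P² ] → x ≈ y [ P² ]
    cancel² {c} {x} {y} uc h = step (cancel uc (≈-weaken {P} h)) h
      where
      step : x ≈ y [ P ] → c * x ≈ c * y [ P² ] → x ≈ y [ P² ]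
      step (congruent k e) (congruent r f) with euclid {c} {k} (congruent r (ℤ.*-cancelʳ-≡ _ _ P eq))
        where
        lemma : ∀ c k N → (c * k - 0ℤ) * N ≡ c * (k * N)
        lemma = solve-∀
        lemma′ : ∀ c x y → c * (x - y) ≡ c * x - c * y
        lemma′ = solve-∀
        eq : (c * k - 0ℤ) * P ≡ r * P * P
        eq = trans (lemma c k P) (trans (cong (_*_ c) (sym e)) (trans (lemma′ c x y) (trans f (sym (*-assoc r P P)))))
      ... | inj₁ c≈0 = contradiction c≈0 uc
      ... | inj₂ (congruent k′ e′) = congruent k′
        (trans e (trans (cong (_* P) (trans (sym (+-identityʳ k)) e′)) (*-assoc k′ P P)))

    -- (k + 1) C(p, k+1) = p C(p - 1, k), and k + 1 is a unit.
    bin-p≈0 : ∀ {k} → suc k < p → bin p (suc k) ≈ 0ℤ [ P ]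
    bin-p≈0 {k} k<p with euclid multiple
      where
      lemma : ∀ N b → N * b - 0ℤ ≡ b * N
      lemma = solve-∀
      multiple : (1ℤ + + k) * bin p (suc k) ≈ 0ℤ [ P ]
      multiple = subst (λ v → v ≈ 0ℤ [ P ]) (sym (bin-absorb q k)) (congruent (bin q k) (lemma P (bin q k)))
    ... | inj₁ h = contradiction h (Unit-small (s≤s z≤n) k<p)
    ... | inj₂ h = h

    freshman : ∀ z y → (z + y) ^ p ≈ z ^ p + y ^ p [ P ]
    freshman z y = begin
      (z + y) ^ p                                ≡⟨ trans (binomial p z y) (B≡∑ p (λ s t → z ^ s * y ^ t)) ⟩
      f 0 + ∑ p (f ∘ suc)                        ≡⟨ cong (_+_ (f 0)) (∑-snoc q (f ∘ suc)) ⟩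
      f 0 + (∑ q (f ∘ suc) + f p)                ≈⟨ +-cong (reflexive first) (+-cong (∑-zero q middle) (reflexive last)) ⟩
      z ^ p + (0ℤ + y ^ p)                       ≡⟨ cong (_+_ (z ^ p)) (+-identityˡ (y ^ p)) ⟩
      z ^ p + y ^ p                              ∎
      where
      open ≈-Reasoning P
      f : ℕ → ℤ
      f t = bin p t * (z ^ (p ∸ t) * y ^ t)
      one : ∀ {b u} → b ≡ 1ℤ → b * (u * 1ℤ) ≡ u
      one {u = u} refl = trans (*-identityˡ (u * 1ℤ)) (*-identityʳ u)
      first : f 0 ≡ z ^ p
      first = one (bin-n-0 p)
      last : f p ≡ y ^ p
      last = trans (cong₂ (λ b k → b * (z ^ k * y ^ p)) (bin-n-n p) (ℕ.n∸n≡0 p))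
        (trans (*-identityˡ (1ℤ * y ^ p)) (*-identityˡ (y ^ p)))
      middle : ∀ {k} → k < q → f (suc k) ≈ 0ℤ [ P ]
      middle {k} k<q = ≈-trans (*-congʳ (z ^ (p ∸ suc k) * y ^ suc k) (bin-p≈0 (s≤s k<q)))
        (reflexive (*-zeroˡ (z ^ (p ∸ suc k) * y ^ suc k)))

    fermat : ∀ x → x ^ p ≈ x [ P ]
    fermat (+ zero)       = reflexive (*-zeroˡ (0ℤ ^ q))
    fermat (+ suc n)      = ≈-trans (freshman 1ℤ (+ n)) (+-cong (reflexive (^-zeroˡ p)) (fermat (+ n)))
    -- Applied to -1 + 1 = 0, `freshman` gives (-1)^p ≡ -1 for either parity of p.
    fermat -[1+ zero ]    = lin₁ 1ℤ 0ℤ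
      (subst (λ v → -1ℤ ^ p + v ≈ 0ℤ [ P ]) (^-zeroˡ p) (≈-trans (≈-sym (freshman -1ℤ 1ℤ)) (reflexive (*-zeroˡ (0ℤ ^ q)))))
      (lemma (-1ℤ ^ p) P)
      where
      lemma : ∀ x N → x - -1ℤ ≡ 1ℤ * (x + 1ℤ - 0ℤ) + 0ℤ * N
      lemma = solve-∀
    fermat -[1+ suc n ]   = ≈-trans (freshman -1ℤ -[1+ n ]) (+-cong (fermat -[1+ zero ]) (fermat -[1+ n ]))

    fermat-unit : ∀ {x} → Unit x → x ^ q ≈ 1ℤ [ P ]
    fermat-unit {x} ux = cancel ux (≈-trans (fermat x) (reflexive (sym (*-identityʳ x))))

    -- For x = y + kP the first-order term p y^(p-1) kP of (y + kP)^p already contains p twice.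
    lift : ∀ {x y} → x ≈ y [ P ] → x ^ p ≈ y ^ p [ P² ]
    lift {x} {y} h with ≈-isolate h
    ... | k , refl = ≈-trans first-order (congruent (y ^ q * k) (lemma (y ^ p) P (y ^ q) k))
      where
      square : ∀ k N → k * N * (k * N) ≡ k * k * (N * N)
      square = solve-∀
      lemma : ∀ u N v k → u + N * (v * (k * N)) - u ≡ v * k * (N * N)
      lemma = solve-∀
      first-order : (y + k * P) ^ p ≈ y ^ p + P * (y ^ q * (k * P)) [ P² ]
      first-order = ≈-weaken {k * k} (subst (λ N → (y + k * P) ^ p ≈ y ^ p + P * (y ^ q * (k * P)) [ N ])
        (square k P) (^-+-first-order q y (k * P)))

    -- x^p is the Teichmüller representative of x to precision p².
    teichmüller : ∀ x → (x ^ p) ^ p ≈ x ^ p [ P² ]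
    teichmüller x = lift (fermat x)

    lift-unit : ∀ {x} → Unit x → (x ^ p) ^ q ≈ 1ℤ [ P² ]
    lift-unit {x} ux = cancel² (Unit-^ p ux) (≈-trans (teichmüller x) (reflexive (sym (*-identityʳ (x ^ p)))))

  -- Power sums over the residues

  module PowerSums (q : ℕ) (p-prime : Prime (suc q)) where

    open Modular q p-prime

    -- The sum of (x + 1)^(d+1) - x^(d+1) telescopes to p^(d+1) ≡ 0. Expanding it leaves (d + 1)
    -- S(d) plus multiples of lower power sums, and d + 1 is a unit.
    power-sum≈0 : ∀ d → d < q → ∑ p (λ x → (+ x) ^ d) ≈ 0ℤ [ P ]
    power-sum≈0 = ℕ.<-rec _ step
      where
      S : ℕ → ℤ
      S t = ∑ p (λ x → (+ x) ^ t)

      expand : ∀ d x → (+ suc x) ^ suc d - (+ x) ^ suc d ≡ ∑ (suc d) (λ t → bin (suc d) t * (+ x) ^ t)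
      expand d x = begin
        (1ℤ + + x) ^ suc d - (+ x) ^ suc d
          ≡⟨ cong (λ v → v - (+ x) ^ suc d) (trans (binomial (suc d) 1ℤ (+ x)) (B≡∑ (suc d) (λ s t → 1ℤ ^ s * (+ x) ^ t))) ⟩
        ∑ (suc (suc d)) (λ t → bin (suc d) t * (1ℤ ^ (suc d ∸ t) * (+ x) ^ t)) - (+ x) ^ suc d
          ≡⟨ cong (λ v → v - (+ x) ^ suc d) (∑-cong-≡ (suc (suc d)) (λ {t} _ → cong (_*_ (bin (suc d) t))
               (trans (cong (_* (+ x) ^ t) (^-zeroˡ (suc d ∸ t))) (*-identityˡ ((+ x) ^ t))))) ⟩
        ∑ (suc (suc d)) g - (+ x) ^ suc d        ≡⟨ cong (λ v → v - (+ x) ^ suc d) (∑-snoc (suc d) g) ⟩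
        ∑ (suc d) g + bin (suc d) (suc d) * (+ x) ^ suc d - (+ x) ^ suc d
          ≡⟨ cong (λ v → ∑ (suc d) g + v * (+ x) ^ suc d - (+ x) ^ suc d) (bin-n-n (suc d)) ⟩
        ∑ (suc d) g + 1ℤ * (+ x) ^ suc d - (+ x) ^ suc d   ≡⟨ lemma (∑ (suc d) g) ((+ x) ^ suc d) ⟩
        ∑ (suc d) g ∎
        where
        open ≡-Reasoning
        g : ℕ → ℤ
        g t = bin (suc d) t * (+ x) ^ t
        lemma : ∀ a b → a + 1ℤ * b - b ≡ a
        lemma = solve-∀

      bin-suc-d : ∀ d → bin (suc d) d ≡ + suc d
      bin-suc-d d = begin
        bin (suc d) d                       ≡⟨ lemma (+ d) (bin (suc d) d) ⟩
        (1ℤ + + d - + d) * bin (suc d) d    ≡⟨ bin-suc-n d d ⟩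
        (1ℤ + + d) * bin d d                ≡⟨ cong (_*_ (1ℤ + + d)) (bin-n-n d) ⟩
        (1ℤ + + d) * 1ℤ                     ≡⟨ *-identityʳ (1ℤ + + d) ⟩
        1ℤ + + d                            ∎
        where
        open ≡-Reasoning
        lemma : ∀ d b → b ≡ (1ℤ + d - d) * b
        lemma = solve-∀

      total : ∀ d → ∑ (suc d) (λ t → bin (suc d) t * S t) ≡ P ^ suc d - 0ℤ ^ suc d
      total d = begin
        ∑ (suc d) (λ t → bin (suc d) t * S t)                            ≡⟨ ∑-cong-≡ (suc d) (λ {t} _ → ∑-*ˡ p (bin (suc d) t) (λ x → (+ x) ^ t)) ⟨
        ∑ (suc d) (λ t → ∑ p (λ x → bin (suc d) t * (+ x) ^ t))          ≡⟨ ∑-comm (suc d) p (λ t x → bin (suc d) t * (+ x) ^ t) ⟩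
        ∑ p (λ x → ∑ (suc d) (λ t → bin (suc d) t * (+ x) ^ t))          ≡⟨ ∑-cong-≡ p (λ {x} _ → expand d x) ⟨
        ∑ p (λ x → (+ suc x) ^ suc d - (+ x) ^ suc d)                    ≡⟨ ∑-telescope p (λ x → (+ x) ^ suc d) ⟩
        P ^ suc d - 0ℤ ^ suc d                                           ∎
        where open ≡-Reasoning

      step : ∀ d → (∀ {t} → t < d → t < q → S t ≈ 0ℤ [ P ]) → d < q → S d ≈ 0ℤ [ P ]
      step d rec d<q = cancel (Unit-small (s≤s z≤n) (s≤s d<q)) (begin
        + suc d * S d                                                ≡⟨ +-identityˡ (+ suc d * S d) ⟨
        0ℤ + + suc d * S d                                           ≈⟨ +-cong lower (reflexive (cong (_* S d) (sym (bin-suc-d d)))) ⟩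
        ∑ d (λ t → bin (suc d) t * S t) + bin (suc d) d * S d        ≡⟨ ∑-snoc d (λ t → bin (suc d) t * S t) ⟨
        ∑ (suc d) (λ t → bin (suc d) t * S t)                        ≡⟨ total d ⟩
        P ^ suc d - 0ℤ ^ suc d                                       ≈⟨ congruent (P ^ d) (lemma P (P ^ d) (0ℤ ^ d)) ⟩
        0ℤ                                                           ≡⟨ *-zeroʳ (+ suc d) ⟨
        + suc d * 0ℤ                                                 ∎)
        where
        open ≈-Reasoning P
        lemma : ∀ N v z → N * v - 0ℤ * z - 0ℤ ≡ v * N
        lemma = solve-∀
        zeroed : ∀ {t} → t < d → bin (suc d) t * S t ≈ bin (suc d) t * 0ℤ [ P ]
        zeroed {t} t<d = *-congˡ (bin (suc d) t) (rec t<d (ℕ.<-trans t<d d<q))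
        lower : 0ℤ ≈ ∑ d (λ t → bin (suc d) t * S t) [ P ]
        lower = ≈-sym (∑-zero d (λ {t} t<d → ≈-trans (zeroed t<d) (reflexive (*-zeroʳ (bin (suc d) t)))))

    -- Stands in for a primitive root: if x^r ≡ 1 held for all units, the power sum of degree r
    -- would be q ≡ -1, against `power-sum≈0`.
    nontrivial-power : ∀ r → 0 < r → r < q → ∃[ c ] Unit c × ¬ c ^ r ≈ 1ℤ [ P ]
    nontrivial-power r@(suc r′) 0<r r<q with ℕ.anyUpTo? (λ x → ¬? ((+ suc x) ^ r ≈? 1ℤ [ P ])) q
    ... | yes (x , x<q , h) = + suc x , Unit-small (s≤s z≤n) (s≤s x<q) , h
    ... | no none = contradiction (≈-trans (≈-sym (power-sum≈0 r r<q)) sum≈q) (λ h → Unit-small 0<q ℕ.≤-refl (≈-sym h))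
      where
      one : ∀ {x} → x < q → (+ suc x) ^ r ≈ 1ℤ [ P ]
      one {x} x<q = decidable-stable ((+ suc x) ^ r ≈? 1ℤ [ P ]) (λ h → none (x , x<q , h))
      open ≈-Reasoning P
      sum≈q : ∑ p (λ x → (+ x) ^ r) ≈ + q [ P ]
      sum≈q = begin
        0ℤ * 0ℤ ^ r′ + ∑ q (λ x → (+ suc x) ^ r)  ≈⟨ +-cong (reflexive (*-zeroˡ (0ℤ ^ r′))) (∑-cong q one) ⟩
        0ℤ + ∑ q (λ _ → 1ℤ)                       ≡⟨ trans (+-identityˡ _) (trans (∑-const q 1ℤ) (*-identityʳ (+ q))) ⟩
        + q                                       ∎

    residue : ℤ → Fin p
    residue x = fromℕ< (n%ℕd<d x p)

    residue≈ : ∀ x → + toℕ (residue x) ≈ x [ P ]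
    residue≈ x = congruent (- (x /ℕ p)) (trans (cong₂ (λ u v → + u - v) (toℕ-fromℕ< (n%ℕd<d x p)) (a≡a%ℕn+[a/ℕn]*n x p))
      (lemma (+ (x %ℕ p)) (x /ℕ p) P))
      where
      lemma : ∀ r k N → r - (r + k * N) ≡ - k * N
      lemma = solve-∀

    residue-unique : ∀ {i j : Fin p} → + toℕ i ≈ + toℕ j [ P ] → i ≡ j
    residue-unique {i} {j} h = toℕ-injective (ℤ.+-injective (≈⇒≡ h
      (ℕ.≤-<-trans (ℕ.≤-trans (ℕ.≤-reflexive (cong ∣_∣ (ℤ.m-n≡m⊖n (toℕ i) (toℕ j)))) (ℤ.∣m⊝n∣≤m⊔n (toℕ i) (toℕ j)))
        (ℕ.⊔-lub (toℕ<n i) (toℕ<n j)))))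

    -- The inverse permutation is multiplication by c^(p - 2), by Fermat.
    scaling : ∀ {c} → Unit c → Fin.Permutation p p
    scaling {c} uc = Fin.permutation
      (λ i → residue (c * + toℕ i)) (λ i → residue (c′ * + toℕ i))
      (inverse c c′ c*c′≈1) (inverse c′ c (≈-trans (reflexive (*-comm c′ c)) c*c′≈1))
      where
      c′ = c ^ ℕ.pred q
      c*c′≈1 : c * c′ ≈ 1ℤ [ P ]
      c*c′≈1 = subst (λ k → c ^ k ≈ 1ℤ [ P ]) (sym (ℕ.suc-pred q {{ℕ.>-nonZero 0<q}})) (fermat-unit uc)
      inverse : ∀ a b → a * b ≈ 1ℤ [ P ] → ∀ i → residue (a * + toℕ (residue (b * + toℕ i))) ≡ i
      inverse a b h i = residue-unique (begin
        + toℕ (residue (a * + toℕ (residue (b * + toℕ i)))) ≈⟨ residue≈ (a * + toℕ (residue (b * + toℕ i))) ⟩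
        a * + toℕ (residue (b * + toℕ i))                   ≈⟨ *-congˡ a (residue≈ (b * + toℕ i)) ⟩
        a * (b * + toℕ i)                                   ≡⟨ *-assoc a b (+ toℕ i) ⟨
        a * b * + toℕ i                                     ≈⟨ *-congʳ (+ toℕ i) h ⟩
        1ℤ * + toℕ i                                        ≡⟨ *-identityˡ (+ toℕ i) ⟩
        + toℕ i                                             ∎)
        where open ≈-Reasoning P

    ∑-scale : ∀ {N c} → Unit c → (f : ℤ → ℤ) → (∀ {x y} → x ≈ y [ P ] → f x ≈ f y [ N ]) →
              ∑ p (λ x → f (c * + x)) ≈ ∑ p (λ x → f (+ x)) [ N ]
    ∑-scale {N} {c} uc f f-resp = ≈-trans (vector-cong p (λ i → f-resp (≈-sym (residue≈ (c * + toℕ i)))))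
      (reflexive (sym (Sum.sum-permute {p} (λ i → f (+ toℕ i)) (scaling uc))))
      where
      vector-cong : ∀ n {f g : Fin n → ℤ} → (∀ i → f i ≈ g i [ N ]) → Sum.sum f ≈ Sum.sum g [ N ]
      vector-cong zero    h = ≈-refl
      vector-cong (suc n) h = +-cong (h Fin.zero) (vector-cong n (h ∘ Fin.suc))

    τ : ℕ → ℤ
    τ e = ∑ p (λ x → ((+ x) ^ p) ^ e)

    -- The factor `suc k` makes the exponent positive, so that x = 0 contributes 0 and each of the
    -- other q residues contributes 1.
    τ-multiple : ∀ k → τ (suc k ℕ.* q) ≈ + q [ P² ]
    τ-multiple k = begin
      (0ℤ ^ p) ^ e + ∑ q (λ x → ((+ suc x) ^ p) ^ e)   ≈⟨ +-cong (reflexive zero-power) (∑-cong q unit-power) ⟩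
      0ℤ + ∑ q (λ _ → 1ℤ)                              ≡⟨ trans (+-identityˡ _) (trans (∑-const q 1ℤ) (*-identityʳ (+ q))) ⟩
      + q                                              ∎
      where
      open ≈-Reasoning P²
      e = suc k ℕ.* q
      zero-power : (0ℤ ^ p) ^ e ≡ 0ℤ
      zero-power with e | ℕ.≤-trans 0<q (ℕ.m≤m+n q (k ℕ.* q))
      ... | suc e′ | _ = refl
      unit-power : ∀ {x} → x < q → ((+ suc x) ^ p) ^ e ≈ 1ℤ [ P² ]
      unit-power {x} x<q = begin
        ((+ suc x) ^ p) ^ (suc k ℕ.* q)    ≡⟨ cong (((+ suc x) ^ p) ^_) (ℕ.*-comm (suc k) q) ⟩
        ((+ suc x) ^ p) ^ (q ℕ.* suc k)    ≡⟨ ^-*-assoc ((+ suc x) ^ p) q (suc k) ⟨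
        (((+ suc x) ^ p) ^ q) ^ suc k      ≈⟨ ^-cong (suc k) (lift-unit (Unit-small (s≤s z≤n) (s≤s x<q))) ⟩
        1ℤ ^ suc k                         ≡⟨ ^-zeroˡ (suc k) ⟩
        1ℤ                                 ∎

    -- Replacing x by cx permutes the residues and multiplies the sum by (c^p)^e. For r = e mod q
    -- and c^r ≢ 1 the number (c^p)^e - 1 is a unit, so the sum vanishes even modulo p².
    τ-nonmultiple : ∀ e → ¬ q ℕ.∣ e → τ e ≈ 0ℤ [ P² ]
    τ-nonmultiple e q∤e = go (nontrivial-power r 0<r (ℕ.m%n<n e q))
      where
      instance _ = ℕ.>-nonZero 0<q
      r = e ℕ.% q
      0<r : 0 < r
      0<r = ℕ.n≢0⇒n>0 (λ r≡0 → q∤e (ℕ.m%n≡0⇒n∣m e q r≡0))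
      go : ∃[ c ] Unit c × ¬ c ^ r ≈ 1ℤ [ P ] → τ e ≈ 0ℤ [ P² ]
      go (c , uc , c^r≉1) = cancel² {(c ^ p) ^ e - 1ℤ} unit
        (lin₁ 1ℤ 0ℤ scaled (lemma ((c ^ p) ^ e) (τ e) P²))
        where
        lemma : ∀ u t N → (u - 1ℤ) * t - (u - 1ℤ) * 0ℤ ≡ 1ℤ * (u * t - t) + 0ℤ * N
        lemma = solve-∀
        c^e≈c^r : c ^ e ≈ c ^ r [ P ]
        c^e≈c^r = begin
          c ^ e                              ≡⟨ cong (c ^_) (ℕ.m≡m%n+[m/n]*n e q) ⟩
          c ^ (r ℕ.+ e ℕ./ q ℕ.* q)          ≡⟨ ^-distribˡ-+-* c r (e ℕ./ q ℕ.* q) ⟩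
          c ^ r * c ^ (e ℕ./ q ℕ.* q)        ≡⟨ cong (λ k → c ^ r * c ^ k) (ℕ.*-comm (e ℕ./ q) q) ⟩
          c ^ r * c ^ (q ℕ.* (e ℕ./ q))      ≡⟨ cong (_*_ (c ^ r)) (^-*-assoc c q (e ℕ./ q)) ⟨
          c ^ r * (c ^ q) ^ (e ℕ./ q)        ≈⟨ *-congˡ (c ^ r) (^-cong (e ℕ./ q) (fermat-unit uc)) ⟩
          c ^ r * 1ℤ ^ (e ℕ./ q)             ≡⟨ cong (_*_ (c ^ r)) (^-zeroˡ (e ℕ./ q)) ⟩
          c ^ r * 1ℤ                         ≡⟨ *-identityʳ (c ^ r) ⟩
          c ^ r                              ∎
          where open ≈-Reasoning P
        unit : Unit ((c ^ p) ^ e - 1ℤ)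
        unit h = c^r≉1 (≈-trans (≈-sym (≈-trans (^-cong e (fermat c)) c^e≈c^r)) (≈0⇒- h))
        scaled : (c ^ p) ^ e * τ e ≈ τ e [ P² ]
        scaled = begin
          (c ^ p) ^ e * τ e                            ≡⟨ ∑-*ˡ p ((c ^ p) ^ e) (λ x → ((+ x) ^ p) ^ e) ⟨
          ∑ p (λ x → (c ^ p) ^ e * ((+ x) ^ p) ^ e)    ≡⟨ ∑-cong-≡ p (λ {x} _ → trans (cong (_^ e) (*-^ c (+ x) p)) (*-^ (c ^ p) ((+ x) ^ p) e)) ⟨
          ∑ p (λ x → ((c * + x) ^ p) ^ e)              ≈⟨ ∑-scale uc (λ y → (y ^ p) ^ e) (λ h → ^-cong e (lift h)) ⟩
          τ e                                          ∎
          where open ≈-Reasoning P²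

  -- The coefficient of x^t in (1 + x)^i (1 − x)^j, computed from 1 − x = 2 − (1 + x)
  coefficient : ℕ → ℕ → ℕ → ℤ
  coefficient i j t = B j (λ s k → (+ 2) ^ s * (-1ℤ) ^ k * bin (i ℕ.+ k) t)

  -- Multiplication by 1 - x = 2 - (1 + x).
  coefficient-suc-j : ∀ i j t → coefficient i (suc j) t ≡ + 2 * coefficient i j t - coefficient (suc i) j t
  coefficient-suc-j i j t = begin
    B j (λ s k → (+ 2) ^ suc s * (-1ℤ) ^ k * bin (i ℕ.+ k) t) + B j (λ s k → (+ 2) ^ s * (-1ℤ) ^ suc k * bin (i ℕ.+ suc k) t)
      ≡⟨ cong₂ _+_ (B-cong-≡ j (λ s k → double ((+ 2) ^ s) ((-1ℤ) ^ k) (bin (i ℕ.+ k) t)))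
           (B-cong-≡ j (λ s k → trans (cong (λ v → (+ 2) ^ s * (-1ℤ) ^ suc k * bin v t) (ℕ.+-suc i k)) (negate ((+ 2) ^ s) ((-1ℤ) ^ k) (bin (suc i ℕ.+ k) t)))) ⟩
    B j (λ s k → + 2 * h s k + 0ℤ * h s k) + B j (λ s k → -1ℤ * h′ s k + 0ℤ * h′ s k)
      ≡⟨ cong₂ _+_ (B-linear j (+ 2) 0ℤ h h) (B-linear j -1ℤ 0ℤ h′ h′) ⟩
    + 2 * B j h + 0ℤ * B j h + (-1ℤ * B j h′ + 0ℤ * B j h′)
      ≡⟨ collect (B j h) (B j h′) ⟩
    + 2 * B j h - B j h′ ∎
    where
    open ≡-Reasoning
    h h′ : ℕ → ℕ → ℤ
    h  s k = (+ 2) ^ s * (-1ℤ) ^ k * bin (i ℕ.+ k) t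
    h′ s k = (+ 2) ^ s * (-1ℤ) ^ k * bin (suc i ℕ.+ k) t
    double : ∀ u v w → + 2 * u * v * w ≡ + 2 * (u * v * w) + 0ℤ * (u * v * w)
    double = solve-∀
    negate : ∀ u v w → u * (-1ℤ * v) * w ≡ -1ℤ * (u * v * w) + 0ℤ * (u * v * w)
    negate = solve-∀
    collect : ∀ x y → + 2 * x + 0ℤ * x + (-1ℤ * y + 0ℤ * y) ≡ + 2 * x - y
    collect = solve-∀

  -- Multiplication by 1 + x, which is Pascal's rule.
  coefficient-suc-i : ∀ i j t → coefficient (suc i) j (suc t) ≡ coefficient i j (suc t) + coefficient i j t
  coefficient-suc-i i j t = begin
    B j (λ s k → (+ 2) ^ s * (-1ℤ) ^ k * bin (suc i ℕ.+ k) (suc t))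
      ≡⟨ B-cong-≡ j (λ s k → trans (cong (_*_ ((+ 2) ^ s * (-1ℤ) ^ k)) (pascal (i ℕ.+ k) t))
           (distribute ((+ 2) ^ s * (-1ℤ) ^ k) (bin (i ℕ.+ k) t) (bin (i ℕ.+ k) (suc t)))) ⟩
    B j (λ s k → 1ℤ * h (suc t) s k + 1ℤ * h t s k)  ≡⟨ B-linear j 1ℤ 1ℤ (h (suc t)) (h t) ⟩
    1ℤ * B j (h (suc t)) + 1ℤ * B j (h t)            ≡⟨ cong₂ _+_ (*-identityˡ (B j (h (suc t)))) (*-identityˡ (B j (h t))) ⟩
    B j (h (suc t)) + B j (h t)                      ∎
    where
    open ≡-Reasoning
    h : ℕ → ℕ → ℕ → ℤ
    h t s k = (+ 2) ^ s * (-1ℤ) ^ k * bin (i ℕ.+ k) t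
    distribute : ∀ u v w → u * (v + w) ≡ 1ℤ * (u * w) + 1ℤ * (u * v)
    distribute = solve-∀

  coefficient-0 : ∀ i j → coefficient i j 0 ≡ 1ℤ
  coefficient-0 i zero    = trans (*-identityˡ (bin (i ℕ.+ 0) 0)) (bin-n-0 (i ℕ.+ 0))
  coefficient-0 i (suc j) = trans (coefficient-suc-j i j 0)
    (cong₂ (λ u v → + 2 * u - v) (coefficient-0 i j) (coefficient-0 (suc i) j))

  -- (1 + x)(1 − x) = 1 − x²
  coefficient-square : ∀ i j t → coefficient (suc i) (suc j) (suc (suc t)) ≡ coefficient i j (suc (suc t)) - coefficient i j t
  coefficient-square i j t = begin
    coefficient (suc i) (suc j) (suc (suc t))
      ≡⟨ coefficient-suc-j (suc i) j (suc (suc t)) ⟩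
    + 2 * coefficient (suc i) j (suc (suc t)) - coefficient (suc (suc i)) j (suc (suc t))
      ≡⟨ cong (λ v → + 2 * coefficient (suc i) j (suc (suc t)) - v) (coefficient-suc-i (suc i) j (suc t)) ⟩
    + 2 * coefficient (suc i) j (suc (suc t)) - (coefficient (suc i) j (suc (suc t)) + coefficient (suc i) j (suc t))
      ≡⟨ cong₂ (λ u v → + 2 * u - (u + v)) (coefficient-suc-i i j (suc t)) (coefficient-suc-i i j t) ⟩
    + 2 * (c₂ + c₁) - (c₂ + c₁ + (c₁ + c₀))
      ≡⟨ collect c₀ c₁ c₂ ⟩
    c₂ - c₀ ∎
    where
    open ≡-Reasoning
    c₀ = coefficient i j t
    c₁ = coefficient i j (suc t)
    c₂ = coefficient i j (suc (suc t))
    collect : ∀ a b c → + 2 * (c + b) - (c + b + (b + a)) ≡ c - a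
    collect = solve-∀

  coefficient-1 : ∀ n → coefficient n n 1 ≡ 0ℤ
  coefficient-1 zero    = trans (*-identityˡ (bin 0 1)) (bin-> {0} {1} (s≤s z≤n))
  coefficient-1 (suc n) = begin
    coefficient (suc n) (suc n) 1                                 ≡⟨ coefficient-suc-i n (suc n) 0 ⟩
    coefficient n (suc n) 1 + coefficient n (suc n) 0             ≡⟨ cong₂ _+_ (coefficient-suc-j n n 1) (coefficient-0 n (suc n)) ⟩
    + 2 * coefficient n n 1 - coefficient (suc n) n 1 + 1ℤ        ≡⟨ cong (λ v → + 2 * coefficient n n 1 - v + 1ℤ) (coefficient-suc-i n n 0) ⟩
    + 2 * coefficient n n 1 - (coefficient n n 1 + coefficient n n 0) + 1ℤ
      ≡⟨ cong₂ (λ u v → + 2 * u - (u + v) + 1ℤ) (coefficient-1 n) (coefficient-0 n n) ⟩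
    0ℤ                                                            ∎
    where open ≡-Reasoning

  -- (1 - x²)^n has no odd powers. With the index written as t * 2, `suc t ℕ.* 2` reduces to a
  -- double successor, the shape that `coefficient-square` expects.
  coefficient-odd : ∀ n t → coefficient n n (suc (t ℕ.* 2)) ≡ 0ℤ
  coefficient-odd n       zero    = coefficient-1 n
  coefficient-odd zero    (suc t) = trans (*-identityˡ (bin 0 (suc (suc t ℕ.* 2)))) (bin-> {0} {suc (suc t ℕ.* 2)} (s≤s z≤n))
  coefficient-odd (suc n) (suc t) = trans (coefficient-square n n (suc (t ℕ.* 2)))
    (cong₂ _-_ (coefficient-odd n (suc t)) (coefficient-odd n t))

  coefficient-even : ∀ n t → coefficient n n (t ℕ.* 2) ≡ (-1ℤ) ^ t * bin n t
  coefficient-even n       zero    = trans (coefficient-0 n n) (sym (trans (*-identityˡ (bin n 0)) (bin-n-0 n)))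
  coefficient-even zero    (suc t) = trans
    (trans (*-identityˡ (bin 0 (suc t ℕ.* 2))) (bin-> {0} {suc t ℕ.* 2} (s≤s z≤n)))
    (sym (trans (cong (_*_ ((-1ℤ) ^ suc t)) (bin-> {0} {suc t} (s≤s z≤n))) (*-zeroʳ ((-1ℤ) ^ suc t))))
  coefficient-even (suc n) (suc t) = begin
    coefficient (suc n) (suc n) (suc t ℕ.* 2)                   ≡⟨ coefficient-square n n (t ℕ.* 2) ⟩
    coefficient n n (suc t ℕ.* 2) - coefficient n n (t ℕ.* 2)   ≡⟨ cong₂ _-_ (coefficient-even n (suc t)) (coefficient-even n t) ⟩
    (-1ℤ) ^ suc t * bin n (suc t) - (-1ℤ) ^ t * bin n t         ≡⟨ collect ((-1ℤ) ^ t) (bin n t) (bin n (suc t)) ⟩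
    (-1ℤ) ^ suc t * (bin n t + bin n (suc t))                   ≡⟨ cong (_*_ ((-1ℤ) ^ suc t)) (pascal n t) ⟨
    (-1ℤ) ^ suc t * bin (suc n) (suc t)                         ∎
    where
    open ≡-Reasoning
    collect : ∀ s a b → -1ℤ * s * b - s * a ≡ -1ℤ * s * (a + b)
    collect = solve-∀

  -- The central binomial sum modulo p²

  module CentralSum (n : ℕ) (p-prime : Prime (suc (2 ℕ.* n))) where

    open Modular (2 ℕ.* n) p-prime

    central : ℕ → ℤ
    central k = bin (2 ℕ.* k) k

    -- Induction by the ratio of consecutive terms: -16 (n - k)(n + k + 1) = 4 (2k + 1)² - 4 (2n +
    -- 1)², and 2n + 1 = p. The common factor (k + 1)² is a unit for k < n.
    central²≈ : ∀ k → k ≤ n → central k * central k ≈ (- + 16) ^ k * (bin n k * bin (n ℕ.+ k) k) [ P² ]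
    central²≈ zero    _   = reflexive (trans (cong₂ _*_ (bin-n-0 0) (bin-n-0 0))
      (sym (trans (*-identityˡ (bin n 0 * bin (n ℕ.+ 0) 0)) (cong₂ _*_ (bin-n-0 n) (bin-n-0 (n ℕ.+ 0))))))
    central²≈ (suc k) k<n = cancel² {(1ℤ + + k) * (1ℤ + + k)} (Unit-* 1+k 1+k) (begin
      (1ℤ + + k) * (1ℤ + + k) * (central (suc k) * central (suc k))
        ≡⟨ regroup (1ℤ + + k) (central (suc k)) ⟩
      (1ℤ + + k) * central (suc k) * ((1ℤ + + k) * central (suc k))
        ≡⟨ cong₂ _*_ (central-suc k) (central-suc k) ⟩
      + 2 * (1ℤ + + 2 * + k) * central k * (+ 2 * (1ℤ + + 2 * + k) * central k)
        ≈⟨ lin₁ (+ 4 * (1ℤ + + 2 * + k) * (1ℤ + + 2 * + k)) (+ 4 * ((- + 16) ^ k * (bin n k * bin (n ℕ.+ k) k)))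
             (central²≈ k (ℕ.<⇒≤ k<n))
             (trans (key (+ k) (central k) (+ n) ((- + 16) ^ k) (bin n k) (bin (n ℕ.+ k) k)) (cong (λ N → + 4 * (1ℤ + + 2 * + k) * (1ℤ + + 2 * + k) *
                (central k * central k - (- + 16) ^ k * (bin n k * bin (n ℕ.+ k) k)) + + 4 * ((- + 16) ^ k * (bin n k * bin (n ℕ.+ k) k)) * (N * N)) 2n+1)) ⟩
      - + 16 * (- + 16) ^ k * ((+ n - + k) * bin n k * ((1ℤ + (+ n + + k)) * bin (n ℕ.+ k) k))
        ≡⟨ cong₂ (λ u v → - + 16 * (- + 16) ^ k * (u * v)) (bin-suc-k n k) (bin-absorb (n ℕ.+ k) k) ⟨
      - + 16 * (- + 16) ^ k * ((1ℤ + + k) * bin n (suc k) * ((1ℤ + + k) * bin (suc (n ℕ.+ k)) (suc k)))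
        ≡⟨ regroup′ (- + 16 * (- + 16) ^ k) (1ℤ + + k) (bin n (suc k)) (bin (suc (n ℕ.+ k)) (suc k)) ⟩
      (1ℤ + + k) * (1ℤ + + k) * (- + 16 * (- + 16) ^ k * (bin n (suc k) * bin (suc (n ℕ.+ k)) (suc k)))
        ≡⟨ cong (λ v → (1ℤ + + k) * (1ℤ + + k) * (- + 16 * (- + 16) ^ k * (bin n (suc k) * bin v (suc k)))) (ℕ.+-suc n k) ⟨
      (1ℤ + + k) * (1ℤ + + k) * ((- + 16) ^ suc k * (bin n (suc k) * bin (n ℕ.+ suc k) (suc k))) ∎)
      where
      open ≈-Reasoning P²
      1+k : Unit (1ℤ + + k)
      1+k = Unit-small (s≤s z≤n) (s≤s (ℕ.≤-trans k<n (ℕ.m≤m+n n (n ℕ.+ 0))))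
      2n+1 : 1ℤ + + 2 * + n ≡ P
      2n+1 = cong (_+_ 1ℤ) (sym (pos-* 2 n))
      regroup : ∀ a b → a * a * (b * b) ≡ a * b * (a * b)
      regroup = solve-∀
      regroup′ : ∀ s a b c → s * (a * b * (a * c)) ≡ a * a * (s * (b * c))
      regroup′ = solve-∀
      key : ∀ k c n s b b′ →
            + 2 * (1ℤ + + 2 * k) * c * (+ 2 * (1ℤ + + 2 * k) * c) - - + 16 * s * ((n - k) * b * ((1ℤ + (n + k)) * b′)) ≡
            + 4 * (1ℤ + + 2 * k) * (1ℤ + + 2 * k) * (c * c - s * (b * b′)) + + 4 * (s * (b * b′)) * ((1ℤ + + 2 * n) * (1ℤ + + 2 * n))
      key = solve-∀

    -- (-16)^k 32^(n-k) = 16^n (-1)^k 2^(n-k), and C(n+k, k) = C(n+k, n) turns the sum into the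
    -- defining expansion of `coefficient n n n`.
    central-sum≈ : ∑ (suc n) (λ k → central k * central k * (+ 32) ^ (n ∸ k)) ≈ (+ 16) ^ n * coefficient n n n [ P² ]
    central-sum≈ = begin
      ∑ (suc n) (λ k → central k * central k * (+ 32) ^ (n ∸ k))
        ≈⟨ ∑-cong (suc n) (λ {k} k≤n → *-congʳ ((+ 32) ^ (n ∸ k)) (central²≈ k (ℕ.s≤s⁻¹ k≤n))) ⟩
      ∑ (suc n) (λ k → (- + 16) ^ k * (bin n k * bin (n ℕ.+ k) k) * (+ 32) ^ (n ∸ k))
        ≡⟨ ∑-cong-≡ (suc n) (λ {k} k≤n → term k (ℕ.s≤s⁻¹ k≤n)) ⟩
      ∑ (suc n) (λ k → (+ 16) ^ n * (bin n k * ((+ 2) ^ (n ∸ k) * (-1ℤ) ^ k * bin (n ℕ.+ k) n)))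
        ≡⟨ ∑-*ˡ (suc n) ((+ 16) ^ n) (λ k → bin n k * ((+ 2) ^ (n ∸ k) * (-1ℤ) ^ k * bin (n ℕ.+ k) n)) ⟩
      (+ 16) ^ n * ∑ (suc n) (λ k → bin n k * ((+ 2) ^ (n ∸ k) * (-1ℤ) ^ k * bin (n ℕ.+ k) n))
        ≡⟨ cong (_*_ ((+ 16) ^ n)) (B≡∑ n (λ s k → (+ 2) ^ s * (-1ℤ) ^ k * bin (n ℕ.+ k) n)) ⟨
      (+ 16) ^ n * coefficient n n n ∎
      where
      open ≈-Reasoning P²
      term : ∀ k → k ≤ n → (- + 16) ^ k * (bin n k * bin (n ℕ.+ k) k) * (+ 32) ^ (n ∸ k) ≡
             (+ 16) ^ n * (bin n k * ((+ 2) ^ (n ∸ k) * (-1ℤ) ^ k * bin (n ℕ.+ k) n))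
      term k k≤n = trans (cong₂ (λ u v → u * (bin n k * bin (n ℕ.+ k) k) * v) (*-^ -1ℤ (+ 16) k) (*-^ (+ 16) (+ 2) (n ∸ k)))
        (trans (regroup ((-1ℤ) ^ k) ((+ 16) ^ k) (bin n k) (bin (n ℕ.+ k) k) ((+ 16) ^ (n ∸ k)) ((+ 2) ^ (n ∸ k)))
          (cong₂ (λ u v → u * (bin n k * ((+ 2) ^ (n ∸ k) * (-1ℤ) ^ k * v)))
            (trans (sym (^-distribˡ-+-* (+ 16) k (n ∸ k))) (cong ((+ 16) ^_) (ℕ.m+[n∸m]≡n k≤n))) (sym (bin-sym n k))))
        where
        regroup : ∀ s x b c y t → s * x * (b * c) * (y * t) ≡ x * y * (b * (t * s * c))
        regroup = solve-∀

  -- Signs, and their sums modulo 4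

  ∏ : ℕ → (ℕ → ℤ) → ℤ
  ∏ zero    f = 1ℤ
  ∏ (suc n) f = ∏ n f * f n

  data IsSign : ℤ → Set where
    plus  : IsSign 1ℤ
    minus : IsSign -1ℤ

  IsSign-* : ∀ {x y} → IsSign x → IsSign y → IsSign (x * y)
  IsSign-* plus  plus  = plus
  IsSign-* plus  minus = minus
  IsSign-* minus plus  = minus
  IsSign-* minus minus = plus

  IsSign-^ : ∀ {x} n → IsSign x → IsSign (x ^ n)
  IsSign-^ zero    sx = plus
  IsSign-^ (suc n) sx = IsSign-* sx (IsSign-^ n sx)

  IsSign-∏ : ∀ n {f} → (∀ {k} → k < n → IsSign (f k)) → IsSign (∏ n f)
  IsSign-∏ zero    h = plus
  IsSign-∏ (suc n) h = IsSign-* (IsSign-∏ n (h ∘ ℕ.m≤n⇒m≤1+n)) (h ℕ.≤-refl)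

  sign-square : ∀ {x} → IsSign x → x * x ≡ 1ℤ
  sign-square plus  = refl
  sign-square minus = refl

  sign-≈⇒≡ : ∀ {N x y} → 2 < ∣ N ∣ → IsSign x → IsSign y → x ≈ y [ N ] → x ≡ y
  sign-≈⇒≡ 2<N plus  plus  h = refl
  sign-≈⇒≡ 2<N plus  minus h = ≈⇒≡ h 2<N
  sign-≈⇒≡ 2<N minus plus  h = ≈⇒≡ h 2<N
  sign-≈⇒≡ 2<N minus minus h = refl

  -- Each factor −1 lowers the sum by 2 and flips the product.
  sum-of-signs : ∀ n {f} → (∀ {k} → k < n → IsSign (f k)) → ∑ n f ≈ + n - 1ℤ + ∏ n f [ + 4 ]
  sum-of-signs zero        h = ≈-refl
  sum-of-signs (suc n) {f} h = begin
    ∑ (suc n) f                          ≡⟨ ∑-snoc n f ⟩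
    ∑ n f + f n                          ≈⟨ +-cong (sum-of-signs n (h ∘ ℕ.m≤n⇒m≤1+n)) ≈-refl ⟩
    + n - 1ℤ + ∏ n f + f n               ≈⟨ lin₁ 1ℤ 0ℤ (add (IsSign-∏ n (h ∘ ℕ.m≤n⇒m≤1+n)) (h ℕ.≤-refl)) (lemma (+ n) (∏ n f) (f n)) ⟩
    1ℤ + + n - 1ℤ + ∏ n f * f n          ∎
    where
    open ≈-Reasoning (+ 4)
    add : ∀ {x y} → IsSign x → IsSign y → x + y ≈ x * y + 1ℤ [ + 4 ]
    add plus  plus  = congruent 0ℤ refl
    add plus  minus = congruent 0ℤ refl
    add minus plus  = congruent 0ℤ refl
    add minus minus = congruent -1ℤ refl
    lemma : ∀ n x y → n - 1ℤ + x + y - (1ℤ + n - 1ℤ + x * y) ≡ 1ℤ * (x + y - (x * y + 1ℤ)) + 0ℤ * + 4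
    lemma = solve-∀

  ^-minus-one-mod-4 : ∀ m → (-1ℤ) ^ m ≈ 1ℤ - + 2 * + m [ + 4 ]
  ^-minus-one-mod-4 zero    = ≈-refl
  ^-minus-one-mod-4 (suc m) = lin₁ -1ℤ (+ m) (^-minus-one-mod-4 m) (lemma ((-1ℤ) ^ m) (+ m))
    where
    lemma : ∀ s m → -1ℤ * s - (1ℤ - + 2 * (1ℤ + m)) ≡ -1ℤ * (s - (1ℤ - + 2 * m)) + m * + 4
    lemma = solve-∀

  ∣∑∣≤ : ∀ n {f} → (∀ {k} → k < n → ∣ f k ∣ ≤ 1) → ∣ ∑ n f ∣ ≤ n
  ∣∑∣≤ zero        h = z≤n
  ∣∑∣≤ (suc n) {f} h = ℕ.≤-trans (ℤ.∣i+j∣≤∣i∣+∣j∣ (f 0) (∑ n (f ∘ suc))) (ℕ.+-mono-≤ (h (s≤s z≤n)) (∣∑∣≤ n {f ∘ suc} (h ∘ s≤s)))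

  -- The quadratic character

  module Character (n : ℕ) (p-prime : Prime (suc (2 ℕ.* n))) where

    open Modular (2 ℕ.* n) p-prime
    open PowerSums (2 ℕ.* n) p-prime

    0<n : 0 < n
    0<n = ℕ.*-cancelˡ-< 2 0 n 0<q

    n<2n : n < 2 ℕ.* n
    n<2n = ℕ.m<m+n n (subst (0 <_) (sym (ℕ.+-identityʳ n)) 0<n)

    n<p : n < p
    n<p = ℕ.<-trans n<2n ℕ.≤-refl

    2<p : 2 < p
    2<p = s≤s (ℕ.*-monoʳ-≤ 2 0<n)

    unit-2 : Unit (+ 2)
    unit-2 = Unit-small (s≤s z≤n) 2<p

    2n+1≡P : 1ℤ + + 2 * + n ≡ P
    2n+1≡P = cong (_+_ 1ℤ) (sym (pos-* 2 n))

    -- Euler's criterion serves as the definition of the Legendre symbol, so that multiplicativity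
    -- and invariance modulo p come from powers.
    χ : ℤ → ℤ
    χ v with v ≈? 0ℤ [ P ] | v ^ n ≈? 1ℤ [ P ]
    ... | yes _ | _     = 0ℤ
    ... | no  _ | yes _ = 1ℤ
    ... | no  _ | no  _ = -1ℤ

    χ-zero : ∀ {v} → v ≈ 0ℤ [ P ] → χ v ≡ 0ℤ
    χ-zero {v} h with v ≈? 0ℤ [ P ] | v ^ n ≈? 1ℤ [ P ]
    ... | yes _ | _ = refl
    ... | no ¬h | _ = contradiction h ¬h

    χ-sign : ∀ {v} → Unit v → IsSign (χ v)
    χ-sign {v} uv with v ≈? 0ℤ [ P ] | v ^ n ≈? 1ℤ [ P ]
    ... | yes h | _     = contradiction h uv
    ... | no  _ | yes _ = plus
    ... | no  _ | no  _ = minus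

    square-root-of-1 : ∀ {x} → x * x ≈ 1ℤ [ P ] → ¬ x ≈ 1ℤ [ P ] → x ≈ -1ℤ [ P ]
    square-root-of-1 {x} h x≉1 with euclid {x - 1ℤ} {x + 1ℤ} (lin₁ 1ℤ 0ℤ h (lemma x P))
      where
      lemma : ∀ x N → (x - 1ℤ) * (x + 1ℤ) - 0ℤ ≡ 1ℤ * (x * x - 1ℤ) + 0ℤ * N
      lemma = solve-∀
    ... | inj₁ e = contradiction (≈0⇒- e) x≉1
    ... | inj₂ e = lin₁ 1ℤ 0ℤ e (lemma x P)
      where
      lemma : ∀ x N → x - -1ℤ ≡ 1ℤ * (x + 1ℤ - 0ℤ) + 0ℤ * N
      lemma = solve-∀

    χ≈ : ∀ v → χ v ≈ v ^ n [ P ]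
    χ≈ v with v ≈? 0ℤ [ P ] | v ^ n ≈? 1ℤ [ P ]
    ... | yes h | _     = ≈-trans (reflexive (sym (zero-power n 0<n))) (^-cong n (≈-sym h))
      where
      zero-power : ∀ n → 0 < n → 0ℤ ^ n ≡ 0ℤ
      zero-power (suc n) _ = refl
    ... | no uv | yes h = ≈-sym h
    -- v^n squares to v^(p-1) ≡ 1 and is not 1, so it is -1.
    ... | no uv | no ¬h = ≈-sym (square-root-of-1 (subst (λ v → v ≈ 1ℤ [ P ]) square (fermat-unit uv)) ¬h)
      where
      square : v ^ (2 ℕ.* n) ≡ v ^ n * v ^ n
      square = trans (cong (λ k → v ^ (n ℕ.+ k)) (ℕ.+-identityʳ n)) (^-distribˡ-+-* v n n)

    sign-unit : ∀ {x} → IsSign x → Unit x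
    sign-unit plus  = Unit-1
    sign-unit minus h = contradiction (≈⇒≡ h 1<p) (λ ())

    χ-resp : ∀ {v w} → v ≈ w [ P ] → χ v ≡ χ w
    χ-resp {v} {w} h = by-cases (v ≈? 0ℤ [ P ])
      where
      by-cases : Dec (v ≈ 0ℤ [ P ]) → χ v ≡ χ w
      by-cases (yes v≈0) = trans (χ-zero v≈0) (sym (χ-zero (≈-trans (≈-sym h) v≈0)))
      by-cases (no  uv)  = sign-≈⇒≡ 2<p (χ-sign uv) (χ-sign (Unit-resp h uv))
        (≈-trans (χ≈ v) (≈-trans (^-cong n h) (≈-sym (χ≈ w))))

    χ-unique : ∀ {v s} → IsSign s → v ^ n ≈ s [ P ] → χ v ≡ s
    χ-unique {v} {s} ss h = sign-≈⇒≡ 2<p (χ-sign uv) ss (≈-trans (χ≈ v) h)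
      where
      uv : Unit v
      uv v≈0 = sign-unit ss (≈-trans (≈-sym h) (≈-trans (≈-sym (χ≈ v)) (reflexive (χ-zero v≈0))))

    χ-* : ∀ v w → χ (v * w) ≡ χ v * χ w
    χ-* v w = by-cases (v ≈? 0ℤ [ P ]) (w ≈? 0ℤ [ P ])
      where
      by-cases : Dec (v ≈ 0ℤ [ P ]) → Dec (w ≈ 0ℤ [ P ]) → χ (v * w) ≡ χ v * χ w
      by-cases (yes v≈0) _ = trans (χ-zero (subst (λ x → v * w ≈ x [ P ]) (*-zeroˡ w) (*-congʳ w v≈0)))
        (sym (trans (cong (_* χ w) (χ-zero v≈0)) (*-zeroˡ (χ w))))
      by-cases (no _) (yes w≈0) = trans (χ-zero (subst (λ x → v * w ≈ x [ P ]) (*-zeroʳ v) (*-congˡ v w≈0)))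
        (sym (trans (cong (_*_ (χ v)) (χ-zero w≈0)) (*-zeroʳ (χ v))))
      by-cases (no uv) (no uw) = χ-unique (IsSign-* (χ-sign uv) (χ-sign uw))
        (subst (λ x → x ≈ χ v * χ w [ P ]) (sym (*-^ v w n)) (*-cong (≈-sym (χ≈ v)) (≈-sym (χ≈ w))))

    ∣χ∣≤1 : ∀ v → ∣ χ v ∣ ≤ 1
    ∣χ∣≤1 v with v ≈? 0ℤ [ P ] | v ^ n ≈? 1ℤ [ P ]
    ... | yes _ | _     = z≤n
    ... | no  _ | yes _ = s≤s z≤n
    ... | no  _ | no  _ = s≤s z≤n

    χ^p : ∀ v → χ v ^ p ≡ χ v
    χ^p v with v ≈? 0ℤ [ P ] | v ^ n ≈? 1ℤ [ P ]
    ... | yes _ | _     = refl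
    ... | no  _ | yes _ = ^-zeroˡ p
    ... | no  _ | no  _ = cong (_*_ -1ℤ) (-1^2k n)

    -- χ v is its own p-th power, so raising Euler's criterion to the power p gains the precision
    -- p².
    χ-lift : ∀ v → χ v ≈ (v ^ p) ^ n [ P² ]
    χ-lift v = begin
      χ v          ≡⟨ χ^p v ⟨
      χ v ^ p      ≈⟨ lift (χ≈ v) ⟩
      (v ^ n) ^ p  ≡⟨ trans (^-*-assoc v n p) (trans (cong (v ^_) (ℕ.*-comm n p)) (sym (^-*-assoc v p n))) ⟩
      (v ^ p) ^ n  ∎
      where open ≈-Reasoning P²

    -- The residues n + 1, ..., 2n are the negatives of n, ..., 1; hence the reversal of the second
    -- half.
    ∑-even : ∀ (f : ℤ → ℤ) → f 0ℤ ≡ 0ℤ → (∀ {x y} → x ≈ - y [ P ] → f x ≡ f y) →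
             ∑ p (λ x → f (+ x)) ≡ + 2 * ∑ n (λ x → f (+ suc x))
    ∑-even f f0 f-even = begin
      f 0ℤ + ∑ (n ℕ.+ (n ℕ.+ 0)) g              ≡⟨ cong₂ (λ u k → u + ∑ (n ℕ.+ k) g) f0 (ℕ.+-identityʳ n) ⟩
      0ℤ + ∑ (n ℕ.+ n) g                        ≡⟨ trans (+-identityˡ (∑ (n ℕ.+ n) g)) (∑-split n n g) ⟩
      ∑ n g + ∑ n (λ x → g (n ℕ.+ x))           ≡⟨ cong (_+_ (∑ n g)) (∑-reverse n (λ x → g (n ℕ.+ x))) ⟩
      ∑ n g + ∑ n (λ x → g (n ℕ.+ (n ∸ suc x))) ≡⟨ cong (_+_ (∑ n g)) (∑-cong-≡ n (λ {x} x<n → f-even (reflect x x<n))) ⟩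
      ∑ n g + ∑ n g                             ≡⟨ lemma (∑ n g) ⟩
      + 2 * ∑ n g                               ∎
      where
      open ≡-Reasoning
      g : ℕ → ℤ
      g x = f (+ suc x)
      lemma : ∀ x → x + x ≡ + 2 * x
      lemma = solve-∀
      reflect : ∀ x → x < n → + suc (n ℕ.+ (n ∸ suc x)) ≈ - (+ suc x) [ P ]
      reflect x x<n = congruent 1ℤ (trans (move (+ suc x) (+ suc (n ℕ.+ (n ∸ suc x))))
        (trans (cong (λ k → + suc k) (trans (ℕ.+-assoc n (n ∸ suc x) (suc x))
          (trans (cong (n ℕ.+_) (ℕ.m∸n+n≡m x<n)) (cong (n ℕ.+_) (sym (ℕ.+-identityʳ n)))))) (sym (*-identityˡ P))))
        where
        move : ∀ a b → b - (- a) ≡ b + a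
        move = solve-∀

    nonresidue : ∃[ g ] χ g ≡ -1ℤ
    nonresidue = go (nontrivial-power n 0<n n<2n)
      where
      go : ∃[ c ] Unit c × ¬ c ^ n ≈ 1ℤ [ P ] → ∃[ g ] χ g ≡ -1ℤ
      go (c , uc , c^n≉1) with χ c | χ-sign uc | χ≈ c
      ... | _ | plus  | h = contradiction (≈-sym h) c^n≉1
      ... | _ | minus | h = c , χ-unique minus (≈-sym h)

  -- Falling factorials and binomials modulo p

  falling : ℤ → ℕ → ℤ
  falling x zero    = 1ℤ
  falling x (suc k) = falling x k * (x - + k)

  falling-bin : ∀ N k → falling (+ N) k ≡ + (k !) * bin N k
  falling-bin N zero    = sym (trans (*-identityˡ (bin N 0)) (bin-n-0 N))
  falling-bin N (suc k) = begin
    falling (+ N) k * (+ N - + k)             ≡⟨ cong (_* (+ N - + k)) (falling-bin N k) ⟩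
    + (k !) * bin N k * (+ N - + k)           ≡⟨ lemma (+ (k !)) (bin N k) (+ N - + k) ⟩
    + (k !) * ((+ N - + k) * bin N k)         ≡⟨ cong (_*_ (+ (k !))) (bin-suc-k N k) ⟨
    + (k !) * ((1ℤ + + k) * bin N (suc k))    ≡⟨ lemma′ (+ (k !)) (1ℤ + + k) (bin N (suc k)) ⟩
    (1ℤ + + k) * + (k !) * bin N (suc k)      ≡⟨ cong (_* bin N (suc k)) (pos-* (suc k) (k !)) ⟨
    + (suc k !) * bin N (suc k)               ∎
    where
    open ≡-Reasoning
    lemma : ∀ a b c → a * b * c ≡ a * (c * b)
    lemma = solve-∀
    lemma′ : ∀ a b c → a * (b * c) ≡ b * a * c
    lemma′ = solve-∀

  -- Induction on b by absorption: the multipliers b + 1 and b + c + 1 move every factor to the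
  -- previous row, and they cancel because they are nonzero.
  trinomial-revision : ∀ b M c → bin (b ℕ.+ M) (b ℕ.+ c) * bin (b ℕ.+ c) b ≡ bin (b ℕ.+ M) b * bin M c
  trinomial-revision zero    M c = trans (cong (_*_ (bin M c)) (bin-n-0 c))
    (trans (*-comm (bin M c) 1ℤ) (cong (_* bin M c) (sym (bin-n-0 M))))
  trinomial-revision (suc b) M c = ℤ.*-cancelˡ-≡ (+ suc b) _ _ (ℤ.*-cancelˡ-≡ (+ suc (b ℕ.+ c)) _ _ (begin
    + suc (b ℕ.+ c) * (+ suc b * (bin (suc (b ℕ.+ M)) (suc (b ℕ.+ c)) * bin (suc (b ℕ.+ c)) (suc b)))
      ≡⟨ pair (+ suc (b ℕ.+ c)) (+ suc b) (bin (suc (b ℕ.+ M)) (suc (b ℕ.+ c))) (bin (suc (b ℕ.+ c)) (suc b)) ⟩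
    + suc (b ℕ.+ c) * bin (suc (b ℕ.+ M)) (suc (b ℕ.+ c)) * (+ suc b * bin (suc (b ℕ.+ c)) (suc b))
      ≡⟨ cong₂ _*_ (bin-absorb (b ℕ.+ M) (b ℕ.+ c)) (bin-absorb (b ℕ.+ c) b) ⟩
    + suc (b ℕ.+ M) * bin (b ℕ.+ M) (b ℕ.+ c) * (+ suc (b ℕ.+ c) * bin (b ℕ.+ c) b)
      ≡⟨ pair′ (+ suc (b ℕ.+ M)) (bin (b ℕ.+ M) (b ℕ.+ c)) (+ suc (b ℕ.+ c)) (bin (b ℕ.+ c) b) ⟩
    + suc (b ℕ.+ c) * (+ suc (b ℕ.+ M) * (bin (b ℕ.+ M) (b ℕ.+ c) * bin (b ℕ.+ c) b))
      ≡⟨ cong (λ v → + suc (b ℕ.+ c) * (+ suc (b ℕ.+ M) * v)) (trinomial-revision b M c) ⟩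
    + suc (b ℕ.+ c) * (+ suc (b ℕ.+ M) * (bin (b ℕ.+ M) b * bin M c))
      ≡⟨ cong (_*_ (+ suc (b ℕ.+ c))) (*-assoc (+ suc (b ℕ.+ M)) (bin (b ℕ.+ M) b) (bin M c)) ⟨
    + suc (b ℕ.+ c) * (+ suc (b ℕ.+ M) * bin (b ℕ.+ M) b * bin M c)
      ≡⟨ cong (λ v → + suc (b ℕ.+ c) * (v * bin M c)) (bin-absorb (b ℕ.+ M) b) ⟨
    + suc (b ℕ.+ c) * (+ suc b * bin (suc (b ℕ.+ M)) (suc b) * bin M c)
      ≡⟨ cong (_*_ (+ suc (b ℕ.+ c))) (*-assoc (+ suc b) (bin (suc (b ℕ.+ M)) (suc b)) (bin M c)) ⟩
    + suc (b ℕ.+ c) * (+ suc b * (bin (suc (b ℕ.+ M)) (suc b) * bin M c)) ∎))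
    where
    open ≡-Reasoning
    pair : ∀ x y u v → x * (y * (u * v)) ≡ x * u * (y * v)
    pair = solve-∀
    pair′ : ∀ x u y v → x * u * (y * v) ≡ y * (x * (u * v))
    pair′ = solve-∀

  module BinomialsModP (q : ℕ) (p-prime : Prime (suc q)) where

    open Modular q p-prime

    -- The lowest digit in Lucas' theorem: row p starts like row 0 as far as column p - 1, and
    -- Pascal's rule propagates this.
    bin-+p : ∀ a b → b < p → bin (a ℕ.+ p) b ≈ bin a b [ P ]
    bin-+p a       zero    _   = reflexive (trans (bin-n-0 (a ℕ.+ p)) (sym (bin-n-0 a)))
    bin-+p zero    (suc b) b<p = ≈-trans (bin-p≈0 b<p) (reflexive (sym (bin-> {0} {suc b} (s≤s z≤n))))
    bin-+p (suc a) (suc b) b<p = begin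
      bin (suc (a ℕ.+ p)) (suc b)                 ≡⟨ pascal (a ℕ.+ p) b ⟩
      bin (a ℕ.+ p) b + bin (a ℕ.+ p) (suc b)     ≈⟨ +-cong (bin-+p a b (ℕ.<-trans ℕ.≤-refl b<p)) (bin-+p a (suc b) b<p) ⟩
      bin a b + bin a (suc b)                     ≡⟨ pascal a b ⟨
      bin (suc a) (suc b)                         ∎
      where open ≈-Reasoning P

    -- Modulo p the upper index i is -(j + 1), and C(-j-1, k) = (-1)^k C(j+k, k). With natural upper
    -- indices this becomes an induction by Pascal's rule, starting from row p, whose inner entries
    -- vanish.
    bin-reflect : ∀ i j k → i ℕ.+ j ≡ q → k ≤ i → bin i k ≈ (-1ℤ) ^ k * bin (j ℕ.+ k) k [ P ]
    bin-reflect i j zero _ _ = reflexive (trans (bin-n-0 i) (sym (trans (*-identityˡ (bin (j ℕ.+ 0) 0)) (bin-n-0 (j ℕ.+ 0)))))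
    bin-reflect i zero (suc k) i+0≡q k<i rewrite trans (sym (ℕ.+-identityʳ i)) i+0≡q =
      subst (λ v → bin q (suc k) ≈ (-1ℤ) ^ suc k * v [ P ]) (sym (bin-n-n (suc k)))
        (lin₂ 1ℤ -1ℤ 0ℤ
          (subst (λ v → v ≈ 0ℤ [ P ]) (pascal q k) (bin-p≈0 {k} (s≤s k<i)))
          (subst (λ v → bin q k ≈ (-1ℤ) ^ k * v [ P ]) (bin-n-n k) (bin-reflect q zero k (ℕ.+-identityʳ q) (ℕ.<⇒≤ k<i)))
          (lemma (bin q k) (bin q (suc k)) ((-1ℤ) ^ k) P))
      where
      lemma : ∀ x y s N → y - -1ℤ * s * 1ℤ ≡ 1ℤ * (x + y - 0ℤ) + -1ℤ * (x - s * 1ℤ) + 0ℤ * N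
      lemma = solve-∀
    bin-reflect i (suc j) (suc k) i+j≡q k<i = subst (λ v → bin i (suc k) ≈ (-1ℤ) ^ suc k * v [ P ])
      (trans (+-comm (bin (j ℕ.+ suc k) (suc k)) (bin (j ℕ.+ suc k) k)) (sym (pascal (j ℕ.+ suc k) k)))
      (lin₂ 1ℤ -1ℤ 0ℤ
        (subst (λ v → v ≈ (-1ℤ) ^ suc k * bin (j ℕ.+ suc k) (suc k) [ P ]) (pascal i k)
          (bin-reflect (suc i) j (suc k) (trans (sym (ℕ.+-suc i j)) i+j≡q) (ℕ.m≤n⇒m≤1+n k<i)))
        (subst (λ v → bin i k ≈ (-1ℤ) ^ k * bin v k [ P ]) (sym (ℕ.+-suc j k))
          (bin-reflect i (suc j) k i+j≡q (ℕ.<⇒≤ k<i)))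
        (lemma (bin i k) (bin i (suc k)) ((-1ℤ) ^ k) (bin (j ℕ.+ suc k) (suc k)) (bin (j ℕ.+ suc k) k) P))
      where
      lemma : ∀ x y s u v N → y - -1ℤ * s * (u + v) ≡ 1ℤ * (x + y - -1ℤ * s * u) + -1ℤ * (x - s * v) + 0ℤ * N
      lemma = solve-∀

    Unit-bin : ∀ N k → N < p → k ≤ N → Unit (bin N k)
    Unit-bin N zero    _   _   h = Unit-1 (subst (λ v → v ≈ 0ℤ [ P ]) (bin-n-0 N) h)
    Unit-bin N (suc k) N<p k<N h = Unit-* {+ N - + k} {bin N k}
      (subst Unit (trans (sym (ℤ.⊖-≥ (ℕ.<⇒≤ k<N))) (sym (ℤ.m-n≡m⊖n N k))) (Unit-small (ℕ.m<n⇒0<n∸m k<N) (ℕ.≤-<-trans (ℕ.m∸n≤m N k) N<p)))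
      (Unit-bin N k N<p (ℕ.<⇒≤ k<N))
      (subst (λ v → v ≈ 0ℤ [ P ]) (bin-suc-k N k)
        (subst (λ v → (1ℤ + + k) * bin N (suc k) ≈ v [ P ]) (*-zeroʳ (1ℤ + + k)) (*-congˡ (1ℤ + + k) h)))

    Unit-! : ∀ k → k < p → Unit (+ (k !))
    Unit-! zero    _   = Unit-1
    Unit-! (suc k) k<p = subst Unit (sym (pos-* (suc k) (k !)))
      (Unit-* (Unit-small (s≤s z≤n) k<p) (Unit-! k (ℕ.<-trans ℕ.≤-refl k<p)))

  -- Binomials at multiples of m = (p - 1)/4

  module QuarterBinomials (m : ℕ) (p-prime : Prime (suc (2 ℕ.* (m ℕ.* 2)))) where

    n q : ℕ
    n = m ℕ.* 2
    q = 2 ℕ.* n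

    open Modular q p-prime
    open BinomialsModP q p-prime
    open Character n p-prime using (0<n; n<p; unit-2; 2n+1≡P)

    -- As n = 2m and q = 4m, `C₆` is C(6m, m), `C₆′` is C(6m + 1, m), and `V` contains C(6m, 3m).
    -- `U` and `V` are the coefficients of Z^m and Z^(3m) in `T≈`.
    s Cₙ C₆ C₆′ U V : ℤ
    s   = (-1ℤ) ^ m
    Cₙ   = bin n m
    C₆  = bin (n ℕ.+ q) m
    C₆′ = bin (n ℕ.+ p) m
    U   = (1ℤ - + n) * Cₙ + + 2 * + n * C₆
    V   = + n * bin (n ℕ.+ q) (n ℕ.+ m)

    0<m : 0 < m
    0<m = ℕ.*-cancelʳ-< 2 0 m 0<n

    m≤n : m ≤ n
    m≤n = ℕ.m≤m*n m 2

    m<p : m < p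
    m<p = ℕ.≤-<-trans m≤n n<p

    4m+1≡P : 1ℤ + + 4 * + m ≡ P
    4m+1≡P = trans (trans (lemma (+ m)) (cong (λ v → 1ℤ + + 2 * v) (sym (pos-* m 2)))) 2n+1≡P
      where
      lemma : ∀ m → 1ℤ + + 4 * m ≡ 1ℤ + + 2 * (m * + 2)
      lemma = solve-∀

    s-unit : Unit s
    s-unit = Unit-^ m (λ h → contradiction (≈⇒≡ h 1<p) (λ ()))

    C-unit : Unit Cₙ
    C-unit = Unit-bin n m n<p m≤n

    bin-3m : bin (n ℕ.+ m) n ≈ s * Cₙ [ P ]
    bin-3m = subst (λ v → bin (n ℕ.+ m) n ≈ s * bin v m [ P ]) (m+m m)
      (≈-trans (reflexive (bin-sym n m)) (bin-reflect (n ℕ.+ m) m m (3m+m m) (ℕ.m≤n+m m n)))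
      where
      m+m : ∀ m → m ℕ.+ m ≡ m ℕ.* 2
      m+m = ℕ.solve-∀
      3m+m : ∀ m → m ℕ.* 2 ℕ.+ m ℕ.+ m ≡ 2 ℕ.* (m ℕ.* 2)
      3m+m = ℕ.solve-∀

    bin-4m : bin q m ≈ s [ P ]
    bin-4m = subst (λ v → bin q m ≈ v [ P ]) (trans (cong (_*_ s) (bin-n-n m)) (*-identityʳ s))
      (bin-reflect q 0 m (ℕ.+-identityʳ q) (ℕ.≤-trans m≤n (ℕ.m≤m+n n (n ℕ.+ 0))))

    -- n C(6m, n) = (4m + 1) C(6m, n - 1). As 6m = p + (n - 1), the last binomial is C(n - 1, n - 1)
    -- modulo p.
    bin-6m-2m : ∃[ b ] + n * bin (n ℕ.+ q) n ≡ P * b × b ≈ 1ℤ [ P ]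
    bin-6m-2m = go n 0<n n<p
      where
      lemma : ∀ n q b → (1ℤ + n + q - n) * b ≡ (1ℤ + q) * b
      lemma = solve-∀
      go : ∀ n → 0 < n → n < p → ∃[ b ] + n * bin (n ℕ.+ q) n ≡ P * b × b ≈ 1ℤ [ P ]
      go (suc n′) _ n<p = bin (suc n′ ℕ.+ q) n′
        , trans (bin-suc-k (suc n′ ℕ.+ q) n′) (lemma (+ n′) (+ q) (bin (suc n′ ℕ.+ q) n′))
        , subst (λ v → bin v n′ ≈ 1ℤ [ P ]) (ℕ.+-suc n′ q)
            (≈-trans (bin-+p n′ n′ (ℕ.<-trans ℕ.≤-refl n<p)) (reflexive (bin-n-n n′)))

    -- C(6m, 3m) C(3m, 2m) = C(6m, 2m) C(4m, m) brings `V` down to binomials with known residues.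
    V-bin-3m : ∃[ b ] V * bin (n ℕ.+ m) n ≡ P * b × b ≈ s [ P ]
    V-bin-3m = go bin-6m-2m
      where
      go : ∃[ b ] + n * bin (n ℕ.+ q) n ≡ P * b × b ≈ 1ℤ [ P ] → ∃[ b ] V * bin (n ℕ.+ m) n ≡ P * b × b ≈ s [ P ]
      go (b , e , b≈1) = b * bin q m , eq , ≈-trans (*-cong b≈1 bin-4m) (reflexive (*-identityˡ s))
        where
        open ≡-Reasoning
        eq : V * bin (n ℕ.+ m) n ≡ P * (b * bin q m)
        eq = begin
          + n * bin (n ℕ.+ q) (n ℕ.+ m) * bin (n ℕ.+ m) n    ≡⟨ *-assoc (+ n) (bin (n ℕ.+ q) (n ℕ.+ m)) (bin (n ℕ.+ m) n) ⟩
          + n * (bin (n ℕ.+ q) (n ℕ.+ m) * bin (n ℕ.+ m) n)  ≡⟨ cong (_*_ (+ n)) (trinomial-revision n q m) ⟩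
          + n * (bin (n ℕ.+ q) n * bin q m)                  ≡⟨ *-assoc (+ n) (bin (n ℕ.+ q) n) (bin q m) ⟨
          + n * bin (n ℕ.+ q) n * bin q m                    ≡⟨ cong (_* bin q m) e ⟩
          P * b * bin q m                                    ≡⟨ *-assoc P b (bin q m) ⟩
          P * (b * bin q m)                                  ∎

    V≈0 : V ≈ 0ℤ [ P ]
    V≈0 = go V-bin-3m
      where
      go : ∃[ b ] V * bin (n ℕ.+ m) n ≡ P * b × b ≈ s [ P ] → V ≈ 0ℤ [ P ]
      go (b , e , _) with euclid {V} {bin (n ℕ.+ m) n} (subst (λ v → v ≈ 0ℤ [ P ]) (sym e) (congruent b (lemma P b)))
        where
        lemma : ∀ N b → N * b - 0ℤ ≡ b * N
        lemma = solve-∀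
      ... | inj₁ h = h
      ... | inj₂ h = contradiction (≈-trans (≈-sym bin-3m) h) (Unit-* s-unit C-unit)

    -- Since p divides `V`, the congruence C(3m, 2m) ≡ s C(2m, m) modulo p suffices; the sign s
    -- cancels at the end.
    VC≈P : V * Cₙ ≈ P [ P² ]
    VC≈P = cancel² s-unit (go V-bin-3m)
      where
      open ≈-Reasoning P²
      rotate : ∀ s v c → s * (v * c) ≡ v * (s * c)
      rotate = solve-∀
      go : ∃[ b ] V * bin (n ℕ.+ m) n ≡ P * b × b ≈ s [ P ] → s * (V * Cₙ) ≈ s * P [ P² ]
      go (b , e , b≈s) = begin
        s * (V * Cₙ)              ≡⟨ rotate s V Cₙ ⟩
        V * (s * Cₙ)              ≈⟨ ≈-scale V≈0 bin-3m ⟨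
        V * bin (n ℕ.+ m) n      ≡⟨ e ⟩
        P * b                    ≈⟨ ≈-scale (N≈0 {P}) b≈s ⟩
        P * s                    ≡⟨ *-comm P s ⟩
        s * P                    ∎

    C₆′≈C : C₆′ ≈ Cₙ [ P ]
    C₆′≈C = bin-+p n m m<p

    C₆-C₆′ : (1ℤ + + 5 * + m) * C₆′ ≡ (1ℤ + + 6 * + m) * C₆
    C₆-C₆′ = begin
      (1ℤ + + 5 * + m) * C₆′                          ≡⟨ cong (λ v → (1ℤ + + 5 * + m) * bin v m) (ℕ.+-suc n q) ⟩
      (1ℤ + + 5 * + m) * bin (suc (n ℕ.+ q)) m        ≡⟨ cong (λ v → v * bin (suc (n ℕ.+ q)) m) (trans (lemma (+ m)) (cong (λ v → 1ℤ + v - + m) 6m)) ⟩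
      (1ℤ + + (n ℕ.+ q) - + m) * bin (suc (n ℕ.+ q)) m ≡⟨ bin-suc-n (n ℕ.+ q) m ⟩
      (1ℤ + + (n ℕ.+ q)) * C₆                         ≡⟨ cong (λ v → (1ℤ + v) * C₆) 6m ⟨
      (1ℤ + + 6 * + m) * C₆                           ∎
      where
      open ≡-Reasoning
      lemma : ∀ m → 1ℤ + + 5 * m ≡ 1ℤ + + 6 * m - m
      lemma = solve-∀
      6m-ℕ : ∀ m → 6 ℕ.* m ≡ m ℕ.* 2 ℕ.+ 2 ℕ.* (m ℕ.* 2)
      6m-ℕ = ℕ.solve-∀
      6m : + 6 * + m ≡ + (n ℕ.+ q)
      6m = trans (sym (pos-* 6 m)) (cong +_ (6m-ℕ m))

    -- Modulo 4m + 1 the factors 5m + 1 and 6m + 1 are m and 2m, so `C₆-C₆′` gives C(6m + 1, m) ≡ 2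
    -- C(6m, m).
    Cₙ≈2C₆ : Cₙ ≈ + 2 * C₆ [ P ]
    Cₙ≈2C₆ = cancel (Unit-small 0<m m<p) (lin₂ (- + m) 1ℤ (C₆ - C₆′) C₆′≈C (reflexive C₆-C₆′)
      (trans (lemma (+ m) Cₙ C₆ C₆′) (cong (λ N → - + m * (C₆′ - Cₙ) +
        1ℤ * ((1ℤ + + 5 * + m) * C₆′ - (1ℤ + + 6 * + m) * C₆) + (C₆ - C₆′) * N) 4m+1≡P)))
      where
      lemma : ∀ m c c₆ c₆′ → m * c - m * (+ 2 * c₆) ≡ - m * (c₆′ - c) +
              1ℤ * ((1ℤ + + 5 * m) * c₆′ - (1ℤ + + 6 * m) * c₆) + (c₆ - c₆′) * (1ℤ + + 4 * m)
      lemma = solve-∀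

    -- The left side is a polynomial in P, Cₙ, C₆ once n = (P − 1) / 2 is eliminated;
    -- multiplying by 5 P − 1 = 4 (1 + 5 m) makes C₆′ expressible through C₆.
    2[1-P]U≈ : + 2 * ((1ℤ - P) * U) ≈ + 3 * Cₙ - C₆′ [ P² ]
    2[1-P]U≈ = cancel² {+ 5 * P - 1ℤ} unit (go (≈-isolate Cₙ≈2C₆))
      where
      unit : Unit (+ 5 * P - 1ℤ)
      unit h = Unit-1 (lin₁ -1ℤ (+ 5) h (lemma P))
        where
        lemma : ∀ P → 1ℤ - 0ℤ ≡ -1ℤ * (+ 5 * P - 1ℤ - 0ℤ) + + 5 * P
        lemma = solve-∀
      eliminate : ∀ P n c c₆ → 1ℤ + + 2 * n ≡ P →
                  + 2 * ((1ℤ - P) * ((1ℤ - n) * c + + 2 * n * c₆)) ≡ (1ℤ - P) * ((+ 3 - P) * c + + 2 * (P - 1ℤ) * c₆)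
      eliminate _ n c c₆ refl = lemma n c c₆
        where
        lemma : ∀ n c c₆ → + 2 * ((1ℤ - (1ℤ + + 2 * n)) * ((1ℤ - n) * c + + 2 * n * c₆)) ≡
                (1ℤ - (1ℤ + + 2 * n)) * ((+ 3 - (1ℤ + + 2 * n)) * c + + 2 * (1ℤ + + 2 * n - 1ℤ) * c₆)
        lemma = solve-∀
      scaled : ∀ P m c₆ c₆′ → 1ℤ + + 4 * m ≡ P → (1ℤ + + 5 * m) * c₆′ ≡ (1ℤ + + 6 * m) * c₆ →
               (+ 5 * P - 1ℤ) * c₆′ ≡ (+ 6 * P - + 2) * c₆
      scaled _ m c₆ c₆′ refl e = trans (lemma m c₆′) (trans (cong (_*_ (+ 4)) e) (lemma′ m c₆))
        where
        lemma : ∀ m c → (+ 5 * (1ℤ + + 4 * m) - 1ℤ) * c ≡ + 4 * ((1ℤ + + 5 * m) * c)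
        lemma = solve-∀
        lemma′ : ∀ m c → + 4 * ((1ℤ + + 6 * m) * c) ≡ (+ 6 * (1ℤ + + 4 * m) - + 2) * c
        lemma′ = solve-∀
      key : ∀ P c c₆ c₆′ k → c ≡ + 2 * c₆ + k * P →
            (+ 5 * P - 1ℤ) * ((1ℤ - P) * ((+ 3 - P) * c + + 2 * (P - 1ℤ) * c₆)) - (+ 5 * P - 1ℤ) * (+ 3 * c - c₆′) ≡
            1ℤ * ((+ 5 * P - 1ℤ) * c₆′ - (+ 6 * P - + 2) * c₆) + (k * (+ 5 * P * P - + 21 * P + + 4) - + 20 * c₆) * (P * P)
      key P _ c₆ c₆′ k refl = lemma P c₆ c₆′ k
        where
        lemma : ∀ P c₆ c₆′ k →
            (+ 5 * P - 1ℤ) * ((1ℤ - P) * ((+ 3 - P) * (+ 2 * c₆ + k * P) + + 2 * (P - 1ℤ) * c₆)) - (+ 5 * P - 1ℤ) * (+ 3 * (+ 2 * c₆ + k * P) - c₆′) ≡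
            1ℤ * ((+ 5 * P - 1ℤ) * c₆′ - (+ 6 * P - + 2) * c₆) + (k * (+ 5 * P * P - + 21 * P + + 4) - + 20 * c₆) * (P * P)
        lemma = solve-∀
      go : ∃[ k ] Cₙ ≡ + 2 * C₆ + k * P → (+ 5 * P - 1ℤ) * (+ 2 * ((1ℤ - P) * U)) ≈ (+ 5 * P - 1ℤ) * (+ 3 * Cₙ - C₆′) [ P² ]
      go (k , e) = subst (λ v → (+ 5 * P - 1ℤ) * v ≈ (+ 5 * P - 1ℤ) * (+ 3 * Cₙ - C₆′) [ P² ])
        (sym (eliminate P (+ n) Cₙ C₆ 2n+1≡P))
        (lin₁ 1ℤ (k * (+ 5 * P * P - + 21 * P + + 4) - + 20 * C₆)
          (reflexive (scaled P (+ m) C₆ C₆′ 4m+1≡P C₆-C₆′)) (key P Cₙ C₆ C₆′ k e))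

    -- From 2n ≡ -1, 2U ≡ 3 C(2m, m) - 2 C(6m, m).
    U≈C : U ≈ Cₙ [ P ]
    U≈C = cancel unit-2 (lin₁ 1ℤ (+ 2 * C₆ - Cₙ) Cₙ≈2C₆
      (trans (lemma (+ n) Cₙ C₆) (cong (λ N → 1ℤ * (Cₙ - + 2 * C₆) + (+ 2 * C₆ - Cₙ) * N) 2n+1≡P)))
      where
      lemma : ∀ n c c₆ → + 2 * ((1ℤ - n) * c + + 2 * n * c₆) - + 2 * c ≡
              1ℤ * (c - + 2 * c₆) + (+ 2 * c₆ - c) * (1ℤ + + 2 * n)
      lemma = solve-∀

    VU≈P : V * U ≈ P [ P² ]
    VU≈P = ≈-trans (≈-scale V≈0 U≈C) VC≈P

    -- (-1)^k times the double factorial (2k - 1)!!.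
    odds : ℕ → ℤ
    odds zero    = 1ℤ
    odds (suc k) = odds k * (-1ℤ - + 2 * + k)

    odds-central : ∀ k → (+ 2) ^ k * odds k ≡ (-1ℤ) ^ k * (+ (k !) * bin (2 ℕ.* k) k)
    odds-central zero    = sym (trans (*-identityˡ (1ℤ * bin 0 0)) (trans (*-identityˡ (bin 0 0)) (bin-n-0 0)))
    odds-central (suc k) = begin
      + 2 * (+ 2) ^ k * (odds k * (-1ℤ - + 2 * + k))                ≡⟨ lemma₁ ((+ 2) ^ k) (odds k) (+ k) ⟩
      (+ 2) ^ k * odds k * (-1ℤ * (+ 2 * (1ℤ + + 2 * + k)))         ≡⟨ cong (_* (-1ℤ * (+ 2 * (1ℤ + + 2 * + k)))) (odds-central k) ⟩
      (-1ℤ) ^ k * (+ (k !) * bin (2 ℕ.* k) k) * (-1ℤ * (+ 2 * (1ℤ + + 2 * + k)))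
        ≡⟨ lemma₂ ((-1ℤ) ^ k) (+ (k !)) (bin (2 ℕ.* k) k) (+ k) ⟩
      -1ℤ * (-1ℤ) ^ k * (+ (k !) * (+ 2 * (1ℤ + + 2 * + k) * bin (2 ℕ.* k) k))
        ≡⟨ cong (λ v → (-1ℤ) ^ suc k * (+ (k !) * v)) (central-suc k) ⟨
      (-1ℤ) ^ suc k * (+ (k !) * ((1ℤ + + k) * bin (2 ℕ.* suc k) (suc k)))
        ≡⟨ lemma₃ ((-1ℤ) ^ suc k) (+ (k !)) (1ℤ + + k) (bin (2 ℕ.* suc k) (suc k)) ⟩
      (-1ℤ) ^ suc k * ((1ℤ + + k) * + (k !) * bin (2 ℕ.* suc k) (suc k))
        ≡⟨ cong (λ v → (-1ℤ) ^ suc k * (v * bin (2 ℕ.* suc k) (suc k))) (pos-* (suc k) (k !)) ⟨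
      (-1ℤ) ^ suc k * (+ (suc k !) * bin (2 ℕ.* suc k) (suc k))     ∎
      where
      open ≡-Reasoning
      lemma₁ : ∀ t o k → + 2 * t * (o * (-1ℤ - + 2 * k)) ≡ t * o * (-1ℤ * (+ 2 * (1ℤ + + 2 * k)))
      lemma₁ = solve-∀
      lemma₂ : ∀ s f b k → s * (f * b) * (-1ℤ * (+ 2 * (1ℤ + + 2 * k))) ≡ -1ℤ * s * (f * (+ 2 * (1ℤ + + 2 * k) * b))
      lemma₂ = solve-∀
      lemma₃ : ∀ s f a b → s * (f * (a * b)) ≡ s * (a * f * b)
      lemma₃ = solve-∀

    -- ∏ (− 1 − 2i) = ∏ (2(n − i) − P), and to first order in P the factors P + n − i and 2(n − i) − P
    -- are perturbations of n − i and 2(n − i) in opposite directions.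
    odds≈falling : ∀ k → (+ 2) ^ k * falling (+ n + P) k ≈ odds k [ P ]
    odds≈falling zero    = ≈-refl
    odds≈falling (suc k) = lin₁ (-1ℤ - + 2 * + k) (((+ 2) ^ k * falling (+ n + P) k) * + 3) (odds≈falling k)
      (subst (λ N → + 2 * (+ 2) ^ k * (falling (+ n + P) k * (+ n + N - + k)) - odds k * (-1ℤ - + 2 * + k) ≡
        (-1ℤ - + 2 * + k) * ((+ 2) ^ k * falling (+ n + P) k - odds k) + ((+ 2) ^ k * falling (+ n + P) k) * + 3 * N)
        2n+1≡P (lemma ((+ 2) ^ k) (falling (+ n + P) k) (odds k) (+ n) (+ k)))
      where
      lemma : ∀ t f o n k → + 2 * t * (f * (n + (1ℤ + + 2 * n) - k)) - o * (-1ℤ - + 2 * k) ≡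
              (-1ℤ - + 2 * k) * (t * f - o) + t * f * + 3 * (1ℤ + + 2 * n)
      lemma = solve-∀

    -- Against 2(n - i), a factor of `odds` is off by -P and the doubled factor 2(n + P - i) by 2P.
    -- The weights 2 and 1 cancel the first-order terms.
    first-order-balance : ∀ k → + 2 * odds k + (+ 2) ^ k * falling (+ n + P) k ≈ + 3 * ((+ 2) ^ k * falling (+ n) k) [ P² ]
    first-order-balance zero    = ≈-refl
    first-order-balance (suc k) = lin₂ (+ 2 * (+ n - + k)) (+ 2) 0ℤ (first-order-balance k)
      (≈-scale (N≈0 {P}) (odds≈falling k))
      (subst (λ N → + 2 * (odds k * (-1ℤ - + 2 * + k)) + + 2 * (+ 2) ^ k * (falling (+ n + P) k * (+ n + N - + k)) -
          + 3 * (+ 2 * (+ 2) ^ k * (falling (+ n) k * (+ n - + k))) ≡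
          + 2 * (+ n - + k) * (+ 2 * odds k + (+ 2) ^ k * falling (+ n + P) k - + 3 * ((+ 2) ^ k * falling (+ n) k)) +
          + 2 * (N * ((+ 2) ^ k * falling (+ n + P) k) - N * odds k) + 0ℤ * P²)
        2n+1≡P (lemma ((+ 2) ^ k) (falling (+ n + P) k) (falling (+ n) k) (odds k) (+ n) (+ k) P²))
      where
      lemma : ∀ t f g o n k N → + 2 * (o * (-1ℤ - + 2 * k)) + + 2 * t * (f * (n + (1ℤ + + 2 * n) - k)) -
              + 3 * (+ 2 * t * (g * (n - k))) ≡
              + 2 * (n - k) * (+ 2 * o + t * f - + 3 * (t * g)) +
              + 2 * ((1ℤ + + 2 * n) * (t * f) - (1ℤ + + 2 * n) * o) + 0ℤ * N
      lemma = solve-∀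

    -- The case k = m of `first-order-balance`, times 2^m: after `odds-central` and `falling-bin`
    -- each product is m! times a binomial, and m! is a unit.
    2sC≈ : + 2 * (s * Cₙ) ≈ (+ 4) ^ m * (+ 3 * Cₙ - C₆′) [ P² ]
    2sC≈ = cancel² {+ (m !)} (Unit-! m m<p) (lin₁ t 0ℤ (first-order-balance m) (begin
      + (m !) * (+ 2 * (s * Cₙ)) - + (m !) * ((+ 4) ^ m * (+ 3 * Cₙ - C₆′))
        ≡⟨ cong (λ v → + (m !) * (+ 2 * (s * Cₙ)) - + (m !) * (v * (+ 3 * Cₙ - C₆′))) (*-^ (+ 2) (+ 2) m) ⟩
      + (m !) * (+ 2 * (s * Cₙ)) - + (m !) * (t * t * (+ 3 * Cₙ - C₆′))
        ≡⟨ lemma (+ (m !)) s Cₙ C₆′ t P² ⟩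
      + 2 * (s * (+ (m !) * Cₙ)) + t * (t * (+ (m !) * C₆′)) - + 3 * (t * (t * (+ (m !) * Cₙ))) + 0ℤ * P²
        ≡⟨ cong (λ v → + 2 * v + t * (t * (+ (m !) * C₆′)) - + 3 * (t * (t * (+ (m !) * Cₙ))) + 0ℤ * P²) odds-m ⟨
      + 2 * (t * odds m) + t * (t * (+ (m !) * C₆′)) - + 3 * (t * (t * (+ (m !) * Cₙ))) + 0ℤ * P²
        ≡⟨ cong₂ (λ u v → + 2 * (t * odds m) + t * (t * u) - + 3 * (t * (t * v)) + 0ℤ * P²) (falling-bin (n ℕ.+ p) m) (falling-bin n m) ⟨
      + 2 * (t * odds m) + t * (t * falling (+ n + P) m) - + 3 * (t * (t * falling (+ n) m)) + 0ℤ * P²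
        ≡⟨ lemma′ t (odds m) (falling (+ n + P) m) (falling (+ n) m) P² ⟩
      t * (+ 2 * odds m + t * falling (+ n + P) m - + 3 * (t * falling (+ n) m)) + 0ℤ * P² ∎))
      where
      open ≡-Reasoning
      t : ℤ
      t = (+ 2) ^ m
      odds-m : t * odds m ≡ s * (+ (m !) * Cₙ)
      odds-m = trans (odds-central m) (cong (λ v → s * (+ (m !) * bin v m)) (ℕ.*-comm 2 m))
      lemma : ∀ f s c c′ t N → f * (+ 2 * (s * c)) - f * (t * t * (+ 3 * c - c′)) ≡
              + 2 * (s * (f * c)) + t * (t * (f * c′)) - + 3 * (t * (t * (f * c))) + 0ℤ * N
      lemma = solve-∀
      lemma′ : ∀ t o f g N → + 2 * (t * o) + t * (t * f) - + 3 * (t * (t * g)) + 0ℤ * N ≡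
               t * (+ 2 * o + t * f - + 3 * (t * g)) + 0ℤ * N
      lemma′ = solve-∀

    sC≈4^m[1-P]U : s * Cₙ ≈ (+ 4) ^ m * ((1ℤ - P) * U) [ P² ]
    sC≈4^m[1-P]U = cancel² unit-2 (begin
      + 2 * (s * Cₙ)                            ≈⟨ 2sC≈ ⟩
      (+ 4) ^ m * (+ 3 * Cₙ - C₆′)              ≈⟨ *-congˡ ((+ 4) ^ m) 2[1-P]U≈ ⟨
      (+ 4) ^ m * (+ 2 * ((1ℤ - P) * U))       ≡⟨ lemma ((+ 4) ^ m) ((1ℤ - P) * U) ⟩
      + 2 * ((+ 4) ^ m * ((1ℤ - P) * U))       ∎)
      where
      open ≈-Reasoning P²
      lemma : ∀ t u → t * (+ 2 * u) ≡ + 2 * (t * u)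
      lemma = solve-∀

    -- Modulo p, `C₆′` is C(2m, m), so `2sC≈` has the unit 2 C(2m, m) on both sides. As 4^m = 2^n,
    -- this evaluates χ(2).
    4^m≈s : (+ 4) ^ m ≈ s [ P ]
    4^m≈s = cancel (Unit-* unit-2 C-unit) (lin₂ -1ℤ ((+ 4) ^ m) 0ℤ (≈-weaken {P} 2sC≈) C₆′≈C (lemma ((+ 4) ^ m) s Cₙ C₆′ P))
      where
      lemma : ∀ t s c c′ N → + 2 * c * t - + 2 * c * s ≡ -1ℤ * (+ 2 * (s * c) - t * (+ 3 * c - c′)) + t * (c′ - c) + 0ℤ * N
      lemma = solve-∀

  -- Jacobsthal sums modulo p²

  module Jacobsthal (m : ℕ) (p-prime : Prime (suc (2 ℕ.* (m ℕ.* 2)))) where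

    open QuarterBinomials m p-prime
    open Modular q p-prime
    open PowerSums q p-prime
    open Character n p-prime

    -- Binomial expansion of (W + (W^p − W))^N, in which P divides W^p − W
    frobenius-power : ∀ W N → (W ^ p) ^ suc N ≈ (1ℤ - + suc N) * W ^ suc N + + suc N * W ^ (suc N ℕ.+ q) [ P² ]
    frobenius-power W N = go (≈-isolate (fermat W))
      where
      go : ∃[ k ] W ^ p ≡ W + k * P → (W ^ p) ^ suc N ≈ (1ℤ - + suc N) * W ^ suc N + + suc N * W ^ (suc N ℕ.+ q) [ P² ]
      go (k , e) = begin
        (W ^ p) ^ suc N                                          ≡⟨ cong (_^ suc N) e ⟩
        (W + k * P) ^ suc N                                      ≈⟨ ≈-weaken {k * k} (subst (λ M → (W + k * P) ^ suc N ≈ W ^ suc N + + suc N * (W ^ N * (k * P)) [ M ])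
                                                                      (square k P) (^-+-first-order N W (k * P))) ⟩
        W ^ suc N + + suc N * (W ^ N * (k * P))                  ≡⟨ cong (λ v → W ^ suc N + + suc N * (W ^ N * v)) (trans (lemma W (k * P)) (cong (_- W) (sym e))) ⟩
        W ^ suc N + + suc N * (W ^ N * (W ^ p - W))              ≡⟨ lemma′ W (W ^ N) (W ^ p) (+ suc N) ⟩
        (1ℤ - + suc N) * W ^ suc N + + suc N * (W ^ N * W ^ p)   ≡⟨ cong (λ v → (1ℤ - + suc N) * W ^ suc N + + suc N * v)
                                                                      (trans (sym (^-distribˡ-+-* W N p)) (cong (W ^_) (ℕ.+-suc N q))) ⟩
        (1ℤ - + suc N) * W ^ suc N + + suc N * W ^ (suc N ℕ.+ q) ∎
        where
        open ≈-Reasoning P²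
        square : ∀ k N → k * N * (k * N) ≡ k * k * (N * N)
        square = solve-∀
        lemma : ∀ w v → v ≡ w + v - w
        lemma = solve-∀
        lemma′ : ∀ w u v n → w * u + n * (u * (v - w)) ≡ (1ℤ - n) * (w * u) + n * (u * v)
        lemma′ = solve-∀

    term : ℤ → ℕ → ℤ
    term z x = χ (+ x) * χ ((+ x) ^ 2 + z)

    T H : ℤ → ℤ
    T z = ∑ p (term z)
    H z = ∑ n (λ x → term z (suc x))

    χ-minus-one : χ -1ℤ ≡ 1ℤ
    χ-minus-one = χ-unique plus (reflexive (trans (cong (-1ℤ ^_) (ℕ.*-comm m 2)) (-1^2k m)))

    χ-even : ∀ {x y} → x ≈ - y [ P ] → χ x ≡ χ y
    χ-even {x} {y} h = trans (χ-resp (≈-trans h (reflexive (lemma y))))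
      (trans (χ-* -1ℤ y) (trans (cong (_* χ y) χ-minus-one) (*-identityˡ (χ y))))
      where
      lemma : ∀ y → - y ≡ -1ℤ * y
      lemma = solve-∀

    T≡2H : ∀ z → T z ≡ + 2 * H z
    T≡2H z = ∑-even (λ v → χ v * χ (v ^ 2 + z))
      (trans (cong (_* χ (0ℤ ^ 2 + z)) (χ-zero ≈-refl)) (*-zeroˡ (χ (0ℤ ^ 2 + z))))
      (λ {x} {y} h → cong₂ _*_ (χ-even h) (χ-resp (+-cong (≈-trans (^-cong 2 h) (reflexive (lemma y))) ≈-refl)))
      where
      lemma : ∀ y → - y * (- y * 1ℤ) ≡ y * (y * 1ℤ)
      lemma = solve-∀

    -- Every x enters through x^p, so that expansion leads to the sums `τ`.
    moment : ℤ → ℕ → ℤ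
    moment Z N = ∑ p (λ x → ((+ x) ^ p) ^ n * (Z + ((+ x) ^ p) ^ 2) ^ N)

    -- χ(x² + z) sees x² + z through its p-th power, so modulo p² it may be replaced by W = z^p +
    -- (x^p)², congruent to it modulo p. Then `frobenius-power` lowers the exponent.
    T≈moments : ∀ z → T z ≈ (1ℤ - + n) * moment (z ^ p) n + + n * moment (z ^ p) (n ℕ.+ q) [ P² ]
    T≈moments z = begin
      T z
        ≈⟨ ∑-cong p (λ {x} _ → pointwise x) ⟩
      ∑ p (λ x → (1ℤ - + n) * f x + + n * g x)
        ≡⟨ ∑-+ p (λ x → (1ℤ - + n) * f x) (λ x → + n * g x) ⟩
      ∑ p (λ x → (1ℤ - + n) * f x) + ∑ p (λ x → + n * g x)
        ≡⟨ cong₂ _+_ (∑-*ˡ p (1ℤ - + n) f) (∑-*ˡ p (+ n) g) ⟩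
      (1ℤ - + n) * moment (z ^ p) n + + n * moment (z ^ p) (n ℕ.+ q) ∎
      where
      open ≈-Reasoning P²
      W : ℕ → ℤ
      W x = z ^ p + ((+ x) ^ p) ^ 2
      f g : ℕ → ℤ
      f x = ((+ x) ^ p) ^ n * W x ^ n
      g x = ((+ x) ^ p) ^ n * W x ^ (n ℕ.+ q)
      frobenius : ∀ N → 0 < N → ∀ w → (w ^ p) ^ N ≈ (1ℤ - + N) * w ^ N + + N * w ^ (N ℕ.+ q) [ P² ]
      frobenius (suc N) _ w = frobenius-power w N
      distribute : ∀ a c d n → a * ((1ℤ - n) * c + n * d) ≡ (1ℤ - n) * (a * c) + n * (a * d)
      distribute = solve-∀
      pointwise : ∀ x → term z x ≈ (1ℤ - + n) * f x + + n * g x [ P² ]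
      pointwise x = begin
        χ (+ x) * χ ((+ x) ^ 2 + z)                  ≈⟨ *-cong (χ-lift (+ x)) (χ-lift ((+ x) ^ 2 + z)) ⟩
        ((+ x) ^ p) ^ n * (((+ x) ^ 2 + z) ^ p) ^ n  ≈⟨ *-congˡ (((+ x) ^ p) ^ n) (^-cong n (lift argument)) ⟩
        ((+ x) ^ p) ^ n * (W x ^ p) ^ n              ≈⟨ *-congˡ (((+ x) ^ p) ^ n) (frobenius n 0<n (W x)) ⟩
        ((+ x) ^ p) ^ n * ((1ℤ - + n) * W x ^ n + + n * W x ^ (n ℕ.+ q))
          ≡⟨ distribute (((+ x) ^ p) ^ n) (W x ^ n) (W x ^ (n ℕ.+ q)) (+ n) ⟩
        (1ℤ - + n) * f x + + n * g x                 ∎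
        where
        argument : (+ x) ^ 2 + z ≈ W x [ P ]
        argument = ≈-trans (reflexive (+-comm ((+ x) ^ 2) z)) (+-cong (≈-sym (fermat z)) (^-cong 2 (≈-sym (fermat (+ x)))))

    moment-term : ℤ → ℕ → ℕ → ℤ
    moment-term Z N t = bin N t * (Z ^ (N ∸ t) * τ (n ℕ.+ 2 ℕ.* t))

    moment≡∑ : ∀ Z N → moment Z N ≡ ∑ (suc N) (moment-term Z N)
    moment≡∑ Z N = begin
      ∑ p (λ x → X x ^ n * (Z + X x ^ 2) ^ N)
        ≡⟨ ∑-cong-≡ p (λ {x} _ → expand (X x)) ⟩
      ∑ p (λ x → B N (λ s t → Z ^ s * X x ^ (n ℕ.+ 2 ℕ.* t)))
        ≡⟨ B-∑ N p (λ x s t → Z ^ s * X x ^ (n ℕ.+ 2 ℕ.* t)) ⟩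
      B N (λ s t → ∑ p (λ x → Z ^ s * X x ^ (n ℕ.+ 2 ℕ.* t)))
        ≡⟨ B-cong-≡ N (λ s t → ∑-*ˡ p (Z ^ s) (λ x → X x ^ (n ℕ.+ 2 ℕ.* t))) ⟩
      B N (λ s t → Z ^ s * τ (n ℕ.+ 2 ℕ.* t))
        ≡⟨ B≡∑ N (λ s t → Z ^ s * τ (n ℕ.+ 2 ℕ.* t)) ⟩
      ∑ (suc N) (moment-term Z N) ∎
      where
      open ≡-Reasoning
      X : ℕ → ℤ
      X x = (+ x) ^ p
      expand : ∀ x → x ^ n * (Z + x ^ 2) ^ N ≡ B N (λ s t → Z ^ s * x ^ (n ℕ.+ 2 ℕ.* t))
      expand x = begin
        x ^ n * (Z + x ^ 2) ^ N                                ≡⟨ cong (_*_ (x ^ n)) (binomial N Z (x ^ 2)) ⟩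
        x ^ n * B N h                                          ≡⟨ lemma (x ^ n) (B N h) ⟩
        x ^ n * B N h + 0ℤ * B N h                             ≡⟨ B-linear N (x ^ n) 0ℤ h h ⟨
        B N (λ s t → x ^ n * h s t + 0ℤ * h s t)               ≡⟨ B-cong-≡ N (λ s t → trans (lemma′ (x ^ n) (Z ^ s) ((x ^ 2) ^ t))
                                                                     (cong (_*_ (Z ^ s)) (trans (cong (_*_ (x ^ n)) (^-*-assoc x 2 t)) (sym (^-distribˡ-+-* x n (2 ℕ.* t)))))) ⟩
        B N (λ s t → Z ^ s * x ^ (n ℕ.+ 2 ℕ.* t))              ∎
        where
        h : ℕ → ℕ → ℤ
        h s t = Z ^ s * (x ^ 2) ^ t
        lemma : ∀ a b → a * b ≡ a * b + 0ℤ * b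
        lemma = solve-∀
        lemma′ : ∀ a z y → a * (z * y) + 0ℤ * (z * y) ≡ z * (a * y)
        lemma′ = solve-∀

    exponent-m : n ℕ.+ 2 ℕ.* m ≡ 1 ℕ.* q
    exponent-m = lemma m
      where
      lemma : ∀ m → m ℕ.* 2 ℕ.+ 2 ℕ.* m ≡ 1 ℕ.* (2 ℕ.* (m ℕ.* 2))
      lemma = ℕ.solve-∀

    exponent-3m : n ℕ.+ 2 ℕ.* (n ℕ.+ m) ≡ 2 ℕ.* q
    exponent-3m = lemma m
      where
      lemma : ∀ m → m ℕ.* 2 ℕ.+ 2 ℕ.* (m ℕ.* 2 ℕ.+ m) ≡ 2 ℕ.* (2 ℕ.* (m ℕ.* 2))
      lemma = ℕ.solve-∀

    exponent-5m : n ℕ.+ 2 ℕ.* (q ℕ.+ m) ≡ 3 ℕ.* q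
    exponent-5m = lemma m
      where
      lemma : ∀ m → m ℕ.* 2 ℕ.+ 2 ℕ.* (2 ℕ.* (m ℕ.* 2) ℕ.+ m) ≡ 3 ℕ.* (2 ℕ.* (m ℕ.* 2))
      lemma = ℕ.solve-∀

    -- n + 2t = kq means t = (2k − 1)m.
    support : ∀ t → t ≤ n ℕ.+ q → q ℕ.∣ n ℕ.+ 2 ℕ.* t → t ≡ m ⊎ t ≡ n ℕ.+ m ⊎ t ≡ q ℕ.+ m
    support t t≤6m (ℕ.divides k e) = by-cases k e
      where
      solve-t : ∀ {k t₀} → n ℕ.+ 2 ℕ.* t ≡ k ℕ.* q → n ℕ.+ 2 ℕ.* t₀ ≡ k ℕ.* q → t ≡ t₀
      solve-t e e₀ = ℕ.*-cancelˡ-≡ _ _ 2 (ℕ.+-cancelˡ-≡ n _ _ (trans e (sym e₀)))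
      by-cases : ∀ k → n ℕ.+ 2 ℕ.* t ≡ k ℕ.* q → t ≡ m ⊎ t ≡ n ℕ.+ m ⊎ t ≡ q ℕ.+ m
      by-cases 0 e = contradiction (ℕ.m+n≡0⇒m≡0 n e) (ℕ.<⇒≢ 0<n ∘ sym)
      by-cases 1 e = inj₁ (solve-t {1} e exponent-m)
      by-cases 2 e = inj₂ (inj₁ (solve-t {2} e exponent-3m))
      by-cases 3 e = inj₂ (inj₂ (solve-t {3} e exponent-5m))
      by-cases (suc (suc (suc (suc k)))) e = contradiction
        (ℕ.≤-trans (ℕ.m≤m+n (4 ℕ.* q) (k ℕ.* q)) (ℕ.≤-reflexive (trans (sym (ℕ.*-distribʳ-+ q 4 k)) (sym e))))
        (ℕ.<⇒≱ (ℕ.≤-<-trans (ℕ.+-monoʳ-≤ n (ℕ.*-monoʳ-≤ 2 t≤6m)) (subst (n ℕ.+ 2 ℕ.* (n ℕ.+ q) <_) (lemma m) (ℕ.m<m+n _ 0<n))))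
        where
        lemma : ∀ m → m ℕ.* 2 ℕ.+ 2 ℕ.* (m ℕ.* 2 ℕ.+ 2 ℕ.* (m ℕ.* 2)) ℕ.+ m ℕ.* 2 ≡ 4 ℕ.* (2 ℕ.* (m ℕ.* 2))
        lemma = ℕ.solve-∀

    moment-term≈ : ∀ Z N t k → n ℕ.+ 2 ℕ.* t ≡ suc k ℕ.* q → moment-term Z N t ≈ + q * (bin N t * Z ^ (N ∸ t)) [ P² ]
    moment-term≈ Z N t k e = ≈-trans
      (*-congˡ (bin N t) (*-congˡ (Z ^ (N ∸ t)) (subst (λ v → τ v ≈ + q [ P² ]) (sym e) (τ-multiple k))))
      (reflexive (lemma (bin N t) (Z ^ (N ∸ t)) (+ q)))
      where
      lemma : ∀ b z q → b * (z * q) ≡ q * (b * z)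
      lemma = solve-∀

    moment-term≈0 : ∀ Z N t → ¬ q ℕ.∣ n ℕ.+ 2 ℕ.* t → moment-term Z N t ≈ 0ℤ [ P² ]
    moment-term≈0 Z N t h = ≈-trans
      (*-congˡ (bin N t) (*-congˡ (Z ^ (N ∸ t)) (τ-nonmultiple (n ℕ.+ 2 ℕ.* t) h)))
      (reflexive (lemma (bin N t) (Z ^ (N ∸ t))))
      where
      lemma : ∀ b z → b * (z * 0ℤ) ≡ 0ℤ
      lemma = solve-∀

    -- Of the indices m, 3m and 5m only m is at most n = 2m.
    moment-n : ∀ Z → moment Z n ≈ + q * (Cₙ * Z ^ m) [ P² ]
    moment-n Z = begin
      moment Z n                                      ≡⟨ trans (moment≡∑ Z n) (∑-erase (suc n) f (s≤s m≤n)) ⟩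
      f m + ∑ (suc n) (erase m f)                     ≈⟨ +-cong (moment-term≈ Z n m 0 exponent-m) (∑-zero (suc n) (λ {t} t≤n → rest t (ℕ.s≤s⁻¹ t≤n))) ⟩
      + q * (Cₙ * Z ^ (n ∸ m)) + 0ℤ                   ≡⟨ +-identityʳ (+ q * (Cₙ * Z ^ (n ∸ m))) ⟩
      + q * (Cₙ * Z ^ (n ∸ m))                        ≡⟨ cong (λ k → + q * (Cₙ * Z ^ k)) n∸m≡m ⟩
      + q * (Cₙ * Z ^ m)                              ∎
      where
      open ≈-Reasoning P²
      f : ℕ → ℤ
      f = moment-term Z n
      n∸m≡m : n ∸ m ≡ m
      n∸m≡m = trans (cong (_∸ m) (lemma m)) (ℕ.m+n∸m≡n m m)
        where
        lemma : ∀ m → m ℕ.* 2 ≡ m ℕ.+ m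
        lemma = ℕ.solve-∀
      rest : ∀ t → t ≤ n → erase m f t ≈ 0ℤ [ P² ]
      rest t t≤n with t ℕ.≟ m
      ... | yes _  = ≈-refl
      ... | no t≢m = moment-term≈0 Z n t (λ q∣ → absurd (support t (ℕ.≤-trans t≤n (ℕ.m≤m+n n q)) q∣))
        where
        absurd : ¬ (t ≡ m ⊎ t ≡ n ℕ.+ m ⊎ t ≡ q ℕ.+ m)
        absurd (inj₁ e)        = t≢m e
        absurd (inj₂ (inj₁ e)) = ℕ.<⇒≱ (ℕ.m<m+n n 0<m) (subst (_≤ n) e t≤n)
        absurd (inj₂ (inj₂ e)) = ℕ.<⇒≱ (ℕ.<-≤-trans n<2n (ℕ.m≤m+n q m)) (subst (_≤ n) e t≤n)

    -- C(6m, 5m) = C(6m, m) and Z^(5m) ≡ Z^m, so t = m and t = 5m contribute equally; t = 3m gives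
    -- the remaining term.
    moment-6m : ∀ Z → Z ^ q ≈ 1ℤ [ P² ] →
                moment Z (n ℕ.+ q) ≈ + q * (+ 2 * C₆ * Z ^ m + bin (n ℕ.+ q) (n ℕ.+ m) * (Z ^ n * Z ^ m)) [ P² ]
    moment-6m Z Z^q≈1 = begin
      moment Z N                                       ≡⟨ moment≡∑ Z N ⟩
      ∑ (suc N) f                                      ≡⟨ ∑-erase (suc N) f (s≤s m≤N) ⟩
      f m + ∑ (suc N) f₁                               ≡⟨ cong (_+_ (f m)) (∑-erase (suc N) f₁ (s≤s 3m≤N)) ⟩
      f m + (f₁ (n ℕ.+ m) + ∑ (suc N) f₂)              ≡⟨ cong (λ v → f m + (f₁ (n ℕ.+ m) + v)) (∑-erase (suc N) f₂ (s≤s 5m≤N)) ⟩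
      f m + (f₁ (n ℕ.+ m) + (f₂ (q ℕ.+ m) + ∑ (suc N) f₃))
        ≈⟨ +-cong value-m (+-cong value-3m (+-cong value-5m (∑-zero (suc N) (λ {t} t≤N → rest t (ℕ.s≤s⁻¹ t≤N))))) ⟩
      + q * (C₆ * Z ^ m) + (+ q * (bin N (n ℕ.+ m) * (Z ^ n * Z ^ m)) + (+ q * (C₆ * Z ^ m) + 0ℤ))
        ≡⟨ lemma (+ q) C₆ (Z ^ m) (bin N (n ℕ.+ m)) (Z ^ n * Z ^ m) ⟩
      + q * (+ 2 * C₆ * Z ^ m + bin N (n ℕ.+ m) * (Z ^ n * Z ^ m)) ∎
      where
      open ≈-Reasoning P²
      N = n ℕ.+ q
      f f₁ f₂ f₃ : ℕ → ℤ
      f  = moment-term Z N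
      f₁ = erase m f
      f₂ = erase (n ℕ.+ m) f₁
      f₃ = erase (q ℕ.+ m) f₂
      lemma : ∀ q c z b w → q * (c * z) + (q * (b * w) + (q * (c * z) + 0ℤ)) ≡ q * (+ 2 * c * z + b * w)
      lemma = solve-∀
      m+5m : m ℕ.+ (q ℕ.+ m) ≡ N
      m+5m = lemma′ m
        where
        lemma′ : ∀ m → m ℕ.+ (2 ℕ.* (m ℕ.* 2) ℕ.+ m) ≡ m ℕ.* 2 ℕ.+ 2 ℕ.* (m ℕ.* 2)
        lemma′ = ℕ.solve-∀
      3m+3m : (n ℕ.+ m) ℕ.+ (n ℕ.+ m) ≡ N
      3m+3m = lemma′ m
        where
        lemma′ : ∀ m → (m ℕ.* 2 ℕ.+ m) ℕ.+ (m ℕ.* 2 ℕ.+ m) ≡ m ℕ.* 2 ℕ.+ 2 ℕ.* (m ℕ.* 2)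
        lemma′ = ℕ.solve-∀
      m≤N  = subst (m ≤_) m+5m (ℕ.m≤m+n m (q ℕ.+ m))
      3m≤N = subst (n ℕ.+ m ≤_) 3m+3m (ℕ.m≤m+n (n ℕ.+ m) (n ℕ.+ m))
      5m≤N = subst (q ℕ.+ m ≤_) m+5m (ℕ.m≤n+m (q ℕ.+ m) m)
      monus : ∀ a b → a ℕ.+ b ≡ N → N ∸ a ≡ b
      monus a b e = trans (cong (_∸ a) (sym e)) (ℕ.m+n∸m≡n a b)
      value-m : f m ≈ + q * (C₆ * Z ^ m) [ P² ]
      value-m = begin
        f m                                 ≈⟨ moment-term≈ Z N m 0 exponent-m ⟩
        + q * (C₆ * Z ^ (N ∸ m))            ≡⟨ cong (λ k → + q * (C₆ * k)) (trans (cong (Z ^_) (monus m (q ℕ.+ m) m+5m)) (^-distribˡ-+-* Z q m)) ⟩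
        + q * (C₆ * (Z ^ q * Z ^ m))        ≈⟨ *-congˡ (+ q) (*-congˡ C₆ (*-congʳ (Z ^ m) Z^q≈1)) ⟩
        + q * (C₆ * (1ℤ * Z ^ m))           ≡⟨ cong (λ k → + q * (C₆ * k)) (*-identityˡ (Z ^ m)) ⟩
        + q * (C₆ * Z ^ m)                  ∎
      3m≢m : n ℕ.+ m ≢ m
      3m≢m = ℕ.<⇒≢ (ℕ.m<n+m m 0<n) ∘ sym
      5m≢m : q ℕ.+ m ≢ m
      5m≢m = ℕ.<⇒≢ (ℕ.m<n+m m 0<q) ∘ sym
      5m≢3m : q ℕ.+ m ≢ n ℕ.+ m
      5m≢3m = ℕ.<⇒≢ (ℕ.+-monoˡ-< m n<2n) ∘ sym
      value-3m : f₁ (n ℕ.+ m) ≈ + q * (bin N (n ℕ.+ m) * (Z ^ n * Z ^ m)) [ P² ]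
      value-3m = begin
        f₁ (n ℕ.+ m)                                      ≡⟨ erase-≢ m f 3m≢m ⟩
        f (n ℕ.+ m)                                       ≈⟨ moment-term≈ Z N (n ℕ.+ m) 1 exponent-3m ⟩
        + q * (bin N (n ℕ.+ m) * Z ^ (N ∸ (n ℕ.+ m)))     ≡⟨ cong (λ k → + q * (bin N (n ℕ.+ m) * k)) (trans (cong (Z ^_) (monus (n ℕ.+ m) (n ℕ.+ m) 3m+3m)) (^-distribˡ-+-* Z n m)) ⟩
        + q * (bin N (n ℕ.+ m) * (Z ^ n * Z ^ m))         ∎
      value-5m : f₂ (q ℕ.+ m) ≈ + q * (C₆ * Z ^ m) [ P² ]
      value-5m = begin
        f₂ (q ℕ.+ m)                                      ≡⟨ trans (erase-≢ (n ℕ.+ m) f₁ 5m≢3m) (erase-≢ m f 5m≢m) ⟩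
        f (q ℕ.+ m)                                       ≈⟨ moment-term≈ Z N (q ℕ.+ m) 2 exponent-5m ⟩
        + q * (bin N (q ℕ.+ m) * Z ^ (N ∸ (q ℕ.+ m)))     ≡⟨ cong₂ (λ b k → + q * (b * Z ^ k)) bin-5m (monus (q ℕ.+ m) m (trans (ℕ.+-comm (q ℕ.+ m) m) m+5m)) ⟩
        + q * (C₆ * Z ^ m)                                ∎
        where
        bin-5m : bin N (q ℕ.+ m) ≡ C₆
        bin-5m = subst (λ v → bin v (q ℕ.+ m) ≡ bin v m) m+5m (sym (bin-sym m (q ℕ.+ m)))
      rest : ∀ t → t ≤ N → f₃ t ≈ 0ℤ [ P² ]
      rest t t≤N = by-cases (t ℕ.≟ m) (t ℕ.≟ n ℕ.+ m) (t ℕ.≟ q ℕ.+ m)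
        where
        by-cases : Dec (t ≡ m) → Dec (t ≡ n ℕ.+ m) → Dec (t ≡ q ℕ.+ m) → f₃ t ≈ 0ℤ [ P² ]
        by-cases _ _ (yes refl) = reflexive (erase-≡ (q ℕ.+ m) f₂)
        by-cases _ (yes refl) (no ≢5m) = reflexive (trans (erase-≢ (q ℕ.+ m) f₂ ≢5m) (erase-≡ (n ℕ.+ m) f₁))
        by-cases (yes refl) (no ≢3m) (no ≢5m) = reflexive (trans (erase-≢ (q ℕ.+ m) f₂ ≢5m) (trans (erase-≢ (n ℕ.+ m) f₁ ≢3m) (erase-≡ m f)))
        by-cases (no ≢m) (no ≢3m) (no ≢5m) = ≈-trans
          (reflexive (trans (erase-≢ (q ℕ.+ m) f₂ ≢5m) (trans (erase-≢ (n ℕ.+ m) f₁ ≢3m) (erase-≢ m f ≢m))))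
          (moment-term≈0 Z N t (λ q∣ → absurd (support t t≤N q∣)))
          where
          absurd : ¬ (t ≡ m ⊎ t ≡ n ℕ.+ m ⊎ t ≡ q ℕ.+ m)
          absurd (inj₁ e)        = ≢m e
          absurd (inj₂ (inj₁ e)) = ≢3m e
          absurd (inj₂ (inj₂ e)) = ≢5m e

    T≈ : ∀ {z} → Unit z → T z ≈ + q * (U * (z ^ p) ^ m + V * ((z ^ p) ^ n * (z ^ p) ^ m)) [ P² ]
    T≈ {z} uz = begin
      T z                                                          ≈⟨ T≈moments z ⟩
      (1ℤ - + n) * moment Z n + + n * moment Z (n ℕ.+ q)           ≈⟨ +-cong (*-congˡ (1ℤ - + n) (moment-n Z)) (*-congˡ (+ n) (moment-6m Z (lift-unit uz))) ⟩
      (1ℤ - + n) * (+ q * (Cₙ * Z ^ m)) + + n * (+ q * (+ 2 * C₆ * Z ^ m + b * (Z ^ n * Z ^ m)))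
        ≡⟨ lemma (+ n) (+ q) Cₙ (Z ^ m) C₆ b (Z ^ n * Z ^ m) ⟩
      + q * (U * Z ^ m + V * (Z ^ n * Z ^ m))                      ∎
      where
      open ≈-Reasoning P²
      Z = z ^ p
      b = bin (n ℕ.+ q) (n ℕ.+ m)
      lemma : ∀ n q c z c₆ b w → (1ℤ - n) * (q * (c * z)) + n * (q * (+ 2 * c₆ * z + b * w)) ≡
              q * (((1ℤ - n) * c + + 2 * n * c₆) * z + n * b * w)
      lemma = solve-∀

  -- Uniqueness of p = a² + b²

  i*i≡+∣i∣*∣i∣ : ∀ i → i * i ≡ + (∣ i ∣ ℕ.* ∣ i ∣)
  i*i≡+∣i∣*∣i∣ (+ n)    = sym (pos-* n n)
  i*i≡+∣i∣*∣i∣ -[1+ n ] = refl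

  *-zero-product : ∀ {x y} → x * y ≡ 0ℤ → x ≡ 0ℤ ⊎ y ≡ 0ℤ
  *-zero-product {x} = ℤ.i*j≡0⇒i≡0∨j≡0 x

  equal-squares : ∀ {x y} → x * x ≡ y * y → x ≡ y ⊎ x ≡ - y
  equal-squares {x} {y} e with *-zero-product {x - y} {x + y} (trans (lemma x y) (trans (cong (_- y * y) e) (+-inverseʳ (y * y))))
    where
    lemma : ∀ x y → (x - y) * (x + y) ≡ x * x - y * y
    lemma = solve-∀
  ... | inj₁ h = inj₁ (ℤ.i-j≡0⇒i≡j x y h)
  ... | inj₂ h = inj₂ (ℤ.i-j≡0⇒i≡j x (- y) (trans (cong (_+_ x) (ℤ.neg-involutive y)) h))

  module TwoSquares (q : ℕ) (p-prime : Prime (suc q)) (2∣q : 2 ℕ.∣ q) where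

    open Modular q p-prime

    private
      -- Excludes a² = B²: that would make the odd number p a sum of two odd squares.
      parity : ∀ a A → a ≈ 1ℤ [ + 2 ] → A ≈ 1ℤ [ + 2 ] → ¬ P ≡ a * a + A * A
      parity a A a-odd A-odd e = contradiction (≈⇒≡ 1≈0 (s≤s (s≤s z≤n))) (λ ())
        where
        open ≈-Reasoning (+ 2)
        q≈0 : + q ≈ 0ℤ [ + 2 ]
        q≈0 = ∣⇒≈ (subst (2 ℕ.∣_) (sym (ℕ.+-identityʳ q)) 2∣q)
        1≈0 : 1ℤ ≈ 0ℤ [ + 2 ]
        1≈0 = begin
          1ℤ                     ≈⟨ +-cong (≈-refl {x = 1ℤ}) q≈0 ⟨
          P                      ≡⟨ e ⟩
          a * a + A * A          ≈⟨ +-cong (*-cong a-odd a-odd) (*-cong A-odd A-odd) ⟩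
          + 2                    ≈⟨ N≈0 ⟩
          0ℤ                     ∎

      cancel-P : ∀ {x y} → P * x ≡ P * y → x ≡ y
      cancel-P = ℤ.*-cancelˡ-≡ P _ _

      -- (aB − bA)² + (aA + bB)² = P², so if P divides aB − bA then one of the two squares vanishes.
      divisible-case : ∀ {a b A B} → P ≡ a * a + b * b → P ≡ A * A + B * B → a ≈ 1ℤ [ + 2 ] → A ≈ 1ℤ [ + 2 ] →
                       a * B - b * A ≈ 0ℤ [ P ] → a * a ≡ A * A
      divisible-case {a} {b} {A} {B} e E a-odd A-odd h = go (≈-isolate h)
        where
        D = a * B - b * A
        F = a * A + b * B
        vanishing : D ≡ 0ℤ → a * a ≡ A * A
        vanishing D≡0 = ℤ.i-j≡0⇒i≡j (a * a) (A * A) (cancel-P (begin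
          P * (a * a - A * A)                          ≡⟨ lemma P a A ⟩
          a * a * (P - A * A) - (P - a * a) * (A * A)  ≡⟨ cong₂ (λ u v → a * a * (u - A * A) - (v - a * a) * (A * A)) E e ⟩
          a * a * (A * A + B * B - A * A) - (a * a + b * b - a * a) * (A * A)  ≡⟨ lemma′ a b A B ⟩
          D * (a * B + b * A)                          ≡⟨ cong (_* (a * B + b * A)) D≡0 ⟩
          0ℤ * (a * B + b * A)                         ≡⟨ *-zeroˡ (a * B + b * A) ⟩
          0ℤ                                           ≡⟨ *-zeroʳ P ⟨
          P * 0ℤ                                       ∎))
          where
          open ≡-Reasoning
          lemma : ∀ P a A → P * (a * a - A * A) ≡ a * a * (P - A * A) - (P - a * a) * (A * A)
          lemma = solve-∀
          lemma′ : ∀ a b A B → a * a * (A * A + B * B - A * A) - (a * a + b * b - a * a) * (A * A) ≡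
                   (a * B - b * A) * (a * B + b * A)
          lemma′ = solve-∀
        impossible : F ≡ 0ℤ → P ≡ a * a + A * A
        impossible F≡0 = cancel-P (ℤ.i-j≡0⇒i≡j (P * P) (P * (a * a + A * A)) (begin
          P * P - P * (a * a + A * A)                               ≡⟨ lemma P a A ⟩
          (P - a * a) * (P - A * A) - a * a * (A * A)               ≡⟨ cong₂ (λ u v → (u - a * a) * (v - A * A) - a * a * (A * A)) e E ⟩
          (a * a + b * b - a * a) * (A * A + B * B - A * A) - a * a * (A * A)  ≡⟨ lemma′ a b A B ⟩
          (b * B - a * A) * F                                       ≡⟨ cong (_*_ (b * B - a * A)) F≡0 ⟩
          (b * B - a * A) * 0ℤ                                      ≡⟨ *-zeroʳ (b * B - a * A) ⟩
          0ℤ                                                        ∎))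
          where
          open ≡-Reasoning
          lemma : ∀ P a A → P * P - P * (a * a + A * A) ≡ (P - a * a) * (P - A * A) - a * a * (A * A)
          lemma = solve-∀
          lemma′ : ∀ a b A B → (a * a + b * b - a * a) * (A * A + B * B - A * A) - a * a * (A * A) ≡
                   (b * B - a * A) * (a * A + b * B)
          lemma′ = solve-∀
        norm : + (∣ F ∣ ℕ.* ∣ F ∣ ℕ.+ ∣ D ∣ ℕ.* ∣ D ∣) ≡ + (p ℕ.* p)
        norm = begin
          + (∣ F ∣ ℕ.* ∣ F ∣) + + (∣ D ∣ ℕ.* ∣ D ∣)          ≡⟨ cong₂ _+_ (i*i≡+∣i∣*∣i∣ F) (i*i≡+∣i∣*∣i∣ D) ⟨
          F * F + D * D                                    ≡⟨ lemma a b A B ⟩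
          (a * a + b * b) * (A * A + B * B)                ≡⟨ cong₂ _*_ e E ⟨
          P * P                                            ≡⟨ pos-* p p ⟨
          + (p ℕ.* p)                                      ∎
          where
          open ≡-Reasoning
          lemma : ∀ a b A B → (a * A + b * B) * (a * A + b * B) + (a * B - b * A) * (a * B - b * A) ≡
                  (a * a + b * b) * (A * A + B * B)
          lemma = solve-∀
        square-zero : ∀ f → f ℕ.* f ≤ 0 → f ≡ 0
        square-zero zero _ = refl
        by-size : ∀ k → ∣ D ∣ ≡ k ℕ.* p → a * a ≡ A * A
        by-size zero    ∣D∣≡0 = vanishing (ℤ.∣i∣≡0⇒i≡0 ∣D∣≡0)
        by-size (suc k) ∣D∣≡  = contradiction (impossible (ℤ.∣i∣≡0⇒i≡0 (square-zero ∣ F ∣ (ℕ.+-cancelʳ-≤ (p ℕ.* p) _ _ (begin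
          ∣ F ∣ ℕ.* ∣ F ∣ ℕ.+ p ℕ.* p            ≤⟨ ℕ.+-monoʳ-≤ (∣ F ∣ ℕ.* ∣ F ∣) (ℕ.*-mono-≤ p≤∣D∣ p≤∣D∣) ⟩
          ∣ F ∣ ℕ.* ∣ F ∣ ℕ.+ ∣ D ∣ ℕ.* ∣ D ∣    ≡⟨ ℤ.+-injective norm ⟩
          p ℕ.* p                                ∎))))) (parity a A a-odd A-odd)
          where
          open ℕ.≤-Reasoning
          p≤∣D∣ : p ≤ ∣ D ∣
          p≤∣D∣ = subst (p ≤_) (sym ∣D∣≡) (ℕ.m≤m+n p (k ℕ.* p))
        go : ∃[ k ] D ≡ 0ℤ + k * P → a * a ≡ A * A
        go (k , D≡) = by-size ∣ k ∣ (trans (cong ∣_∣ (trans D≡ (+-identityˡ (k * P)))) (abs-* k P))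

    -- (aB - bA)(aB + bA) = p (a² - A²), so p divides one of the factors; changing the sign of B
    -- exchanges them.
    unique : ∀ {a b A B} → P ≡ a * a + b * b → P ≡ A * A + B * B → a ≈ 1ℤ [ + 2 ] → A ≈ 1ℤ [ + 2 ] → a * a ≡ A * A
    unique {a} {b} {A} {B} e E a-odd A-odd = go (euclid {a * B - b * A} {a * - B - b * A} (congruent (A * A - a * a) (begin
      (a * B - b * A) * (a * - B - b * A) - 0ℤ                                       ≡⟨ lemma a b A B ⟩
      (a * a + b * b - a * a) * (A * A) - a * a * (A * A + B * B - A * A)            ≡⟨ cong₂ (λ u v → (u - a * a) * (A * A) - a * a * (v - A * A)) e E ⟨
      (P - a * a) * (A * A) - a * a * (P - A * A)                                    ≡⟨ lemma′ P a A ⟩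
      (A * A - a * a) * P                                                            ∎)))
      where
      open ≡-Reasoning
      lemma : ∀ a b A B → (a * B - b * A) * (a * - B - b * A) - 0ℤ ≡
              (a * a + b * b - a * a) * (A * A) - a * a * (A * A + B * B - A * A)
      lemma = solve-∀
      lemma′ : ∀ P a A → (P - a * a) * (A * A) - a * a * (P - A * A) ≡ (A * A - a * a) * P
      lemma′ = solve-∀
      even : ∀ A B → A * A + B * B ≡ A * A + - B * - B
      even = solve-∀
      go : a * B - b * A ≈ 0ℤ [ P ] ⊎ a * - B - b * A ≈ 0ℤ [ P ] → a * a ≡ A * A
      go (inj₁ h) = divisible-case {a} {b} {A} {B} e E a-odd A-odd h
      go (inj₂ h) = divisible-case {a} {b} {A} { - B} e (trans E (even A B)) a-odd A-odd h

  -- Evaluation of T(-1), and the case p = 4m + 1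

  module Quarter (m : ℕ) (p-prime : Prime (suc (2 ℕ.* (m ℕ.* 2)))) where

    open QuarterBinomials m p-prime
    open Modular q p-prime
    open PowerSums q p-prime
    open Character n p-prime
    open Jacobsthal m p-prime
    open CentralSum n p-prime
    open TwoSquares q p-prime (ℕ.m∣m*n n)

    s-sign : IsSign s
    s-sign = IsSign-^ m minus

    s*s≡1 : s * s ≡ 1ℤ
    s*s≡1 = sign-square s-sign

    T-minus-one : T -1ℤ ≈ + q * (s * (U + V)) [ P² ]
    T-minus-one = ≈-trans (T≈ (sign-unit minus)) (reflexive (trans
      (cong (λ v → + q * (U * v ^ m + V * (v ^ n * v ^ m))) -1^p)
      (trans (cong (λ v → + q * (U * s + V * (v * s))) -1^n) (lemma (+ q) U V s))))
      where
      -1^p : -1ℤ ^ p ≡ -1ℤ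
      -1^p = cong (_*_ -1ℤ) (-1^2k n)
      -1^n : -1ℤ ^ n ≡ 1ℤ
      -1^n = trans (cong (-1ℤ ^_) (ℕ.*-comm m 2)) (-1^2k m)
      lemma : ∀ q u v s → q * (u * s + v * (1ℤ * s)) ≡ q * (s * (u + v))
      lemma = solve-∀

    -- With s² = 1 and ζ² ≡ χ(g) = -1, the squared sums add up to q² ((U + V)² - (U - V)²) = 4 q² U
    -- V ≡ 4 q² P, and q² ≡ 1 modulo p.
    H²+H²≈P : ∀ {g} → χ g ≡ -1ℤ → P ≈ H -1ℤ * H -1ℤ + H g * H g [ P² ]
    H²+H²≈P {g} χg≡-1 = ≈-sym (cancel² {+ 4} (Unit-* unit-2 unit-2) (begin
      + 4 * (H -1ℤ * H -1ℤ + H g * H g)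
        ≡⟨ lemma₁ (H -1ℤ) (H g) ⟩
      (+ 2 * H -1ℤ) * (+ 2 * H -1ℤ) + (+ 2 * H g) * (+ 2 * H g)
        ≡⟨ cong₂ (λ u v → u * u + v * v) (T≡2H -1ℤ) (T≡2H g) ⟨
      T -1ℤ * T -1ℤ + T g * T g
        ≈⟨ +-cong (*-cong T-minus-one T-minus-one) (*-cong T-g T-g) ⟩
      + q * (s * (U + V)) * (+ q * (s * (U + V))) + + q * (ζ * (U - V)) * (+ q * (ζ * (U - V)))
        ≈⟨ lin₃ (+ q * + q * (U + V) * (U + V)) (+ q * + q * (U - V) * (U - V)) (+ 4 * + q * + q) (+ 4 * + q - + 4)
             (reflexive s*s≡1) ζ*ζ≈-1 VU≈P (lemma₂ (+ q) s ζ U V) ⟩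
      + 4 * P ∎))
      where
      open ≈-Reasoning P²
      ζ = (g ^ p) ^ m
      ug : Unit g
      ug g≈0 = contradiction (trans (sym χg≡-1) (χ-zero g≈0)) (λ ())
      Z^n≈-1 : (g ^ p) ^ n ≈ -1ℤ [ P² ]
      Z^n≈-1 = ≈-sym (subst (λ v → v ≈ (g ^ p) ^ n [ P² ]) χg≡-1 (χ-lift g))
      ζ*ζ≈-1 : ζ * ζ ≈ -1ℤ [ P² ]
      ζ*ζ≈-1 = subst (λ v → v ≈ -1ℤ [ P² ])
        (trans (sym (^-*-assoc (g ^ p) m 2)) (cong (_*_ ζ) (*-identityʳ ζ))) Z^n≈-1
      T-g : T g ≈ + q * (ζ * (U - V)) [ P² ]
      T-g = ≈-trans (T≈ ug) (lin₁ (+ q * (V * ζ)) 0ℤ Z^n≈-1 (lemma (+ q) U V ζ ((g ^ p) ^ n) P²))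
        where
        lemma : ∀ q u v z w N → q * (u * z + v * (w * z)) - q * (z * (u - v)) ≡ q * (v * z) * (w - -1ℤ) + 0ℤ * N
        lemma = solve-∀
      lemma₁ : ∀ x y → + 4 * (x * x + y * y) ≡ (+ 2 * x) * (+ 2 * x) + (+ 2 * y) * (+ 2 * y)
      lemma₁ = solve-∀
      lemma₂ : ∀ q s z u v →
        q * (s * (u + v)) * (q * (s * (u + v))) + q * (z * (u - v)) * (q * (z * (u - v))) - + 4 * (1ℤ + q) ≡
        q * q * (u + v) * (u + v) * (s * s - 1ℤ) + q * q * (u - v) * (u - v) * (z * z - -1ℤ) +
        + 4 * q * q * (v * u - (1ℤ + q)) + (+ 4 * q - + 4) * ((1ℤ + q) * (1ℤ + q))
      lemma₂ = solve-∀

    ∣H∣≤n : ∀ z → ∣ H z ∣ ≤ n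
    ∣H∣≤n z = ∣∑∣≤ n {λ x → term z (suc x)} (λ {x} _ → ℕ.≤-trans (ℕ.≤-reflexive (abs-* (χ (+ suc x)) (χ ((+ suc x) ^ 2 + z))))
      (ℕ.*-mono-≤ (∣χ∣≤1 (+ suc x)) (∣χ∣≤1 ((+ suc x) ^ 2 + z))))

    -- The halved sums matter: |H| ≤ n gives H² + H² ≤ 2n² < p², whereas the trivial bound 2q² for
    -- T² + T² exceeds p².
    H²+H²≡P : ∀ {g} → χ g ≡ -1ℤ → P ≡ H -1ℤ * H -1ℤ + H g * H g
    H²+H²≡P {g} χg≡-1 = ≈⇒≡ (H²+H²≈P χg≡-1) (begin-strict
      ∣ P - (H -1ℤ * H -1ℤ + H g * H g) ∣    ≡⟨ cong (λ v → ∣ P - v ∣) (cong₂ _+_ (i*i≡+∣i∣*∣i∣ (H -1ℤ)) (i*i≡+∣i∣*∣i∣ (H g))) ⟩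
      ∣ P - + h ∣                            ≡⟨ cong ∣_∣ (ℤ.m-n≡m⊖n p h) ⟩
      ∣ p ℤ.⊖ h ∣                            ≤⟨ ℤ.∣m⊝n∣≤m⊔n p h ⟩
      p ℕ.⊔ h                                <⟨ ℕ.⊔-lub (ℕ.m<m*n p p 1<p) h<p*p ⟩
      p ℕ.* p                                ≡⟨ abs-* P P ⟨
      ∣ P² ∣                                 ∎)
      where
      open ℕ.≤-Reasoning
      h = ∣ H -1ℤ ∣ ℕ.* ∣ H -1ℤ ∣ ℕ.+ ∣ H g ∣ ℕ.* ∣ H g ∣
      h<p*p : h < p ℕ.* p
      h<p*p = begin-strict
        h                        ≤⟨ ℕ.+-mono-≤ (ℕ.*-mono-≤ (∣H∣≤n -1ℤ) (∣H∣≤n -1ℤ)) (ℕ.*-mono-≤ (∣H∣≤n g) (∣H∣≤n g)) ⟩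
        n ℕ.* n ℕ.+ n ℕ.* n      ≡⟨ ℕ.*-distribʳ-+ n n n ⟨
        (n ℕ.+ n) ℕ.* n          ≡⟨ cong (λ k → (n ℕ.+ k) ℕ.* n) (ℕ.+-identityʳ n) ⟨
        q ℕ.* n                  ≤⟨ ℕ.*-monoʳ-≤ q (ℕ.<⇒≤ n<p) ⟩
        q ℕ.* p                  <⟨ ℕ.m<n+m (q ℕ.* p) (s≤s z≤n) ⟩
        p ℕ.* p                  ∎

    -- Twice this sum is the full sum of x^n modulo p, hence 0, and its absolute value is at most n
    -- < p.
    ∑χ≡0 : ∑ n (λ x → χ (+ suc x)) ≡ 0ℤ
    ∑χ≡0 = ≈⇒≡ half≈0 (ℕ.≤-<-trans (ℕ.≤-trans (ℕ.≤-reflexive (cong ∣_∣ (+-identityʳ half))) (∣∑∣≤ n {λ x → χ (+ suc x)} (λ {x} _ → ∣χ∣≤1 (+ suc x)))) n<p)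
      where
      open ≈-Reasoning P
      half = ∑ n (λ x → χ (+ suc x))
      half≈0 : half ≈ 0ℤ [ P ]
      half≈0 = cancel unit-2 (begin
        + 2 * half                      ≡⟨ ∑-even χ (χ-zero ≈-refl) χ-even ⟨
        ∑ p (λ x → χ (+ x))             ≈⟨ ∑-cong p (λ {x} _ → χ≈ (+ x)) ⟩
        ∑ p (λ x → (+ x) ^ n)           ≈⟨ power-sum≈0 n n<2n ⟩
        0ℤ                              ∎)

    χ-2 : χ (+ 2) ≡ s
    χ-2 = χ-unique s-sign (subst (λ v → v ≈ s [ P ]) (trans (^-*-assoc (+ 2) 2 m) (cong ((+ 2) ^_) (ℕ.*-comm 2 m))) 4^m≈s)

    -- This is χ(j!).
    w : ℕ → ℤ
    w j = ∏ j (λ x → χ (+ suc x))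

    χ-sign-small : ∀ {k} → suc k < p → IsSign (χ (+ suc k))
    χ-sign-small k<p = χ-sign (Unit-small (s≤s z≤n) k<p)

    χ-square : ∀ {k} → suc k < p → χ (+ suc k) * χ (+ suc k) ≡ 1ℤ
    χ-square k<p = sign-square (χ-sign-small k<p)

    -- By `∑χ≡0` and `sum-of-signs`, 0 ≡ n - 1 + w(n) modulo 4, and 1 - 2m ≡ (-1)^m.
    w-n : w n ≡ s
    w-n = sign-≈⇒≡ {+ 4} (s≤s (s≤s (s≤s z≤n))) (IsSign-∏ n signs) s-sign
      (lin₂ -1ℤ -1ℤ 0ℤ
        (subst (λ v → 0ℤ ≈ v - 1ℤ + w n [ + 4 ]) (pos-* m 2) (subst (λ v → v ≈ + n - 1ℤ + w n [ + 4 ]) ∑χ≡0 (sum-of-signs n signs)))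
        (^-minus-one-mod-4 m) (lemma (w n) s (+ m)))
      where
      signs : ∀ {x} → x < n → IsSign (χ (+ suc x))
      signs x<n = χ-sign-small (s≤s (ℕ.≤-trans x<n (ℕ.m≤m+n n (n ℕ.+ 0))))
      lemma : ∀ w s m → w - s ≡ -1ℤ * (0ℤ - (m * + 2 - 1ℤ + w)) + -1ℤ * (s - (1ℤ - + 2 * m)) + 0ℤ * + 4
      lemma = solve-∀

    term-factor : ∀ x → term -1ℤ (suc (suc x)) ≡ χ (+ suc (suc x)) * (χ (+ suc x) * χ (+ suc (suc (suc x))))
    term-factor x = cong (_*_ (χ (+ suc (suc x)))) (trans (cong χ (factor (+ x))) (χ-* (+ suc x) (+ suc (suc (suc x)))))
      where
      factor : ∀ x → (1ℤ + (1ℤ + x)) * ((1ℤ + (1ℤ + x)) * 1ℤ) + -1ℤ ≡ (1ℤ + x) * (1ℤ + (1ℤ + (1ℤ + x)))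
      factor = solve-∀

    -- The terms are χ(y - 1) χ(y) χ(y + 1) for 2 ≤ y ≤ j + 1. Interior values occur three times and
    -- leave one copy; the corrections at the ends are χ(j + 1) χ(j + 2) and χ(2) = s.
    product-of-terms : ∀ j → suc (suc j) < p → ∏ j (λ x → term -1ℤ (suc (suc x))) ≡ w (suc j) * (χ (+ suc j) * χ (+ suc (suc j))) * s
    product-of-terms zero    _   = sym (trans (cong₂ (λ u v → 1ℤ * u * (u * v) * s) χ-one χ-2) (trans (lemma s) s*s≡1))
      where
      χ-one : χ 1ℤ ≡ 1ℤ
      χ-one = χ-unique plus (reflexive (^-zeroˡ n))
      lemma : ∀ s → 1ℤ * 1ℤ * (1ℤ * s) * s ≡ s * s
      lemma = solve-∀
    product-of-terms (suc j) j<p = begin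
      ∏ j (λ x → term -1ℤ (suc (suc x))) * term -1ℤ (suc (suc j))
        ≡⟨ cong₂ _*_ (product-of-terms j (ℕ.<-trans ℕ.≤-refl j<p)) (term-factor j) ⟩
      w (suc j) * (χ₁ * χ₂) * s * (χ₂ * (χ₁ * χ₃))
        ≡⟨ lemma (w (suc j)) χ₁ χ₂ χ₃ s ⟩
      (χ₁ * χ₁) * (w (suc j) * χ₂ * (χ₂ * χ₃) * s)
        ≡⟨ cong (_* (w (suc j) * χ₂ * (χ₂ * χ₃) * s)) (χ-square (ℕ.<-trans ℕ.≤-refl (ℕ.<-trans ℕ.≤-refl j<p))) ⟩
      1ℤ * (w (suc j) * χ₂ * (χ₂ * χ₃) * s)
        ≡⟨ *-identityˡ (w (suc j) * χ₂ * (χ₂ * χ₃) * s) ⟩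
      w (suc (suc j)) * (χ₂ * χ₃) * s ∎
      where
      open ≡-Reasoning
      χ₁ = χ (+ suc j)
      χ₂ = χ (+ suc (suc j))
      χ₃ = χ (+ suc (suc (suc j)))
      lemma : ∀ w x y z s → w * (x * y) * s * (y * (x * z)) ≡ (x * x) * (w * y * (y * z) * s)
      lemma = solve-∀

    -- 4 n (n + 1) = p² - 1, and χ takes the value 1 at both 4 and -1.
    χ-n*χ-suc-n : χ (+ n) * χ (+ suc n) ≡ 1ℤ
    χ-n*χ-suc-n = begin
      χ (+ n) * χ (+ suc n)                            ≡⟨ χ-* (+ n) (+ suc n) ⟨
      χ (+ n * + suc n)                                ≡⟨ lemma (χ (+ n * + suc n)) ⟩
      1ℤ * χ (+ n * + suc n)                           ≡⟨ cong (_* χ (+ n * + suc n)) (trans (cong₂ _*_ χ-2 χ-2) s*s≡1) ⟨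
      χ (+ 2) * χ (+ 2) * χ (+ n * + suc n)            ≡⟨ cong (_* χ (+ n * + suc n)) (χ-* (+ 2) (+ 2)) ⟨
      χ (+ 4) * χ (+ n * + suc n)                      ≡⟨ χ-* (+ 4) (+ n * + suc n) ⟨
      χ (+ 4 * (+ n * + suc n))                        ≡⟨ χ-resp (congruent P (trans (square (+ n)) (cong₂ _*_ 2n+1≡P 2n+1≡P))) ⟩
      χ -1ℤ                                            ≡⟨ χ-minus-one ⟩
      1ℤ                                               ∎
      where
      open ≡-Reasoning
      lemma : ∀ x → x ≡ 1ℤ * x
      lemma = solve-∀
      square : ∀ n → + 4 * (n * (1ℤ + n)) - -1ℤ ≡ (1ℤ + + 2 * n) * (1ℤ + + 2 * n)
      square = solve-∀

    -- The term at x = 1 is 0. The other n - 1 terms are signs with product w(n) s = 1, so their sum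
    -- is n - 1 = 2m - 1 modulo 4.
    H≈-s : H -1ℤ ≈ - s [ + 4 ]
    H≈-s = go n refl
      where
      go : ∀ k → k ≡ n → H -1ℤ ≈ - s [ + 4 ]
      go zero    k≡n = contradiction k≡n (ℕ.<⇒≢ 0<n)
      go (suc k) k≡n = lin₂ 1ℤ 1ℤ 0ℤ (subst (λ v → H -1ℤ ≈ v - 1ℤ [ + 4 ]) 1+k sum-mod-4) (^-minus-one-mod-4 m)
        (lemma (H -1ℤ) s (+ m))
        where
        open ≈-Reasoning (+ 4)
        lemma : ∀ h s m → h - - s ≡ 1ℤ * (h - (m * + 2 - 1ℤ)) + 1ℤ * (s - (1ℤ - + 2 * m)) + 0ℤ * + 4
        lemma = solve-∀
        lemma′ : ∀ k → 0ℤ + (k - 1ℤ + 1ℤ) ≡ 1ℤ + k - 1ℤ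
        lemma′ = solve-∀
        1+k : 1ℤ + + k ≡ + m * + 2
        1+k = trans (cong +_ k≡n) (pos-* m 2)
        f : ℕ → ℤ
        f x = term -1ℤ (suc (suc x))
        k+2<p : suc (suc k) < p
        k+2<p = subst (λ j → suc j < p) (sym k≡n) (s≤s n<2n)
        signs : ∀ {x} → x < k → IsSign (f x)
        signs {x} x<k = subst IsSign (sym (term-factor x))
          (IsSign-* (χ-sign-small (small 1 (s≤s z≤n))) (IsSign-* (χ-sign-small (small 0 z≤n)) (χ-sign-small (small 2 ℕ.≤-refl))))
          where
          small : ∀ i → i ≤ 2 → suc (i ℕ.+ x) < p
          small i i≤2 = ℕ.≤-<-trans (ℕ.≤-trans (s≤s (ℕ.+-monoˡ-≤ x i≤2)) (s≤s (s≤s x<k))) k+2<p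
        first : term -1ℤ 1 ≡ 0ℤ
        first = trans (cong (_*_ (χ 1ℤ)) (χ-zero ≈-refl)) (*-zeroʳ (χ 1ℤ))
        product≡1 : ∏ k f ≡ 1ℤ
        product≡1 = trans (product-of-terms k k+2<p) (trans (cong (λ j → w j * (χ (+ j) * χ (+ suc j)) * s) k≡n)
          (trans (cong₂ (λ u v → u * v * s) w-n χ-n*χ-suc-n) (trans (cong (_* s) (*-identityʳ s)) s*s≡1)))
        sum-mod-4 : H -1ℤ ≈ 1ℤ + + k - 1ℤ [ + 4 ]
        sum-mod-4 = begin
          ∑ n (λ x → term -1ℤ (suc x))   ≡⟨ cong (λ j → ∑ j (λ x → term -1ℤ (suc x))) k≡n ⟨
          term -1ℤ 1 + ∑ k f             ≈⟨ +-cong (reflexive first) (sum-of-signs k signs) ⟩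
          0ℤ + (+ k - 1ℤ + ∏ k f)        ≡⟨ cong (λ v → 0ℤ + (+ k - 1ℤ + v)) product≡1 ⟩
          0ℤ + (+ k - 1ℤ + 1ℤ)           ≡⟨ lemma′ (+ k) ⟩
          1ℤ + + k - 1ℤ                  ∎

    -- Uniqueness gives a² = H², and -s H ≡ s² = 1 ≡ a modulo 4 decides the sign.
    a≡-s*H : ∀ {a b} → P ≡ a * a + b * b → a ≈ 1ℤ [ + 4 ] → a ≡ - s * H -1ℤ
    a≡-s*H {a} {b} e a≈1 = by-cases s-sign H≈-s (equal-squares a²≡H²)
      where
      h = H -1ℤ
      sign-odd : ∀ {x} → IsSign x → - x ≈ 1ℤ [ + 2 ]
      sign-odd plus  = congruent -1ℤ refl
      sign-odd minus = congruent 0ℤ refl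
      a²≡H² : a * a ≡ h * h
      a²≡H² = unique {a} {b} {h} {H (proj₁ nonresidue)} e (H²+H²≡P (proj₂ nonresidue)) (≈-weaken {+ 2} a≈1)
        (≈-trans (≈-weaken {+ 2} H≈-s) (sign-odd s-sign))
      negate : ∀ x y → x ≡ - y → y ≡ - x
      negate _ y refl = sym (ℤ.neg-involutive y)
      by-cases : ∀ {x} → IsSign x → h ≈ - x [ + 4 ] → a ≡ h ⊎ a ≡ - h → a ≡ - x * h
      by-cases plus  h≈-1 (inj₁ a≡h)  = contradiction (≈⇒≡ {+ 4} {1ℤ} { -1ℤ } (≈-trans (≈-sym a≈1) (subst (λ v → v ≈ -1ℤ [ + 4 ]) (sym a≡h) h≈-1)) (s≤s (s≤s (s≤s z≤n)))) (λ ())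
      by-cases plus  h≈-1 (inj₂ a≡-h) = trans a≡-h (sym (ℤ.-1*i≡-i h))
      by-cases minus h≈1  (inj₁ a≡h)  = trans a≡h (sym (*-identityˡ h))
      by-cases minus h≈1  (inj₂ a≡-h) = contradiction (≈⇒≡ {+ 4} {0ℤ} {+ 2} (lin₂ 1ℤ 1ℤ 0ℤ h≈1 a≈1 (trans (lemma h) (cong (λ v → 1ℤ * (h - 1ℤ) + 1ℤ * (v - 1ℤ) + 0ℤ * + 4) (sym a≡-h)))) (s≤s (s≤s (s≤s z≤n)))) (λ ())
        where
        lemma : ∀ h → 0ℤ - + 2 ≡ 1ℤ * (h - 1ℤ) + 1ℤ * (- h - 1ℤ) + 0ℤ * + 4
        lemma = solve-∀

    2a≈ : ∀ {a b} → P ≡ a * a + b * b → a ≈ 1ℤ [ + 4 ] → + 2 * a ≈ (1ℤ - P) * (U + V) [ P² ]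
    2a≈ {a} {b} e a≈1 = begin
      + 2 * a                              ≡⟨ cong (_*_ (+ 2)) (a≡-s*H {a} {b} e a≈1) ⟩
      + 2 * (- s * H -1ℤ)                  ≡⟨ lemma s (H -1ℤ) ⟩
      - s * (+ 2 * H -1ℤ)                  ≡⟨ cong (_*_ (- s)) (T≡2H -1ℤ) ⟨
      - s * T -1ℤ                          ≈⟨ *-congˡ (- s) T-minus-one ⟩
      - s * (+ q * (s * (U + V)))          ≡⟨ lemma′ s (+ q) (U + V) ⟩
      (s * s) * ((1ℤ - P) * (U + V))       ≡⟨ trans (cong (_* ((1ℤ - P) * (U + V))) s*s≡1) (*-identityˡ ((1ℤ - P) * (U + V))) ⟩
      (1ℤ - P) * (U + V)                   ∎
      where
      open ≈-Reasoning P²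
      lemma : ∀ s h → + 2 * (- s * h) ≡ - s * (+ 2 * h)
      lemma = solve-∀
      lemma′ : ∀ s q u → - s * (q * (s * u)) ≡ s * s * ((1ℤ - (1ℤ + q)) * u)
      lemma′ = solve-∀

    unit-2a : ∀ {a b} → P ≡ a * a + b * b → a ≈ 1ℤ [ + 4 ] → Unit (+ 2 * a)
    unit-2a {a} {b} e a≈1 = Unit-resp (≈-sym (≈-trans (≈-weaken {P} (2a≈ {a} {b} e a≈1))
      (lin₂ 1ℤ 1ℤ (- (U + V)) U≈C V≈0 (lemma P U V Cₙ)))) C-unit
      where
      lemma : ∀ P u v c → (1ℤ - P) * (u + v) - c ≡ 1ℤ * (u - c) + 1ℤ * (v - 0ℤ) + - (u + v) * P
      lemma = solve-∀

    -- s C(2m, m) / 2^n approximates the root λ of X² - 2aX + p prime to p, for which λ = 2a - p/λ ≡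
    -- 2a - p/(2a). The computation rests on (1 - P) V · 2a ≡ P, as V² ≡ 0.
    unit-root : ∀ {a b} → P ≡ a * a + b * b → a ≈ 1ℤ [ + 4 ] →
                s * Cₙ * (+ 2 * a) ≈ (+ 2) ^ n * (+ 2 * a * (+ 2 * a) - P) [ P² ]
    unit-root {a} {b} e a≈1 = begin
      s * Cₙ * α                                     ≈⟨ *-cong sC≈4^m[1-P]U (2a≈ {a} {b} e a≈1) ⟩
      (+ 4) ^ m * ((1ℤ - P) * U) * β                 ≡⟨ *-assoc ((+ 4) ^ m) ((1ℤ - P) * U) β ⟩
      (+ 4) ^ m * ((1ℤ - P) * U * β)                 ≈⟨ *-congˡ ((+ 4) ^ m) (lin₂ (- ((1ℤ - P) * (1ℤ - P))) (- ((1ℤ - P) * (1ℤ - P))) (+ 2 - P)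
                                                          VU≈P (≈-scale V≈0 V≈0) (lemma P U V)) ⟩
      (+ 4) ^ m * (β * β - P)                        ≈⟨ *-congˡ ((+ 4) ^ m) (+-cong (*-cong (2a≈ {a} {b} e a≈1) (2a≈ {a} {b} e a≈1)) ≈-refl) ⟨
      (+ 4) ^ m * (α * α - P)                        ≡⟨ cong (_* (α * α - P)) (trans (^-*-assoc (+ 2) 2 m) (cong ((+ 2) ^_) (ℕ.*-comm 2 m))) ⟩
      (+ 2) ^ n * (α * α - P)                        ∎
      where
      open ≈-Reasoning P²
      α β : ℤ
      α = + 2 * a
      β = (1ℤ - P) * (U + V)
      lemma : ∀ P u v → (1ℤ - P) * u * ((1ℤ - P) * (u + v)) - ((1ℤ - P) * (u + v) * ((1ℤ - P) * (u + v)) - P) ≡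
              - ((1ℤ - P) * (1ℤ - P)) * (v * u - P) + - ((1ℤ - P) * (1ℤ - P)) * (v * v - v * 0ℤ) + (+ 2 - P) * (P * P)
      lemma = solve-∀

    central-sum-quarter : ∀ {a b} → P ≡ a * a + b * b → a ≈ 1ℤ [ + 4 ] →
      ∑ (suc n) (λ k → central k * central k * (+ 32) ^ (n ∸ k)) * (+ 2 * a) ≈ (+ 32) ^ n * (+ 2 * a * (+ 2 * a) - P) [ P² ]
    central-sum-quarter {a} {b} e a≈1 = begin
      ∑ (suc n) (λ k → central k * central k * (+ 32) ^ (n ∸ k)) * α   ≈⟨ *-congʳ α central-sum≈ ⟩
      (+ 16) ^ n * coefficient n n n * α           ≡⟨ cong (λ v → (+ 16) ^ n * v * α) (coefficient-even n m) ⟩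
      (+ 16) ^ n * (s * Cₙ) * α                    ≡⟨ *-assoc ((+ 16) ^ n) (s * Cₙ) α ⟩
      (+ 16) ^ n * (s * Cₙ * α)                    ≈⟨ *-congˡ ((+ 16) ^ n) (unit-root {a} {b} e a≈1) ⟩
      (+ 16) ^ n * ((+ 2) ^ n * (α * α - P))       ≡⟨ *-assoc ((+ 16) ^ n) ((+ 2) ^ n) (α * α - P) ⟨
      (+ 16) ^ n * (+ 2) ^ n * (α * α - P)         ≡⟨ cong (_* (α * α - P)) (*-^ (+ 16) (+ 2) n) ⟨
      (+ 32) ^ n * (α * α - P)                     ∎
      where
      open ≈-Reasoning P²
      α = + 2 * a

  -- Passage from integers to rationals

  fromℤ-+ : ∀ x y → fromℤ (x + y) ≡ fromℤ x ℚ.+ fromℤ y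
  fromℤ-+ x y = ℚ.toℚᵘ-injective (ℚᵘ.≃-trans (ℚᵘ.*≡* (lemma x y)) (ℚᵘ.≃-sym (ℚ.toℚᵘ-homo-+ (fromℤ x) (fromℤ y))))
    where
    lemma : ∀ x y → (x + y) * 1ℤ ≡ (x * 1ℤ + y * 1ℤ) * 1ℤ
    lemma = solve-∀

  fromℤ-* : ∀ x y → fromℤ (x * y) ≡ fromℤ x ℚ.* fromℤ y
  fromℤ-* x y = ℚ.toℚᵘ-injective (ℚᵘ.≃-sym (ℚ.toℚᵘ-homo-* (fromℤ x) (fromℤ y)))

  fromℤ-neg : ∀ x → fromℤ (- x) ≡ ℚ.- fromℤ x
  fromℤ-neg x = ℚ.toℚᵘ-injective (ℚᵘ.≃-sym (ℚ.toℚᵘ-homo‿- (fromℤ x)))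

  fromℤ-minus : ∀ x y → fromℤ (x - y) ≡ fromℤ x ℚ.- fromℤ y
  fromℤ-minus x y = trans (fromℤ-+ x (- y)) (cong (fromℤ x ℚ.+_) (fromℤ-neg y))

  infix 4 _IsOver_≡_

  -- The fraction y/d kept as x · d = y, neither reduced nor divided out, so that sums over a common
  -- denominator stay integer computations.
  record _IsOver_≡_ (x : ℚ) (d y : ℤ) : Set where
    constructor over
    field
      product : x ℚ.* fromℤ d ≡ fromℤ y

  open _IsOver_≡_

  over-scale : ∀ {x d y} e → x IsOver d ≡ y → x IsOver d * e ≡ y * e
  over-scale {x} {d} {y} e (over h) = over (begin
    x ℚ.* fromℤ (d * e)              ≡⟨ cong (x ℚ.*_) (fromℤ-* d e) ⟩
    x ℚ.* (fromℤ d ℚ.* fromℤ e)      ≡⟨ ℚ.*-assoc x (fromℤ d) (fromℤ e) ⟨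
    x ℚ.* fromℤ d ℚ.* fromℤ e        ≡⟨ cong (ℚ._* fromℤ e) h ⟩
    fromℤ y ℚ.* fromℤ e              ≡⟨ fromℤ-* y e ⟨
    fromℤ (y * e)                    ∎)
    where open ≡-Reasoning

  over-minus : ∀ {x x′ d y y′} → x IsOver d ≡ y → x′ IsOver d ≡ y′ → x ℚ.- x′ IsOver d ≡ y - y′
  over-minus {x} {x′} {d} {y} {y′} (over h) (over h′) = over (begin
    (x ℚ.- x′) ℚ.* fromℤ d                             ≡⟨ ℚ.*-distribʳ-+ (fromℤ d) x (ℚ.- x′) ⟩
    x ℚ.* fromℤ d ℚ.+ (ℚ.- x′) ℚ.* fromℤ d             ≡⟨ cong₂ ℚ._+_ h (trans (sym (ℚ.neg-distribˡ-* x′ (fromℤ d))) (cong ℚ.-_ h′)) ⟩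
    fromℤ y ℚ.- fromℤ y′                               ≡⟨ fromℤ-minus y y′ ⟨
    fromℤ (y - y′)                                     ∎)
    where open ≡-Reasoning

  over-/ : ∀ i d e .{{_ : ℕ.NonZero d}} → i ℚ./ d IsOver + d * e ≡ i * e
  over-/ i (suc d) e = over-scale e (over (ℚ.toℚᵘ-injective (begin
    ℚ.toℚᵘ (i ℚ./ suc d ℚ.* fromℤ (+ suc d))               ≈⟨ ℚ.toℚᵘ-homo-* (i ℚ./ suc d) (fromℤ (+ suc d)) ⟩
    ℚ.toℚᵘ (i ℚ./ suc d) ℚᵘ.* ℚ.toℚᵘ (fromℤ (+ suc d))     ≈⟨ ℚᵘ.*-congʳ (ℚ.toℚᵘ-fromℚᵘ (ℚᵘ.mkℚᵘ i d)) ⟩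
    ℚᵘ.mkℚᵘ i d ℚᵘ.* ℚ.toℚᵘ (fromℤ (+ suc d))              ≈⟨ ℚᵘ.*≡* (trans (*-identityʳ (i * + suc d)) (cong (λ k → i * + suc k) (sym (ℕ.*-identityʳ d)))) ⟩
    ℚ.toℚᵘ (fromℤ i)                                       ∎)))
    where open ℚᵘ.≃-Reasoning

  over-sum : ∀ k d {f : Fin k → ℚ} {g : Fin k → ℤ} → (∀ i → f i IsOver d ≡ g i) → ℚ-Sum.sum f IsOver d ≡ Sum.sum g
  over-sum zero    d h = over (ℚ.*-zeroˡ (fromℤ d))
  over-sum (suc k) d {f} {g} h = over (begin
    (f Fin.zero ℚ.+ ℚ-Sum.sum (f ∘ Fin.suc)) ℚ.* fromℤ d                   ≡⟨ ℚ.*-distribʳ-+ (fromℤ d) (f Fin.zero) (ℚ-Sum.sum (f ∘ Fin.suc)) ⟩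
    f Fin.zero ℚ.* fromℤ d ℚ.+ ℚ-Sum.sum (f ∘ Fin.suc) ℚ.* fromℤ d         ≡⟨ cong₂ ℚ._+_ (product (h Fin.zero)) (product (over-sum k d (h ∘ Fin.suc))) ⟩
    fromℤ (g Fin.zero) ℚ.+ fromℤ (Sum.sum (g ∘ Fin.suc))                   ≡⟨ fromℤ-+ (g Fin.zero) (Sum.sum (g ∘ Fin.suc)) ⟨
    fromℤ (g Fin.zero + Sum.sum (g ∘ Fin.suc))                             ∎)
    where open ≡-Reasoning

  over-cross : ∀ {x d y} → x IsOver d ≡ y → ↥ x * d ≡ y * ↧ x
  over-cross {x@record{}} {d} {y} (over h) with ℚᵘ.≃-trans (ℚᵘ.≃-sym (ℚ.toℚᵘ-homo-* x (fromℤ d))) (ℚᵘ.≃-reflexive (cong ℚ.toℚᵘ h))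
  ... | ℚᵘ.*≡* e = trans (sym (*-identityʳ (↥ x * d))) (trans e (cong (y *_) (cong +_ (ℕ.*-identityʳ (↧ₙ x)))))

  pos-^ : ∀ a k → + (a ℕ.^ k) ≡ (+ a) ^ k
  pos-^ a zero    = refl
  pos-^ a (suc k) = trans (pos-* a (a ℕ.^ k)) (cong (_*_ (+ a)) (pos-^ a k))

  series : ℕ → ℚ
  series n = ℚ-Sum.sum {suc n} (λ k → ((+ (((2 ℕ.* toℕ k) C toℕ k) ℕ.^ 2)) ℚ./ (32 ℕ.^ toℕ k)) {{ℕ.m^n≢0 32 (toℕ k)}})

  series-over : ∀ n → series n IsOver (+ 32) ^ n ≡ ∑ (suc n) (λ k → bin (2 ℕ.* k) k * bin (2 ℕ.* k) k * (+ 32) ^ (n ∸ k))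
  series-over n = over-sum (suc n) ((+ 32) ^ n) (λ i → term (toℕ i) (ℕ.s≤s⁻¹ (toℕ<n i)))
    where
    term : ∀ k → k ≤ n → ((+ (((2 ℕ.* k) C k) ℕ.^ 2)) ℚ./ (32 ℕ.^ k)) {{ℕ.m^n≢0 32 k}} IsOver (+ 32) ^ n ≡
           bin (2 ℕ.* k) k * bin (2 ℕ.* k) k * (+ 32) ^ (n ∸ k)
    term k k≤n = subst (λ v → ((+ (((2 ℕ.* k) C k) ℕ.^ 2)) ℚ./ (32 ℕ.^ k)) {{ℕ.m^n≢0 32 k}} IsOver v ≡
                   bin (2 ℕ.* k) k * bin (2 ℕ.* k) k * (+ 32) ^ (n ∸ k))
      (trans (cong (_* (+ 32) ^ (n ∸ k)) (pos-^ 32 k)) (trans (sym (^-distribˡ-+-* (+ 32) k (n ∸ k))) (cong ((+ 32) ^_) (ℕ.m+[n∸m]≡n k≤n))))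
      (subst (λ v → ((+ (((2 ℕ.* k) C k) ℕ.^ 2)) ℚ./ (32 ℕ.^ k)) {{ℕ.m^n≢0 32 k}} IsOver + (32 ℕ.^ k) * (+ 32) ^ (n ∸ k) ≡ v * (+ 32) ^ (n ∸ k))
        square (over-/ (+ (((2 ℕ.* k) C k) ℕ.^ 2)) (32 ℕ.^ k) ((+ 32) ^ (n ∸ k)) {{ℕ.m^n≢0 32 k}}))
      where
      square : + (((2 ℕ.* k) C k) ℕ.^ 2) ≡ bin (2 ℕ.* k) k * bin (2 ℕ.* k) k
      square = trans (pos-^ ((2 ℕ.* k) C k) 2) (trans (cong (_*_ (+ ((2 ℕ.* k) C k))) (*-identityʳ (+ ((2 ℕ.* k) C k))))
        (cong₂ _*_ (sym (bin≡C (2 ℕ.* k) k)) (sym (bin≡C (2 ℕ.* k) k))))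

  module RationalCongruence (q : ℕ) (p-prime : Prime (suc q)) where

    open Modular q p-prime

    private
      -- The reduced denominator of x divides any d that clears the denominator of x.
      denominator-coprime : ∀ {x d y} → Unit d → x IsOver d ≡ y → Coprime (↧ₙ x) p
      denominator-coprime {x@(ℚ.mkℚ _ _ coprime)} {d} {y} ud h {k} (k∣den , k∣p) = prime-divisor k∣p
        where
        den∣d : ↧ₙ x ℕ.∣ ∣ d ∣
        den∣d = coprime-divisor (ℕ.sym (ℕ.recompute coprime))
          (ℕ.divides ∣ y ∣ (trans (sym (abs-* (↥ x) d)) (trans (cong ∣_∣ (over-cross h)) (abs-* y (↧ x)))))
        prime-divisor : k ℕ.∣ p → k ≡ 1
        prime-divisor k∣p with prime⇒irreducible p-prime k∣p
        ... | inj₁ k≡1 = k≡1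
        ... | inj₂ refl = contradiction (∣⇒≈ (subst (p ℕ.∣_) (cong ∣_∣ (sym (+-identityʳ d))) (ℕ.∣-trans k∣den den∣d))) ud

    -- d times the reduced numerator of x - x′ is y - y′ times its reduced denominator, hence
    -- divisible by p², and d is a unit.
    over⇒≡ : ∀ {x x′ d y y′} → Unit d → x IsOver d ≡ y → x′ IsOver d ≡ y′ → y ≈ y′ [ P² ] → x ≡ x′ [mod p ^ 2 ]
    over⇒≡ {x} {x′} {d} {y} {y′} ud h h′ y≈y′ = record
      { denominatorˡ-coprime = denominator-coprime ud h
      ; denominatorʳ-coprime = denominator-coprime ud h′
      ; numerator-divisible  = subst (ℕ._∣ ∣ ↥ (x ℚ.- x′) ∣) (cong (p ℕ.*_) (sym (ℕ.*-identityʳ p)))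
          (subst (p ℕ.* p ℕ.∣_) (cong ∣_∣ (+-identityʳ (↥ (x ℚ.- x′)))) (subst (ℕ._∣ ∣ ↥ (x ℚ.- x′) - 0ℤ ∣) (abs-* P P) (≈⇒∣ numerator≈0)))
      }
      where
      open ≈-Reasoning P²
      numerator≈0 : ↥ (x ℚ.- x′) ≈ 0ℤ [ P² ]
      numerator≈0 = cancel² ud (begin
        d * ↥ (x ℚ.- x′)              ≡⟨ *-comm d (↥ (x ℚ.- x′)) ⟩
        ↥ (x ℚ.- x′) * d              ≡⟨ over-cross (over-minus h h′) ⟩
        (y - y′) * ↧ (x ℚ.- x′)       ≈⟨ lin₁ (↧ (x ℚ.- x′)) 0ℤ y≈y′ (lemma y y′ (↧ (x ℚ.- x′)) d P²) ⟩
        d * 0ℤ                        ∎)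
        where
        lemma : ∀ y y′ v d N → (y - y′) * v - d * 0ℤ ≡ v * (y - y′) + 0ℤ * N
        lemma = solve-∀

  -- The two residue classes of p modulo 4

  half : ∀ n → (suc (2 ℕ.* n) ∸ 1) ℕ./ 2 ≡ n
  half n = trans (cong (ℕ._/ 2) (ℕ.*-comm 2 n)) (ℕ.m*n/n≡m n 2)

  series-3-mod-4 : ∀ p j → p ≡ suc (2 ℕ.* suc (j ℕ.* 2)) → Prime p → series ((p ∸ 1) ℕ./ 2) ≡ 0ℚ [mod p ^ 2 ]
  series-3-mod-4 p j refl p-prime = subst (λ k → series k ≡ 0ℚ [mod p ^ 2 ]) (sym (half n))
    (over⇒≡ (Unit-^ n 32-unit) (series-over n) (over (ℚ.*-zeroˡ (fromℤ ((+ 32) ^ n)))) (begin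
      ∑ (suc n) (λ k → central k * central k * (+ 32) ^ (n ∸ k))   ≈⟨ central-sum≈ ⟩
      (+ 16) ^ n * coefficient n n n                              ≡⟨ cong (_*_ ((+ 16) ^ n)) (coefficient-odd n j) ⟩
      (+ 16) ^ n * 0ℤ                                             ≡⟨ *-zeroʳ ((+ 16) ^ n) ⟩
      0ℤ                                                          ∎))
    where
    n = suc (j ℕ.* 2)
    open Modular (2 ℕ.* n) p-prime using (P²; Unit-^)
    open CentralSum n p-prime
    open Character n p-prime using (unit-2)
    open RationalCongruence (2 ℕ.* n) p-prime
    open ≈-Reasoning P²
    -- `(+ 2) ^ 5` computes to `+ 32`.
    32-unit = Unit-^ {+ 2} 5 unit-2

  fromℤ-minus-quotient-over : ∀ x y .{{_ : ℚ.NonZero (fromℤ y)}} → fromℤ y ℚ.- fromℤ x ℚ.÷ fromℤ y IsOver y ≡ y * y - x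
  fromℤ-minus-quotient-over x y = over-minus {fromℤ y} {fromℤ x ℚ.÷ fromℤ y} (over (sym (fromℤ-* y y))) (over (begin
    fromℤ x ℚ.* (ℚ.1/ fromℤ y) ℚ.* fromℤ y      ≡⟨ ℚ.*-assoc (fromℤ x) (ℚ.1/ fromℤ y) (fromℤ y) ⟩
    fromℤ x ℚ.* ((ℚ.1/ fromℤ y) ℚ.* fromℤ y)    ≡⟨ cong (fromℤ x ℚ.*_) (ℚ.*-inverseˡ (fromℤ y)) ⟩
    fromℤ x ℚ.* ℚ.1ℚ                            ≡⟨ ℚ.*-identityʳ (fromℤ x) ⟩
    fromℤ x                                     ∎))
    where open ≡-Reasoning

  series-1-mod-4 : ∀ p m → p ≡ suc (2 ℕ.* (m ℕ.* 2)) → Prime p → ∀ a b → + p ≡ a * a + b * b → (4∣a-1 : + 4 ℤᵘ.∣ a - + 1) →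
    series ((p ∸ 1) ℕ./ 2) ≡ fromℤ (+ 2 * a) ℚ.- (fromℤ (+ p) ℚ.÷ fromℤ (+ 2 * a)) {{4∣a-1⇒2a≢0 a 4∣a-1}} [mod p ^ 2 ]
  series-1-mod-4 p m refl p-prime a b p≡a²+b² 4∣a-1 =
    subst (λ k → series k ≡ fromℤ α ℚ.- (fromℤ (+ p) ℚ.÷ fromℤ α) {{4∣a-1⇒2a≢0 a 4∣a-1}} [mod p ^ 2 ]) (sym (half n))
      -- Both sides are brought over 32^n · 2a, which is prime to p.
      (over⇒≡ (Unit-* 32^n-unit (unit-2a {a} {b} p≡a²+b² a≈1)) (over-scale α (series-over n))
        (subst (λ d → (fromℤ α ℚ.- (fromℤ (+ p) ℚ.÷ fromℤ α) {{4∣a-1⇒2a≢0 a 4∣a-1}}) IsOver d ≡ (α * α - P) * (+ 32) ^ n)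
          (*-comm α ((+ 32) ^ n))
          (over-scale ((+ 32) ^ n) (fromℤ-minus-quotient-over (+ p) α {{4∣a-1⇒2a≢0 a 4∣a-1}})))
        (≈-trans (central-sum-quarter {a} {b} p≡a²+b² a≈1) (reflexive (*-comm ((+ 32) ^ n) (α * α - P)))))
    where
    n = m ℕ.* 2
    α = + 2 * a
    open Modular (2 ℕ.* n) p-prime using (P; Unit; Unit-^; Unit-*)
    open Quarter m p-prime
    open Character n p-prime using (unit-2)
    open RationalCongruence (2 ℕ.* n) p-prime
    32^n-unit : Unit ((+ 32) ^ n)
    32^n-unit = Unit-^ n (Unit-^ {+ 2} 5 unit-2)
    a≈1 : a ≈ 1ℤ [ + 4 ]
    a≈1 = ∣⇒≈ 4∣a-1

  series-congruence : ∀ p → Prime p → ¬ (+ 2 ℤᵘ.∣ + p) →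
    (+ 4 ℤᵘ.∣ + p - + 3 → series ((p ∸ 1) ℕ./ 2) ≡ 0ℚ [mod p ^ 2 ])
    ×
    (+ 4 ℤᵘ.∣ + p - + 1 → ∀ (a b : ℤ) → + p ≡ a * a + b * b → (4∣a-1 : + 4 ℤᵘ.∣ a - + 1) →
      series ((p ∸ 1) ℕ./ 2) ≡ fromℤ (+ 2 * a) ℚ.- (fromℤ (+ p) ℚ.÷ fromℤ (+ 2 * a)) {{4∣a-1⇒2a≢0 a 4∣a-1}} [mod p ^ 2 ])
  series-congruence 0 p-prime 2∤p = contradiction (ℕ.divides 0 refl) 2∤p
  series-congruence 1 p-prime 2∤p = contradiction (ℕ.nonTrivial⇒n>1 1 {{prime⇒nonTrivial p-prime}}) ℕ.1+n≰n
  series-congruence 2 p-prime 2∤p = contradiction ℕ.∣-refl 2∤p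
  -- With three successors exposed, p - 3 and p - 1 compute to `+ r` and `+ suc (suc r)`, so the
  -- hypotheses become divisibilities in ℕ.
  series-congruence (suc (suc (suc r))) p-prime 2∤p = case₃ , case₁
    where
    p = suc (suc (suc r))
    p≡3+4j : ∀ j → 3 ℕ.+ j ℕ.* 4 ≡ suc (2 ℕ.* suc (j ℕ.* 2))
    p≡3+4j = ℕ.solve-∀
    p≡1+4m : ∀ m → 1 ℕ.+ m ℕ.* 4 ≡ suc (2 ℕ.* (m ℕ.* 2))
    p≡1+4m = ℕ.solve-∀
    case₃ : 4 ℕ.∣ r → series ((p ∸ 1) ℕ./ 2) ≡ 0ℚ [mod p ^ 2 ]
    case₃ (ℕ.divides j r≡4j) = series-3-mod-4 p j (trans (cong (3 ℕ.+_) r≡4j) (p≡3+4j j)) p-prime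
    case₁ : 4 ℕ.∣ suc (suc r) → ∀ a b → + p ≡ a * a + b * b → (4∣a-1 : + 4 ℤᵘ.∣ a - + 1) →
      series ((p ∸ 1) ℕ./ 2) ≡ fromℤ (+ 2 * a) ℚ.- (fromℤ (+ p) ℚ.÷ fromℤ (+ 2 * a)) {{4∣a-1⇒2a≢0 a 4∣a-1}} [mod p ^ 2 ]
    case₁ (ℕ.divides m 2+r≡4m) = series-1-mod-4 p m (trans (cong suc 2+r≡4m) (p≡1+4m m)) p-prime

open import Data.Fin.Base using (toℕ)
open import Data.Integer.Base using (ℤ; +_; _-_; _+_; _*_)
open import Data.Integer.Divisibility using (_∣_)
open import Data.Nat.Base as ℕ using (ℕ; _∸_; _^_)
open import Data.Nat.Combinatorics using (_C_)
open import Data.Nat.Primality using (Prime)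
open import Data.Nat.Properties using (m^n≢0)
open import Data.Product.Base using (_×_)
open import Data.Rational.Base as ℚ using (0ℚ; _/_; _÷_)
open import Data.Rational.Literals using (fromℤ)
open import Data.Rational.Properties using (+-0-monoid)
open import Algebra.Properties.Monoid.Sum +-0-monoid using (sum⁺-syntax)
open import Relation.Binary.PropositionalEquality.Core using (_≡_)
open import Relation.Nullary.Negation.Core using (¬_)
open import Defs

open CentralBinomialSum using (series-congruence)

theorem2p2 : ∀ (p : ℕ) → Prime p → ¬ (+ 2 ∣ + p) →
    let S = ∑[ k ≤ (p ∸ 1) ℕ./ 2 ] (((+ (((2 ℕ.* toℕ k) C toℕ k) ^ 2)) / (32 ^ toℕ k)) {{m^n≢0 32 (toℕ k)}}) in
    (+ 4 ∣ + p - + 3 → S ≡ 0ℚ [mod p ^ 2 ])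
    ×
    (+ 4 ∣ + p - + 1 → ∀ (a b : ℤ) → + p ≡ a * a + b * b → (4∣a-1 : + 4 ∣ a - + 1) →
    S ≡ fromℤ (+ 2 * a) ℚ.- (fromℤ (+ p) ÷ fromℤ (+ 2 * a)) {{4∣a-1⇒2a≢0 a 4∣a-1}} [mod p ^ 2 ])
theorem2p2 = series-congruence
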